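{- Let $\mathcal{S}=\{(1,b_1),\dots,(1,b_m)\}$ be a set of steps with distinct $b_\ell\in\mathbb{Z}$, with positive real weights $w_1,\dots,w_m$, characteristic polynomial $P(X)=\sum_{\ell=1}^m w_\ell X^{b_\ell}$, and $c=-\min_\ell b_\ell\ge1$. For $j\ge0$, the generating function $T_j(z)$ of weighted meanders with these steps and weights starting at level $j$ is given by $$T_j(z)=T(z)\left(1-\sum_{\ell=1}^{c}\frac{\Big(\prod_{1\le i<k\le c}(X_i-X_k)\Big)\Big|_{X_\ell=1}}{\prod_{1\le i<k\le c}(X_i-X_k)}\,X_\ell^{c+j}\right)=\frac{1}{1-zP(1)}\Big(\sum_{f=0}^{j}h_f(X_1,\dots,X_c)\Big)\prod_{\ell=1}^{c}(1-X_\ell),$$ where $T(z)=\frac1{1-zP(1)}$, $X_1,\dots,X_c$ are the small solutions of the characteristic equation $1-zP(X)=0$, $h_f(X_1,\dots,X_c)=\sum_{1\le i_1\le\dots\le i_f\le c}\prod_{\ell=1}^f X_{i_\ell}$ is the complete homogeneous symmetric polynomial of degree $f$, and $(\cdot)|_{X_\ell=1}$ means that $X_\ell$ is replaced by $1$ in the product.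
   Context: A meander of length $n$ starting at level $j\ge0$ is a lattice path $(0,j)=p_0,p_1,\dots,p_n$ with $p_i-p_{i-1}\in\mathcal{S}$ for all $i$ whose points all have nonnegative second coordinate (the end level is arbitrary). The weight of a path is the product of the weights of its steps (step $(1,b_\ell)$ has weight $w_\ell$). $T_j(z)=\sum_{n\ge0}t_{n,j}z^n$, where $t_{n,j}$ is the total weight of meanders of length $n$ starting at level $j$. The small solutions $X_1,\dots,X_c$ are the $c$ Puiseux series solutions $X\in\bigcup_{m\ge1}\mathbb{C}((z^{1/m}))$ of $1-zP(X)=0$ with positive order in $z$ (i.e. tending to $0$ as $z\to 0$); they are pairwise distinct. -}

module Defs where

open import Level using (Level; _⊔_)
open import Algebra.Bundles using (RawRing)
open import Algebra.Apartness.Bundles using (HeytingField)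
import Algebra.Definitions
import Algebra.Definitions.RawSemiring as RawSemiringDefs
open import Data.Bool.Base using (if_then_else_)
open import Data.Fin.Base as Fin using (Fin; toℕ)
import Data.Fin.Properties as Fin
open import Data.Integer.Base as ℤ using (ℤ; +_; -[1+_])
import Data.Integer.Properties as ℤ
open import Data.List.Base as List using (List; cartesianProductWith; allFin; filter)
open import Data.Nat.Base as ℕ using (ℕ; zero; suc; NonZero)
open import Data.Nat.Properties using (m*n≢0)
open import Data.Nat.Divisibility using (_∣?_; divides)
open import Data.Product using (∃; ∃-syntax; _×_; _,_)
open import Data.Sum.Base using (_⊎_)
open import Data.Vec.Base as Vec using (Vec; []; _∷_)
open import Data.Vec.Functional using (Vector; updateAt)
open import Data.Vec.Relation.Unary.All using (All; all?)
open import Data.Vec.Relation.Unary.Linked using (linked?)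
open import Function.Base using (const)
open import Function.Bundles using (_⇔_)
open import Function.Definitions using (Injective)
open import Relation.Binary.Core using (Rel)
open import Relation.Binary.PropositionalEquality.Core using (_≡_)
open import Relation.Binary.Structures using (IsStrictPartialOrder)
open import Relation.Nullary.Decidable.Core using (yes; no; does)

-- The real numbers, axiomatised as an Archimedean, Cauchy-complete ordered
-- field; these axioms determine ℝ up to isomorphism.  Invertibility is
-- governed by apartness, so that constructive and classical reals are both
-- models.

record Reals a ℓ₁ ℓ₂ : Set (Level.suc (a ⊔ ℓ₁ ⊔ ℓ₂)) where
  infix 4 _<_
  field
    heytingField : HeytingField a ℓ₁ ℓ₂

  open HeytingField heytingField public

  rawRing : RawRing a ℓ₁
  rawRing = record
    { _≈_ = _≈_ ; _+_ = _+_ ; _*_ = _*_ ; -_ = -_ ; 0# = 0# ; 1# = 1# }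

  open RawSemiringDefs (RawRing.rawSemiring rawRing) using () renaming (_×_ to _·_)

  field
    _<_                  : Rel Carrier ℓ₂
    isStrictPartialOrder : IsStrictPartialOrder _≈_ _<_
    #⇔<⊎>                : ∀ {x y} → x # y ⇔ (x < y ⊎ y < x)
    +-monoˡ-<            : ∀ {x y} z → x < y → x + z < y + z
    *-pos                : ∀ {x y} → 0# < x → 0# < y → 0# < x * y
    archimedean          : ∀ x → ∃[ n ] x < n · 1#

  IsCauchy : (ℕ → Carrier) → Set (a ⊔ ℓ₂)
  IsCauchy s = ∀ ε → 0# < ε →
    ∃[ N ] ∀ m n → N ℕ.≤ m → N ℕ.≤ n → s m - s n < ε

  _ConvergesTo_ : (ℕ → Carrier) → Carrier → Set (a ⊔ ℓ₂)
  s ConvergesTo l = ∀ ε → 0# < ε →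
    ∃[ N ] ∀ n → N ℕ.≤ n → s n - l < ε × l - s n < ε

  field
    complete : ∀ s → IsCauchy s → ∃[ l ] s ConvergesTo l

module Complex {a ℓ₁ ℓ₂} (ℝ : Reals a ℓ₁ ℓ₂) where
  open Reals ℝ

  infix 5 _+i_
  record ℂ : Set a where
    constructor _+i_
    field
      re im : Carrier

  ℂ-rawRing : RawRing a ℓ₁
  ℂ-rawRing = record
    { Carrier = ℂ
    ; _≈_     = λ { (x +i y) (u +i v) → x ≈ u × y ≈ v }
    ; _+_     = λ { (x +i y) (u +i v) → (x + u) +i (y + v) }
    ; _*_     = λ { (x +i y) (u +i v) → (x * u - y * v) +i (x * v + y * u) }
    ; -_      = λ { (x +i y) → (- x) +i (- y) }
    ; 0#      = 0# +i 0#
    ; 1#      = 1# +i 0#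
    }

  fromℝ : Carrier → ℂ
  fromℝ x = x +i 0#

-- All tuples (i₁ , … , iₙ) of elements of Fin k, each listed once.

tuples : ∀ k n → List (Vec (Fin k) n)
tuples k zero    = [] List.∷ List.[]
tuples k (suc n) = cartesianProductWith _∷_ (allFin k) (tuples k n)

module RingNotation {a ℓ} (R : RawRing a ℓ) where
  open RawRing R public
  open RawSemiringDefs rawSemiring public using (sum; product; _^_)
  open Algebra.Definitions _≈_ using () renaming (Invertible to Invertible′)

  infixl 6 _-_
  _-_ : Carrier → Carrier → Carrier
  x - y = x + (- y)

  Invertible : Carrier → Set (a ⊔ ℓ)
  Invertible = Invertible′ 1# _*_

  -- x to the integer power e, where x⁻¹ is the inverse of x.
  zpow : (x x⁻¹ : Carrier) → ℤ → Carrier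
  zpow x x⁻¹ (+ n)    = x ^ n
  zpow x x⁻¹ -[1+ n ] = x⁻¹ ^ suc n

  listSum : List Carrier → Carrier
  listSum = List.foldr _+_ 0#

  vecProduct : ∀ {n} → Vec Carrier n → Carrier
  vecProduct = Vec.foldr′ _*_ 1#

  -- ∏_{i<k} (Xᵢ − Xₖ)
  vandermonde : ∀ {n} → Vector Carrier n → Carrier
  vandermonde X = product λ i → product λ k →
    if does (i Fin.<? k) then X i - X k else 1#

  _[_]≔1 : ∀ {n} → Vector Carrier n → Fin n → Vector Carrier n
  X [ ℓ ]≔1 = updateAt X ℓ (const 1#)

  -- Complete homogeneous symmetric polynomial: the sum over all weakly
  -- increasing tuples i₁ ≤ … ≤ i_f.
  h : ∀ {n} → ℕ → Vector Carrier n → Carrier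
  h {n} f X = listSum (List.map (λ is → vecProduct (Vec.map X is))
                                (filter (linked? Fin._≤?_) (tuples n f)))

-- ⋃_{m≥1} K((z^{1/m})).  Elements are fractions in the style of ℚᵘ: the
-- record (den , pole , coeff) stands for Σₙ coeff n · z^{(n − pole)/den}, and
-- two records are equal when their coefficients agree after passing to a
-- common denominator and a common pole.

module PuiseuxSeries {a ℓ} (K : RawRing a ℓ) where
  private module K = RingNotation K

  record Puiseux : Set a where
    field
      den         : ℕ
      {{den≢0}}   : NonZero den
      pole        : ℕ
      coeff       : ℕ → K.Carrier

  open Puiseux

  -- a(t) ↦ a(tᵏ), for k ≥ 1
  inflate : ℕ → (ℕ → K.Carrier) → (ℕ → K.Carrier)
  inflate k a n with k ∣? n
  ... | yes (divides q _) = a q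
  ... | no _              = K.0#

  -- a(t) ↦ tᵏ a(t)
  shift : ℕ → (ℕ → K.Carrier) → (ℕ → K.Carrier)
  shift zero    a n       = a n
  shift (suc k) a zero    = K.0#
  shift (suc k) a (suc n) = shift k a n

  cauchyProduct : (ℕ → K.Carrier) → (ℕ → K.Carrier) → (ℕ → K.Carrier)
  cauchyProduct a b n = K.sum {suc n} λ i → a (toℕ i) K.* b (n ℕ.∸ toℕ i)

  -- The denominator and pole shared by f and g, and the coefficients of f
  -- with respect to these.

  commonDen commonPole : Puiseux → Puiseux → ℕ
  commonDen  f g = den f ℕ.* den g
  commonPole f g = pole f ℕ.* den g ℕ.+ pole g ℕ.* den f

  commonCoeff : Puiseux → Puiseux → (ℕ → K.Carrier)
  commonCoeff f g = shift (pole g ℕ.* den f) (inflate (den g) (coeff f))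

  commonDen≢0 : ∀ f g → NonZero (commonDen f g)
  commonDen≢0 f g = m*n≢0 (den f) (den g)

  infix 4 _≈ₚ_
  _≈ₚ_ : Rel Puiseux ℓ
  f ≈ₚ g = ∀ n → commonCoeff f g n K.≈ commonCoeff g f n

  _+ₚ_ _*ₚ_ : Puiseux → Puiseux → Puiseux
  f +ₚ g = record
    { den   = commonDen f g
    ; den≢0 = commonDen≢0 f g
    ; pole  = commonPole f g
    ; coeff = λ n → commonCoeff f g n K.+ commonCoeff g f n
    }
  f *ₚ g = record
    { den   = commonDen f g
    ; den≢0 = commonDen≢0 f g
    ; pole  = commonPole f g
    ; coeff = cauchyProduct (inflate (den g) (coeff f)) (inflate (den f) (coeff g))
    }

  -ₚ_ : Puiseux → Puiseux
  -ₚ f = record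
    { den = den f ; pole = pole f ; coeff = λ n → K.- coeff f n }

  fromPowerSeries : (ℕ → K.Carrier) → Puiseux
  fromPowerSeries a = record { den = 1 ; pole = 0 ; coeff = a }

  constant : K.Carrier → Puiseux
  constant x = fromPowerSeries λ { zero → x ; (suc _) → K.0# }

  z : Puiseux
  z = fromPowerSeries (shift 1 λ { zero → K.1# ; (suc _) → K.0# })

  rawRing : RawRing a ℓ
  rawRing = record
    { _≈_ = _≈ₚ_ ; _+_ = _+ₚ_ ; _*_ = _*ₚ_ ; -_ = -ₚ_
    ; 0#  = constant K.0# ; 1# = constant K.1# }

  HasPositiveOrder : Puiseux → Set ℓ
  HasPositiveOrder f = ∀ n → n ℕ.≤ pole f → coeff f n K.≈ K.0#

-- Steps (1 , b ℓ) with weights w ℓ, for ℓ : Fin m.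

module Steps {a ℓ} (K : RawRing a ℓ)
             {m : ℕ} (b : Fin m → ℤ) (w : Fin m → RawRing.Carrier K) where
  private module K = RingNotation K
  open PuiseuxSeries K using (Puiseux; HasPositiveOrder; constant; z; fromPowerSeries)
  open RingNotation (PuiseuxSeries.rawRing K)

  -- A path is given by its starting level and its sequence of steps (this is
  -- unambiguous when b is injective); levels lists the second coordinates of
  -- its points p₀ , … , pₙ.
  levels : ∀ {n} → ℤ → Vec (Fin m) n → Vec ℤ (suc n)
  levels j []       = j ∷ []
  levels j (s ∷ ss) = j ∷ levels (j ℤ.+ b s) ss

  meanders : (n j : ℕ) → List (Vec (Fin m) n)
  meanders n j = filter (λ ss → all? (ℤ.+0 ℤ.≤?_) (levels (+ j) ss)) (tuples m n)

  weight : ∀ {n} → Vec (Fin m) n → K.Carrier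
  weight ss = K.vecProduct (Vec.map w ss)

  t : (n j : ℕ) → K.Carrier
  t n j = K.listSum (List.map weight (meanders n j))

  T : ℕ → Puiseux
  T j = fromPowerSeries λ n → t n j

  -- P(X), where X⁻¹ is the inverse of X.
  P : (X X⁻¹ : Puiseux) → Puiseux
  P X X⁻¹ = sum λ ℓ → constant (w ℓ) * zpow X X⁻¹ (b ℓ)

  -- The characteristic equation involves negative powers of X, so that its
  -- solutions are by definition invertible.
  record IsSmallSolution (X : Puiseux) : Set (a ⊔ ℓ) where
    field
      positiveOrder : HasPositiveOrder X
      X⁻¹           : Puiseux
      inverseˡ      : X⁻¹ * X ≈ 1#
      inverseʳ      : X * X⁻¹ ≈ 1#
      solution      : 1# - z * P X X⁻¹ ≈ 0#

  -- X₁ , … , X_c are the pairwise distinct small solutions.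
  record AreTheSmallSolutions {c : ℕ} (X : Vector Puiseux c) : Set (a ⊔ ℓ) where
    field
      isSmallSolution : ∀ i → IsSmallSolution (X i)
      distinct        : Injective _≡_ _≈_ X
      exhaustive      : ∀ Y → IsSmallSolution Y → ∃[ i ] Y ≈ X i

IsMinimum : ∀ {m} → (Fin m → ℤ) → ℤ → Set
IsMinimum b x = (∃[ ℓ ] b ℓ ≡ x) × (∀ ℓ → x ℤ.≤ b ℓ)

module WeightedPaths {a ℓ₁ ℓ₂} (ℝ : Reals a ℓ₁ ℓ₂)
                     {m : ℕ} (b : Fin m → ℤ) (w : Fin m → Reals.Carrier ℝ) where
  open Complex ℝ
  open PuiseuxSeries ℂ-rawRing public using (Puiseux; z)
  open RingNotation (PuiseuxSeries.rawRing ℂ-rawRing) public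
  open Steps ℂ-rawRing b (λ ℓ → fromℝ (w ℓ)) public
    using (P; AreTheSmallSolutions) renaming (T to T[_])

{-# OPTIONS --safe #-}
module Submission where

-- Kernel method.  Extend T to negative levels by 0 and let λ_ℓ be the value at
-- 1 of the ℓ-th Lagrange polynomial for the nodes X₁ , … , X_c.  Splitting off
-- the first step of a path gives a recurrence in j for (1 − zP(1)) T_j, and
-- 1 − Σ λ_ℓ X_ℓ^{c+j} satisfies the same recurrence because zP(X_ℓ) = 1; for
-- −c ≤ j < 0 it vanishes, since interpolation is exact in degrees below c.
-- Each round of the recurrence gains a factor z, so the difference of the two
-- is divisible by every power of z, hence 0.  The second formula is the
-- divided difference of x^{c+j} at 1 , X₁ , … , X_c.
--
-- That the λ_ℓ exist constructively, i.e. that X_i − X_k is invertible for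
-- i ≠ k, comes from the leading terms: X_i = u_i z^{1/c} + … with u_i^c equal
-- to the weight of the lowest step, and two solutions either coincide or have
-- leading coefficients that are apart.

open import Defs
open import Data.Nat.Base as ℕ using (ℕ; zero; suc; z≤n; s≤s; NonZero) renaming (_≤_ to _≤ℕ_; _+_ to _+ℕ_)
open import Data.Integer.Base as ℤ using (ℤ; +_; -[1+_]; _⊖_) renaming (-_ to -ℤ_)
open import Data.Fin.Base as Fin using (Fin; zero; suc; toℕ; fromℕ; inject₁)
open import Data.Product using (Σ; Σ-syntax; ∃-syntax; _×_; _,_; proj₁; proj₂)
open import Data.Vec.Functional using (Vector; tail; removeAt; updateAt) renaming (_∷_ to _◂_)
open import Function.Definitions using (Injective)
open import Relation.Binary.PropositionalEquality.Core as ≡ using (_≡_; _≢_)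
open import Algebra.Apartness.Bundles using (HeytingField; HeytingCommutativeRing)
open import Algebra.Bundles using (CommutativeRing; RawRing)
import Algebra.Definitions.RawSemiring as RawSemiringDefinitions
import Algebra.Properties.CommutativeMonoid.Sum as CommutativeMonoidSum
import Algebra.Properties.Ring as RingProperties
import Algebra.Properties.Semiring.Exp as SemiringExp
import Algebra.Properties.Semiring.Mult.TCOptimised as SemiringMult
import Algebra.Properties.Semiring.Sum as SemiringSum
import Algebra.Solver.Ring as RingSolver
import Algebra.Solver.Ring.AlmostCommutativeRing as ACR
open import Algebra.Structures using (IsCommutativeRing)
open import Data.Bool.Base using (if_then_else_; true; false)
import Data.Fin.Properties as Fin
import Data.Integer.Properties as ℤ
open import Data.List.Base as List using (List; filter; cartesianProductWith; _++_)
import Data.List.Properties as List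
import Data.List.Relation.Unary.All as ListAll
open import Data.Maybe.Base as Maybe using (Maybe)
import Data.Nat.Properties as ℕ
open import Data.Nat.Divisibility as ℕ∣ using (_∣_; _∣?_; divides; divides-refl)
open import Data.Nat.Induction using (<-rec)
import Data.Nat.Tactic.RingSolver as ℕSolver
open import Data.Sum.Base as Sum using (_⊎_; inj₁; inj₂)
open import Data.Unit.Polymorphic using (⊤; tt)
open import Data.Vec.Base as Vec using (Vec)
open import Data.Vec.Relation.Unary.All as All using (All; all?)
open import Data.Vec.Relation.Unary.Linked as Linked using (Linked; linked?)
open import Function.Base using (_∘_; _∋_; const; id)
open import Function.Bundles using (Equivalence)
open import Level using (_⊔_)
open import Relation.Binary.Consequences using (dec⇒weaklyDec)
open import Relation.Binary.Definitions using (tri<; tri≈; tri>)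
import Relation.Binary.Reasoning.Setoid as SetoidReasoning
open import Relation.Binary.Structures using (IsStrictPartialOrder)
open import Relation.Nullary using (¬_; Dec; yes; no; does; contradiction)
open import Relation.Unary using (Pred; Decidable; _≐_)

-- The Lagrange form `1 − Σ λ_ℓ X_ℓ^N` makes the recurrence evident, but it divides by the
-- Vandermonde product, which for c ≥ 2 has no inverse among power series in a root of z, and
-- divisibility by powers of z is an argument about such power series. Newton's form of the same
-- quantity, the product of the `1 − X_ℓ` times the divided difference `H`, is a polynomial in the
-- X_ℓ. So the difference to be killed lives in K[[t]] with t = z^{1/D}, where D is a common
-- denominator of the X_ℓ. Its recurrence is proved among Puiseux series and pulled back along the
-- injective inclusion; there z becomes t^D with D ≥ 1, and induction on coefficients applies.
-- Indexing by N = c + level makes every level from -c on a natural number. Equality in ℂ is not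
-- decidable constructively, and distinctness of the X_ℓ is only a refutation of equality. Orders
-- are therefore found by comparing natural numbers, and units by locality: if a sum is a unit, so
-- is one of its summands.

-- Polynomial identities in commutative rings.

module IntegerSolver {a ℓ} (R : CommutativeRing a ℓ) where
  open CommutativeRing R
  open RingProperties ring
  open SemiringMult semiring renaming (_×_ to infixl 8 _·_)
  open SetoidReasoning setoid

  private
    ⟦_⟧ℤ : ℤ → Carrier
    ⟦ + n ⟧ℤ = n · 1#
    ⟦ -[1+ n ] ⟧ℤ = - (suc n · 1#)

    cancel-head : ∀ x y z → (x + y) - (x + z) ≈ y - z
    cancel-head x y z = begin
      (x + y) - (x + z)        ≈⟨ +-congˡ (-‿+-comm x z) ⟨
      (x + y) + (- x + - z)    ≈⟨ +-congʳ (+-comm x y) ⟩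
      (y + x) + (- x + - z)    ≈⟨ +-assoc y x _ ⟩
      y + (x + (- x + - z))    ≈⟨ +-congˡ (+-assoc x _ _) ⟨
      y + ((x + - x) + - z)    ≈⟨ +-congˡ (+-congʳ (-‿inverseʳ x)) ⟩
      y + (0# + - z)           ≈⟨ +-congˡ (+-identityˡ _) ⟩
      y - z                    ∎

    ⊖-homo : ∀ m n → ⟦ m ⊖ n ⟧ℤ ≈ m · 1# - n · 1#
    ⊖-homo zero    zero    = sym (-‿inverseʳ 0#)
    ⊖-homo zero    (suc n) = sym (+-identityˡ _)
    ⊖-homo (suc m) zero    = sym (trans (+-congˡ -0#≈0#) (+-identityʳ _))
    ⊖-homo (suc m) (suc n) = begin
      ⟦ suc m ⊖ suc n ⟧ℤ       ≡⟨ ≡.cong ⟦_⟧ℤ (ℤ.[1+m]⊖[1+n]≡m⊖n m n) ⟩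
      ⟦ m ⊖ n ⟧ℤ               ≈⟨ ⊖-homo m n ⟩
      m · 1# - n · 1#          ≈⟨ cancel-head 1# _ _ ⟨
      (1# + m · 1#) - (1# + n · 1#) ≈⟨ +-cong (1+× m 1#) (-‿cong (1+× n 1#)) ⟨
      suc m · 1# - suc n · 1#  ∎

    +-homo : ∀ x y → ⟦ x ℤ.+ y ⟧ℤ ≈ ⟦ x ⟧ℤ + ⟦ y ⟧ℤ
    +-homo (+ m) (+ n)       = ×-homo-+ 1# m n
    +-homo (+ m) -[1+ n ]    = ⊖-homo m (suc n)
    +-homo -[1+ m ] (+ n)    = trans (⊖-homo n (suc m)) (+-comm _ _)
    +-homo -[1+ m ] -[1+ n ] = begin
      - (suc (suc (m ℕ.+ n)) · 1#)      ≡⟨ ≡.cong (λ k → - (k · 1#)) (≡.sym (ℕ.+-suc (suc m) n)) ⟩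
      - ((suc m ℕ.+ suc n) · 1#)        ≈⟨ -‿cong (×-homo-+ 1# (suc m) (suc n)) ⟩
      - (suc m · 1# + suc n · 1#)       ≈⟨ -‿+-comm _ _ ⟨
      - (suc m · 1#) + - (suc n · 1#)   ∎

    -‿homo : ∀ x → ⟦ ℤ.- x ⟧ℤ ≈ - ⟦ x ⟧ℤ
    -‿homo (+ zero)  = sym -0#≈0#
    -‿homo (+ suc n) = refl
    -‿homo -[1+ n ]  = sym (-‿involutive _)

    +*-homo : ∀ m y → ⟦ + m ℤ.* y ⟧ℤ ≈ (m · 1#) * ⟦ y ⟧ℤ
    +*-homo zero y = begin
      ⟦ + 0 ℤ.* y ⟧ℤ ≡⟨ ≡.cong ⟦_⟧ℤ (ℤ.*-zeroˡ y) ⟩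
      0#             ≈⟨ zeroˡ _ ⟨
      0# * ⟦ y ⟧ℤ    ∎
    +*-homo (suc m) y = begin
      ⟦ + suc m ℤ.* y ⟧ℤ              ≡⟨ ≡.cong ⟦_⟧ℤ (ℤ.suc-* (+ m) y) ⟩
      ⟦ y ℤ.+ + m ℤ.* y ⟧ℤ            ≈⟨ +-homo y (+ m ℤ.* y) ⟩
      ⟦ y ⟧ℤ + ⟦ + m ℤ.* y ⟧ℤ         ≈⟨ +-cong (sym (*-identityˡ _)) (+*-homo m y) ⟩
      1# * ⟦ y ⟧ℤ + m · 1# * ⟦ y ⟧ℤ   ≈⟨ distribʳ _ _ _ ⟨
      (1# + m · 1#) * ⟦ y ⟧ℤ          ≈⟨ *-congʳ (1+× m 1#) ⟨
      (suc m · 1#) * ⟦ y ⟧ℤ           ∎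

    *-homo : ∀ x y → ⟦ x ℤ.* y ⟧ℤ ≈ ⟦ x ⟧ℤ * ⟦ y ⟧ℤ
    *-homo (+ m)    y = +*-homo m y
    *-homo -[1+ m ] y = begin
      ⟦ -[1+ m ] ℤ.* y ⟧ℤ         ≡⟨ ≡.cong ⟦_⟧ℤ (≡.sym (ℤ.neg-distribˡ-* (+ suc m) y)) ⟩
      ⟦ ℤ.- (+ suc m ℤ.* y) ⟧ℤ    ≈⟨ -‿homo (+ suc m ℤ.* y) ⟩
      - ⟦ + suc m ℤ.* y ⟧ℤ        ≈⟨ -‿cong (+*-homo (suc m) y) ⟩
      - ((suc m · 1#) * ⟦ y ⟧ℤ)   ≈⟨ -‿distribˡ-* _ _ ⟩
      - (suc m · 1#) * ⟦ y ⟧ℤ     ∎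

    almostCommutativeRing : ACR.AlmostCommutativeRing a ℓ
    almostCommutativeRing = ACR.fromCommutativeRing R

    morphism : CommutativeRing.rawRing ℤ.+-*-commutativeRing
                 ACR.-Raw-AlmostCommutative⟶ almostCommutativeRing
    morphism = record
      { ⟦_⟧ = ⟦_⟧ℤ ; +-homo = +-homo ; *-homo = *-homo ; -‿homo = -‿homo
      ; 0-homo = refl ; 1-homo = refl }

    -- Equality in R need not be decidable, but that of ℤ is. Integer coefficients thus let the
    -- normaliser collect and cancel terms over any commutative ring.
    _coeff≟_ : ∀ x y → Maybe (⟦ x ⟧ℤ ≈ ⟦ y ⟧ℤ)
    x coeff≟ y = Maybe.map (λ x≡y → reflexive (≡.cong ⟦_⟧ℤ x≡y)) (dec⇒weaklyDec ℤ._≟_ x y)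

  open RingSolver (CommutativeRing.rawRing ℤ.+-*-commutativeRing)
    almostCommutativeRing morphism _coeff≟_ public
    using (solve; _:+_; _:*_; _:-_; :-_; _:=_; con)

module RingKit {a ℓ} (R : CommutativeRing a ℓ) where
  open CommutativeRing R public hiding (_-_; zero)
  open RingNotation rawRing public
    using (_-_; sum; product; _^_; zpow; Invertible; listSum; vecProduct; vandermonde; _[_]≔1; h)
  open RingProperties ring public
  open RawSemiringDefinitions (RawRing.rawSemiring rawRing) public using () renaming (_×_ to _·_)
  open SemiringExp semiring public using (^-congˡ; ^-homo-*)
  open SemiringSum semiring public
    using (*-distribˡ-sum; ∑-distrib-+; ∑-comm; sum-cong-≋; sum-remove; sum-replicate-zero; sum-init-last)
  open CommutativeMonoidSum *-commutativeMonoid public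
    using () renaming (sum-cong-≋ to product-cong; sum-remove to product-remove)
  open IntegerSolver R public
  open SetoidReasoning setoid public

  Regular : Carrier → Set (a ⊔ ℓ)
  Regular x = ∀ y → x * y ≈ 0# → y ≈ 0#

  x≈y⇒x-y≈0 : ∀ {x y} → x ≈ y → x - y ≈ 0#
  x≈y⇒x-y≈0 x≈y = trans (+-congʳ x≈y) (-‿inverseʳ _)

  x-y≈0⇒x≈y : ∀ {x y} → x - y ≈ 0# → x ≈ y
  x-y≈0⇒x≈y {x} {y} eq = begin
    x            ≈⟨ solve 2 (λ x y → x := (x :- y) :+ y) refl x y ⟩
    (x - y) + y  ≈⟨ +-congʳ eq ⟩
    0# + y       ≈⟨ +-identityˡ y ⟩
    y            ∎

  sum-neg : ∀ {n} (f : Vector Carrier n) → - sum f ≈ sum (λ i → - f i)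
  sum-neg {zero}  f = -0#≈0#
  sum-neg {suc n} f = trans (sym (-‿+-comm _ _)) (+-congˡ (sum-neg (tail f)))

  sum-zero : ∀ {n} {f : Vector Carrier n} → (∀ i → f i ≈ 0#) → sum f ≈ 0#
  sum-zero {n} f≈0 = trans (sum-cong-≋ f≈0) (sum-replicate-zero n)

  1^n≈1 : ∀ n → 1# ^ n ≈ 1#
  1^n≈1 zero    = refl
  1^n≈1 (suc n) = trans (*-identityˡ _) (1^n≈1 n)

-- Vandermonde products, divided differences and Lagrange interpolation.

module Vandermonde {a ℓ} (R : CommutativeRing a ℓ) where
  open RingKit R

  altSum : ∀ {n} → Vector Carrier n → Carrier
  altSum {zero}  g = 0#
  altSum {suc n} g = g zero - altSum (tail g)

  altSum-cong : ∀ {n} {f g : Vector Carrier n} → (∀ i → f i ≈ g i) → altSum f ≈ altSum g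
  altSum-cong {zero}  f≈g = refl
  altSum-cong {suc n} f≈g = +-cong (f≈g zero) (-‿cong (altSum-cong (f≈g ∘ suc)))

  *-distribˡ-altSum : ∀ {n} x (f : Vector Carrier n) → x * altSum f ≈ altSum (λ i → x * f i)
  *-distribˡ-altSum {zero}  x f = zeroʳ x
  *-distribˡ-altSum {suc n} x f = begin
    x * (f zero - altSum (tail f))
      ≈⟨ solve 3 (λ x y z → x :* (y :- z) := x :* y :- x :* z) refl x _ _ ⟩
    x * f zero - x * altSum (tail f)
      ≈⟨ +-congˡ (-‿cong (*-distribˡ-altSum x (tail f))) ⟩
    x * f zero - altSum (λ i → x * f (suc i)) ∎

  altSum-+ : ∀ {n} (f g : Vector Carrier n) → altSum (λ i → f i + g i) ≈ altSum f + altSum g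
  altSum-+ {zero}  f g = sym (+-identityˡ _)
  altSum-+ {suc n} f g = trans (+-congˡ (-‿cong (altSum-+ (tail f) (tail g))))
    (solve 4 (λ a b c d → (a :+ b) :- (c :+ d) := (a :- c) :+ (b :- d)) refl _ _ _ _)

  altSum-neg : ∀ {n} (f : Vector Carrier n) → altSum (λ i → - f i) ≈ - altSum f
  altSum-neg {zero}  f = sym -0#≈0#
  altSum-neg {suc n} f = trans (+-congˡ (-‿cong (altSum-neg (tail f))))
    (solve 2 (λ a b → :- a :- (:- b) := :- (a :- b)) refl _ _)

  -- Multiplication by the sign (-1)^i.
  alternate : ∀ {n} → Fin n → Carrier → Carrier
  alternate zero    x = x
  alternate (suc i) x = - alternate i x

  alternate-cong : ∀ {n} (i : Fin n) {x y} → x ≈ y → alternate i x ≈ alternate i y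
  alternate-cong zero    x≈y = x≈y
  alternate-cong (suc i) x≈y = -‿cong (alternate-cong i x≈y)

  alternate-*ʳ : ∀ {n} (i : Fin n) x y → alternate i (x * y) ≈ alternate i x * y
  alternate-*ʳ zero    x y = refl
  alternate-*ʳ (suc i) x y = trans (-‿cong (alternate-*ʳ i x y)) (-‿distribˡ-* _ _)

  alternate-*ˡ : ∀ {n} (i : Fin n) x y → alternate i (x * y) ≈ x * alternate i y
  alternate-*ˡ i x y = begin
    alternate i (x * y)  ≈⟨ alternate-cong i (*-comm x y) ⟩
    alternate i (y * x)  ≈⟨ alternate-*ʳ i y x ⟩
    alternate i y * x    ≈⟨ *-comm _ _ ⟩
    x * alternate i y    ∎

  alternate-neg : ∀ {n} (i : Fin n) x → alternate i (- x) ≈ - alternate i x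
  alternate-neg zero    x = refl
  alternate-neg (suc i) x = -‿cong (alternate-neg i x)

  altSum≈sum : ∀ {n} (g : Vector Carrier n) → altSum g ≈ sum (λ i → alternate i (g i))
  altSum≈sum {zero}  g = refl
  altSum≈sum {suc n} g = +-congˡ (trans (-‿cong (altSum≈sum (tail g))) (sum-neg (λ i → alternate i (tail g i))))

  differences : ∀ {n} → Carrier → Vector Carrier n → Carrier
  differences x Z = product (λ k → x - Z k)

  vandermonde-cong : ∀ {n} {Z W : Vector Carrier n} → (∀ i → Z i ≈ W i) →
                     vandermonde Z ≈ vandermonde W
  vandermonde-cong Z≈W = product-cong λ i → product-cong λ k → entry i k
    where
    entry : ∀ i k → (if does (i Fin.<? k) then _ else 1#) ≈ (if does (i Fin.<? k) then _ else 1#)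
    entry i k with does (i Fin.<? k)
    ... | true  = +-cong (Z≈W i) (-‿cong (Z≈W k))
    ... | false = refl

  -- Row 0 holds exactly the factors with the first node, preceded by a diagonal 1; every later row
  -- has the entry 1 in column 0.
  vandermonde-∷ : ∀ {n} (Z : Vector Carrier (suc n)) →
                  vandermonde Z ≈ differences (Z zero) (tail Z) * vandermonde (tail Z)
  vandermonde-∷ Z = *-cong (*-identityˡ _) (product-cong {x = λ i → 1# * row i} λ i → *-identityˡ (row i))
    where row : ∀ i → Carrier
          row i = product λ k → if does (i Fin.<? k) then tail Z i - tail Z k else 1#

  -- Expanded twice, the two products share all factors except `x - y` against `y - x`.
  vandermonde-swap : ∀ {n} x y (Z : Vector Carrier n) →
                     vandermonde (x ◂ y ◂ Z) ≈ - vandermonde (y ◂ x ◂ Z)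
  vandermonde-swap x y Z = begin
    vandermonde (x ◂ y ◂ Z)
      ≈⟨ expand x y ⟩
    ((x - y) * differences x Z) * (differences y Z * vandermonde Z)
      ≈⟨ solve 5 (λ x y p q v → ((x :- y) :* p) :* (q :* v) := :- (((y :- x) :* q) :* (p :* v)))
           refl x y _ _ _ ⟩
    - (((y - x) * differences y Z) * (differences x Z * vandermonde Z))
      ≈⟨ -‿cong (expand y x) ⟨
    - vandermonde (y ◂ x ◂ Z) ∎
    where
    expand : ∀ x y → vandermonde (x ◂ y ◂ Z) ≈
             ((x - y) * differences x Z) * (differences y Z * vandermonde Z)
    expand x y = trans (vandermonde-∷ (x ◂ y ◂ Z)) (*-congˡ (vandermonde-∷ (y ◂ Z)))

  -- The new node y is carried to the front past the i nodes before it, and each transposition costs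
  -- a sign. This identifies the numerators of the Lagrange coefficients with minors for the node
  -- list `y ◂ X`.
  vandermonde-≔ : ∀ {n} (X : Vector Carrier (suc n)) i y →
                  vandermonde (updateAt X i (const y)) ≈
                  alternate i (vandermonde (y ◂ removeAt X i))
  vandermonde-≔ X zero y = vandermonde-cong
    {Z = updateAt X zero (const y)} {W = y ◂ tail X} λ { zero → refl ; (suc k) → refl }
  vandermonde-≔ {suc n} X (suc i) y = begin
    vandermonde (updateAt X (suc i) (const y))
      ≈⟨ vandermonde-∷ (updateAt X (suc i) (const y)) ⟩
    differences x (updateAt (tail X) i (const y)) * vandermonde (updateAt (tail X) i (const y))
      ≈⟨ *-cong (head-factor (tail X) i) (vandermonde-≔ (tail X) i y) ⟩
    differences x (y ◂ X′) * alternate i (vandermonde (y ◂ X′))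
      ≈⟨ alternate-*ˡ i _ _ ⟨
    alternate i (differences x (y ◂ X′) * vandermonde (y ◂ X′))
      ≈⟨ alternate-cong i (vandermonde-∷ (x ◂ y ◂ X′)) ⟨
    alternate i (vandermonde (x ◂ y ◂ X′))
      ≈⟨ alternate-cong i (vandermonde-swap x y X′) ⟩
    alternate i (- vandermonde (y ◂ x ◂ X′))
      ≈⟨ alternate-neg i _ ⟩
    - alternate i (vandermonde (y ◂ x ◂ X′))
      ≈⟨ -‿cong (alternate-cong i (vandermonde-cong {Z = y ◂ x ◂ X′} {W = y ◂ removeAt X (suc i)} λ { zero
          → refl ; (suc zero) → refl ; (suc (suc k)) → refl })) ⟩
    - alternate i (vandermonde (y ◂ removeAt X (suc i))) ∎
    where
    x  = X zero
    X′ = removeAt (tail X) i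
    head-factor : ∀ {n} (Y : Vector Carrier (suc n)) i →
                  differences x (updateAt Y i (const y)) ≈ differences x (y ◂ removeAt Y i)
    head-factor Y zero = refl
    head-factor {suc n} Y (suc i) = begin
      (x - Y zero) * differences x (updateAt (tail Y) i (const y))
        ≈⟨ *-congˡ (head-factor (tail Y) i) ⟩
      (x - Y zero) * ((x - y) * differences x (removeAt (tail Y) i))
        ≈⟨ solve 3 (λ p q r → p :* (q :* r) := q :* (p :* r)) refl _ _ _ ⟩
      (x - y) * ((x - Y zero) * differences x (removeAt (tail Y) i)) ∎

  -- Up to sign, the determinant of the Vandermonde matrix of Z with the last
  -- column replaced by the N-th powers, expanded along that column.
  minorSum : ∀ {n} → Vector Carrier (suc n) → ℕ → Carrier
  minorSum Z N = altSum (λ i → vandermonde (removeAt Z i) * Z i ^ N)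

  -- Write `Z i` as `Z zero − (Z zero − Z i)`. The factor `Z zero − Z i` is precisely the one that
  -- the minor omitting node i lacks from the full product of differences, so that product can be
  -- pulled out and leaves a minor of `tail Z`.
  minorSum-suc : ∀ {n} (Z : Vector Carrier (suc (suc n))) N →
    minorSum Z (suc N) ≈ Z zero * minorSum Z N + differences (Z zero) (tail Z) * minorSum (tail Z) N
  minorSum-suc Z N = begin
    v * (z * z ^ N) - altSum (λ i → V i * (Z′ i * Z′ i ^ N))
      ≈⟨ +-congˡ (-‿cong rest) ⟩
    v * (z * z ^ N) - (z * S + - (D * M))
      ≈⟨ solve 6 (λ v z p S D M → v :* (z :* p) :- (z :* S :+ (:- (D :* M)))
                               := z :* (v :* p :- S) :+ D :* M) refl v z (z ^ N) S D M ⟩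
    z * (v * z ^ N - S) + D * M ∎
    where
    z  = Z zero
    Z′ = tail Z
    v  = vandermonde Z′
    D  = differences z Z′
    M  = minorSum Z′ N
    V  = λ i → vandermonde (removeAt Z (suc i))
    S  = altSum (λ i → V i * Z′ i ^ N)

    term : ∀ i → V i * (Z′ i * Z′ i ^ N) ≈
                 z * (V i * Z′ i ^ N) + - (D * (vandermonde (removeAt Z′ i) * Z′ i ^ N))
    term i = begin
      V i * (Z′ i * p)
        ≈⟨ solve 4 (λ V x p z → V :* (x :* p) := z :* (V :* p) :+ (:- (((z :- x) :* V) :* p)))
             refl (V i) (Z′ i) p z ⟩
      z * (V i * p) + - (((z - Z′ i) * V i) * p)
        ≈⟨ +-congˡ (-‿cong (*-congʳ (*-congˡ (vandermonde-∷ (removeAt Z (suc i)))))) ⟩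
      z * (V i * p) + - (((z - Z′ i) * (differences z (removeAt Z′ i) * w)) * p)
        ≈⟨ +-congˡ (-‿cong (*-congʳ (*-assoc _ _ _))) ⟨
      z * (V i * p) + - ((((z - Z′ i) * differences z (removeAt Z′ i)) * w) * p)
        ≈⟨ +-congˡ (-‿cong (*-congʳ (*-congʳ (product-remove {i = i} (λ k → z - Z′ k))))) ⟨
      z * (V i * p) + - ((D * w) * p)
        ≈⟨ +-congˡ (-‿cong (*-assoc _ _ _)) ⟩
      z * (V i * p) + - (D * (w * p)) ∎
      where
      p = Z′ i ^ N
      w = vandermonde (removeAt Z′ i)

    rest : altSum (λ i → V i * (Z′ i * Z′ i ^ N)) ≈ z * S + - (D * M)
    rest = begin
      altSum (λ i → V i * (Z′ i * Z′ i ^ N))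
        ≈⟨ altSum-cong term ⟩
      altSum (λ i → z * (V i * Z′ i ^ N) + - (D * (vandermonde (removeAt Z′ i) * Z′ i ^ N)))
        ≈⟨ altSum-+ (λ i → z * (V i * Z′ i ^ N)) (λ i → - (D * (vandermonde (removeAt Z′ i) * Z′ i ^ N))) ⟩
      altSum (λ i → z * (V i * Z′ i ^ N)) + altSum (λ i → - (D * (vandermonde (removeAt Z′ i) * Z′ i ^ N)))
        ≈⟨ +-cong (sym (*-distribˡ-altSum z (λ i → V i * Z′ i ^ N))) (altSum-neg (λ i → D * (vandermonde
            (removeAt Z′ i) * Z′ i ^ N))) ⟩
      z * S + - altSum (λ i → D * (vandermonde (removeAt Z′ i) * Z′ i ^ N))
        ≈⟨ +-congˡ (-‿cong (*-distribˡ-altSum D (λ i → vandermonde (removeAt Z′ i) * Z′ i ^ N))) ⟨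
      z * S + - (D * M) ∎

  -- Antisymmetry of the determinant in its first two rows: the first two minors trade places, and
  -- all others contain both nodes and change sign by `vandermonde-swap`.
  minorSum-swap : ∀ {n} x y (Z : Vector Carrier n) N →
                  minorSum (y ◂ x ◂ Z) N ≈ - minorSum (x ◂ y ◂ Z) N
  minorSum-swap x y Z N = begin
    v x * y ^ N - (v y * x ^ N - rest y x)
      ≈⟨ +-congˡ (-‿cong (+-congˡ (-‿cong (trans (altSum-cong (swap Z)) (altSum-neg (λ i → vandermonde (removeAt
          (x ◂ y ◂ Z) (suc (suc i))) * Z i ^ N)))))) ⟩
    v x * y ^ N - (v y * x ^ N - - rest x y)
      ≈⟨ solve 3 (λ a b c → a :- (b :- (:- c)) := :- (b :- (a :- c))) refl _ _ _ ⟩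
    - (v y * x ^ N - (v x * y ^ N - rest x y))
      ≈⟨ -‿cong (+-cong (*-congʳ (same y x)) (-‿cong (+-congʳ (*-congʳ (sym (same x y)))))) ⟩
    - minorSum (x ◂ y ◂ Z) N ∎
    where
    v : Carrier → Carrier
    v x = vandermonde (removeAt (y ◂ x ◂ Z) zero)
    rest : Carrier → Carrier → Carrier
    rest x y = altSum (λ i → vandermonde (removeAt (x ◂ y ◂ Z) (suc (suc i))) * Z i ^ N)
    same : ∀ y x → v y ≈ vandermonde (removeAt (y ◂ x ◂ Z) (suc zero))
    same y x = vandermonde-cong
      {Z = removeAt (x ◂ y ◂ Z) zero} {W = removeAt (y ◂ x ◂ Z) (suc zero)} λ { zero → refl ; (suc k) → refl }
    swap : ∀ {n} (Z : Vector Carrier n) i →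
           vandermonde (removeAt (y ◂ x ◂ Z) (suc (suc i))) * Z i ^ N ≈
           - (vandermonde (removeAt (x ◂ y ◂ Z) (suc (suc i))) * Z i ^ N)
    swap {suc n} Z i = trans (*-congʳ (begin
      vandermonde (removeAt (y ◂ x ◂ Z) (suc (suc i)))
        ≈⟨ vandermonde-cong {W = y ◂ x ◂ removeAt Z i} (split y x) ⟩
      vandermonde (y ◂ x ◂ removeAt Z i)
        ≈⟨ vandermonde-swap y x (removeAt Z i) ⟩
      - vandermonde (x ◂ y ◂ removeAt Z i)
        ≈⟨ -‿cong (vandermonde-cong {W = x ◂ y ◂ removeAt Z i} (split x y)) ⟨
      - vandermonde (removeAt (x ◂ y ◂ Z) (suc (suc i))) ∎))
      (sym (-‿distribˡ-* _ _))
      where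
      split : ∀ y x k → removeAt (y ◂ x ◂ Z) (suc (suc i)) k ≈ (y ◂ x ◂ removeAt Z i) k
      split y x zero          = refl
      split y x (suc zero)    = refl
      split y x (suc (suc k)) = refl

  minorSum-cong : ∀ {n} {Z W : Vector Carrier (suc n)} N → (∀ i → Z i ≈ W i) →
                  minorSum Z N ≈ minorSum W N
  minorSum-cong N Z≈W = altSum-cong λ i →
    *-cong (vandermonde-cong (λ k → Z≈W (Fin.punchIn i k))) (^-congˡ N (Z≈W i))

  -- Each node is compared with the later ones only, so that inductions on `tail Z` obtain their
  -- hypothesis by projection. Non-zero-divisors are enough for the identities of this part, which
  -- are stated without division.
  RegularDifferences : ∀ {n} → Vector Carrier n → Set (a ⊔ ℓ)
  RegularDifferences {zero}  Z = ⊤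
  RegularDifferences {suc n} Z = (∀ k → Regular (Z zero - Z (suc k))) × RegularDifferences (tail Z)

  -- This is a determinant with two equal columns. Instead of a theory of determinants: by induction
  -- and `minorSum-suc`, the value M at 0 and the value at 1 are related by `minorSum Z 1 ≈ x * M`.
  -- Exchanging the first two nodes gives `minorSum Z 1 ≈ y * M` as well, so `x − y` annihilates M.
  minorSum-0 : ∀ {n} (Z : Vector Carrier (suc (suc n))) → RegularDifferences Z → minorSum Z 0 ≈ 0#
  minorSum-0 {zero} Z _ = solve 1 (λ v → v :* con (+ 1) :- (v :* con (+ 1) :- con (+ 0)) := con (+ 0))
    refl (vandermonde (tail Z))
  minorSum-0 {suc n} Z (reg , reg′ , reg″) = reg zero M (begin
    (x - y) * M
      ≈⟨ solve 3 (λ x y M → (x :- y) :* M := x :* M :- y :* M) refl x y M ⟩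
    x * M - y * M
      ≈⟨ +-cong (step Z (reg′ , reg″)) (-‿cong step′) ⟨
    minorSum Z 1 - minorSum Z 1
      ≈⟨ -‿inverseʳ _ ⟩
    0# ∎)
    where
    x = Z zero
    y = Z (suc zero)
    W = tail (tail Z)
    M = minorSum Z 0
    Zˢ = y ◂ x ◂ W

    step : ∀ (Z : Vector Carrier (suc (suc (suc n)))) → RegularDifferences (tail Z) →
           minorSum Z 1 ≈ Z zero * minorSum Z 0
    step Z reg = begin
      minorSum Z 1
        ≈⟨ minorSum-suc Z 0 ⟩
      Z zero * minorSum Z 0 + differences (Z zero) (tail Z) * minorSum (tail Z) 0
        ≈⟨ +-congˡ (trans (*-congˡ (minorSum-0 (tail Z) reg)) (zeroʳ _)) ⟩
      Z zero * minorSum Z 0 + 0#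
        ≈⟨ +-identityʳ _ ⟩
      Z zero * minorSum Z 0 ∎

    swapped : ∀ N → minorSum Zˢ N ≈ - minorSum Z N
    swapped N = trans (minorSum-swap x y W N)
      (-‿cong (minorSum-cong {Z = x ◂ y ◂ W} {W = Z} N λ { zero → refl ; (suc zero) → refl ; (suc (suc k))
          → refl }))

    step′ : minorSum Z 1 ≈ y * M
    step′ = begin
      minorSum Z 1      ≈⟨ -‿involutive _ ⟨
      - - minorSum Z 1  ≈⟨ -‿cong (swapped 1) ⟨
      - minorSum Zˢ 1   ≈⟨ -‿cong (step Zˢ ((λ k → reg (suc k)) , reg″)) ⟩
      - (y * minorSum Zˢ 0) ≈⟨ -‿cong (*-congˡ (swapped 0)) ⟩
      - (y * - M)       ≈⟨ solve 2 (λ y M → :- (y :* (:- M)) := y :* M) refl y M ⟩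
      y * M             ∎

  -- The complete homogeneous symmetric polynomial of degree N − n in the
  -- n + 1 variables Z, and 0 for N < n.
  H : ∀ {n} → Vector Carrier (suc n) → ℕ → Carrier
  H {zero}  Z N       = Z zero ^ N
  H {suc n} Z zero    = 0#
  H {suc n} Z (suc N) = Z zero * H Z N + H (tail Z) N

  -- The bialternant formula for complete homogeneous polynomials. Both sides obey the recurrence of
  -- `minorSum-suc`, and for at least two nodes both vanish at N = 0.
  minorSum≈H : ∀ {n} (Z : Vector Carrier (suc n)) → RegularDifferences Z → ∀ N →
               minorSum Z N ≈ vandermonde Z * H Z N
  minorSum≈H {zero} Z _ N =
    solve 1 (λ p → con (+ 1) :* p :- con (+ 0) := ((con (+ 1) :* con (+ 1)) :* con (+ 1)) :* p) refl _
  minorSum≈H {suc n} Z reg zero = trans (minorSum-0 Z reg) (sym (zeroʳ _))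
  minorSum≈H {suc n} Z reg (suc N) = begin
    minorSum Z (suc N)
      ≈⟨ minorSum-suc Z N ⟩
    x * minorSum Z N + D * minorSum Z′ N
      ≈⟨ +-cong (*-congˡ (minorSum≈H Z reg N)) (*-congˡ (minorSum≈H Z′ (proj₂ reg) N)) ⟩
    x * (vandermonde Z * H Z N) + D * (vandermonde Z′ * H Z′ N)
      ≈⟨ +-congˡ (*-assoc _ _ _) ⟨
    x * (vandermonde Z * H Z N) + (D * vandermonde Z′) * H Z′ N
      ≈⟨ +-congˡ (*-congʳ (vandermonde-∷ Z)) ⟨
    x * (vandermonde Z * H Z N) + vandermonde Z * H Z′ N
      ≈⟨ solve 4 (λ x v p q → x :* (v :* p) :+ v :* q := v :* (x :* p :+ q)) refl x _ _ _ ⟩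
    vandermonde Z * (x * H Z N + H Z′ N) ∎
    where
    x = Z zero
    Z′ = tail Z
    D = differences x Z′

  -- The error formula of interpolation, multiplied by the common denominator. The left side is the
  -- expansion of `minorSum (y ◂ X) N` along its column of powers, with the minors rewritten by
  -- `vandermonde-≔`; the right side is its value by `minorSum≈H`.
  interpolation : ∀ {n} y (X : Vector Carrier (suc n)) → RegularDifferences (y ◂ X) → ∀ N →
    vandermonde X * y ^ N - sum (λ i → vandermonde (updateAt X i (const y)) * X i ^ N) ≈
    vandermonde X * (differences y X * H (y ◂ X) N)
  interpolation y X reg N = begin
    vandermonde X * y ^ N - sum (λ i → vandermonde (updateAt X i (const y)) * X i ^ N)
      ≈⟨ +-congˡ (-‿cong (sum-cong-≋ term)) ⟩
    vandermonde X * y ^ N - sum (λ i → alternate i (vandermonde (removeAt (y ◂ X) (suc i)) * X i ^ N))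
      ≈⟨ +-congˡ (-‿cong (altSum≈sum (λ i → vandermonde (removeAt (y ◂ X) (suc i)) * X i ^ N))) ⟨
    minorSum (y ◂ X) N
      ≈⟨ minorSum≈H (y ◂ X) reg N ⟩
    vandermonde (y ◂ X) * H (y ◂ X) N
      ≈⟨ *-congʳ (vandermonde-∷ (y ◂ X)) ⟩
    (differences y X * vandermonde X) * H (y ◂ X) N
      ≈⟨ solve 3 (λ d v p → (d :* v) :* p := v :* (d :* p)) refl _ _ _ ⟩
    vandermonde X * (differences y X * H (y ◂ X) N) ∎
    where
    term : ∀ i → vandermonde (updateAt X i (const y)) * X i ^ N ≈
                 alternate i (vandermonde (removeAt (y ◂ X) (suc i)) * X i ^ N)
    term i = begin
      vandermonde (updateAt X i (const y)) * X i ^ N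
        ≈⟨ *-congʳ (vandermonde-≔ X i y) ⟩
      alternate i (vandermonde (y ◂ removeAt X i)) * X i ^ N
        ≈⟨ alternate-*ʳ i _ _ ⟨
      alternate i (vandermonde (y ◂ removeAt X i) * X i ^ N)
        ≈⟨ alternate-cong i (*-congʳ (vandermonde-cong {Z = y ◂ removeAt X i} {W = removeAt (y ◂ X) (suc i)} λ
            { zero → refl ; (suc k) → refl })) ⟩
      alternate i (vandermonde (removeAt (y ◂ X) (suc i)) * X i ^ N) ∎

-- Sums over filtered lists of tuples.

module FilteredSums {a ℓ} (R : CommutativeRing a ℓ) where
  open RingKit R
  open import Data.List.Base using ([]; _∷_)
  open import Data.Vec.Base using ([]; _∷_)

  filteredSum : ∀ {b p} {B : Set b} {P : Pred B p} → Decidable P → (B → Carrier) → List B → Carrier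
  filteredSum P? φ xs = listSum (List.map φ (filter P? xs))

  module _ {b p} {B : Set b} {P : Pred B p} (P? : Decidable P) (φ : B → Carrier) where

    filteredSum-++ : ∀ xs ys → filteredSum P? φ (xs ++ ys) ≈ filteredSum P? φ xs + filteredSum P? φ ys
    filteredSum-++ []       ys = sym (+-identityˡ _)
    filteredSum-++ (x ∷ xs) ys with does (P? x)
    ... | true  = trans (+-congˡ (filteredSum-++ xs ys)) (sym (+-assoc _ _ _))
    ... | false = filteredSum-++ xs ys

    filteredSum-map : ∀ {d} {D : Set d} (f : D → B) xs →
                      filteredSum P? φ (List.map f xs) ≈ filteredSum (P? ∘ f) (φ ∘ f) xs
    filteredSum-map f []       = refl
    filteredSum-map f (x ∷ xs) with does (P? (f x))
    ... | true  = +-congˡ (filteredSum-map f xs)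
    ... | false = filteredSum-map f xs

    filteredSum-none : (∀ x → ¬ P x) → ∀ xs → filteredSum P? φ xs ≈ 0#
    filteredSum-none ¬P xs = reflexive
      (≡.cong (listSum ∘ List.map φ) (List.filter-none P? (ListAll.universal ¬P xs)))

    filteredSum-≐ : ∀ {q} {Q : Pred B q} (Q? : Decidable Q) → P ≐ Q → ∀ xs →
                    filteredSum P? φ xs ≈ filteredSum Q? φ xs
    filteredSum-≐ Q? P≐Q xs = reflexive (≡.cong (listSum ∘ List.map φ) (List.filter-≐ P? Q? P≐Q xs))

    *-distribˡ-filteredSum : ∀ x xs → x * filteredSum P? φ xs ≈ filteredSum P? (λ y → x * φ y) xs
    *-distribˡ-filteredSum x []       = zeroʳ x
    *-distribˡ-filteredSum x (y ∷ xs) with does (P? y)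
    ... | true  = trans (distribˡ x _ _) (+-congˡ (*-distribˡ-filteredSum x xs))
    ... | false = *-distribˡ-filteredSum x xs

  filteredSum-tuples : ∀ {p} k n {P : Pred (Vec (Fin k) (suc n)) p} (P? : Decidable P) φ →
    filteredSum P? φ (tuples k (suc n)) ≈
    sum (λ i → filteredSum (P? ∘ (i ∷_)) (φ ∘ (i ∷_)) (tuples k n))
  filteredSum-tuples k n P? φ = go k id
    where
    -- `allFin k` is tabulated from `id`, but its tail is tabulated from `suc`; the induction
    -- therefore runs over arbitrary tabulated functions.
    go : ∀ m (f : Fin m → Fin k) →
      filteredSum P? φ (cartesianProductWith _∷_ (List.tabulate f) (tuples k n)) ≈
      sum (λ i → filteredSum (P? ∘ (f i ∷_)) (φ ∘ (f i ∷_)) (tuples k n))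
    go zero    f = refl
    go (suc m) f = trans (filteredSum-++ P? φ (List.map (f zero ∷_) (tuples k n)) _)
      (+-cong (filteredSum-map P? φ (f zero ∷_) (tuples k n)) (go m (f ∘ suc)))

-- Complete homogeneous symmetric polynomials as divided differences.

module CompleteHomogeneous {a ℓ} (R : CommutativeRing a ℓ) where
  open RingKit R
  open import Data.Vec.Base using ([]; _∷_)
  open import Data.Vec.Relation.Unary.Linked using ([]; [-]; _∷_)
  open Vandermonde R
  open FilteredSums R

  private
    Increasing? : ∀ {k n} → Decidable (Linked Fin._≤_ {n = n})
    Increasing? {k} = linked? (Fin._≤?_ {k} {k})

    monomial : ∀ {k n} → Vector Carrier k → Vec (Fin k) n → Carrier
    monomial X is = vecProduct (Vec.map X is)

    -- This is h_f in the variables X_i, X_{i+1}, ...: the prefix i serves only as a lower bound and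
    -- contributes no factor.
    increasingFrom : ∀ {k} → Fin k → ℕ → Vector Carrier k → Carrier
    increasingFrom {k} i f X = filteredSum (Increasing? ∘ (i ∷_)) (monomial X) (tuples k f)

    -- A weakly increasing tuple bounded below by `suc i` never takes the value `zero`, so all its
    -- entries can be lowered by one.
    increasingFrom-suc : ∀ {k} (i : Fin k) f X → increasingFrom (suc i) f X ≈ increasingFrom i f (tail X)
    increasingFrom-suc i zero    X = refl
    increasingFrom-suc {k} i (suc f) X = begin
      increasingFrom (suc i) (suc f) X
        ≈⟨ filteredSum-tuples (suc k) f (Increasing? ∘ (suc i ∷_)) (monomial X) ⟩
      filteredSum (λ is → Increasing? (suc i ∷ zero ∷ is)) (λ is → X zero * monomial X is) (tuples
          (suc k) f) + sum F
        ≈⟨ +-cong (filteredSum-none _ _ (λ { _ (() ∷ _) }) (tuples (suc k) f)) (sum-cong-≋ {x = F} {y = G} step) ⟩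
      0# + sum G
        ≈⟨ +-identityˡ _ ⟩
      sum G
        ≈⟨ filteredSum-tuples k f (Increasing? ∘ (i ∷_)) (monomial (tail X)) ⟨
      increasingFrom i (suc f) (tail X) ∎
      where
      F G : Fin k → Carrier
      F j = filteredSum (λ is → Increasing? (suc i ∷ suc j ∷ is)) (λ is → X (suc j) * monomial X is) (tuples
          (suc k) f)
      G j = filteredSum (λ is → Increasing? (i ∷ j ∷ is)) (λ is → X (suc j) * monomial (tail X) is) (tuples k f)
      step : ∀ j → F j ≈ G j
      -- If the first entry violates the bound, both sums are empty. Otherwise the bound i is
      -- absorbed by the new bound j, and the induction hypothesis applies.
      step j with i Fin.≤? j
      ... | no i≰j = trans
        (filteredSum-none _ _ (λ { _ (s≤s i≤j ∷ _) → i≰j i≤j }) (tuples (suc k) f))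
        (sym (filteredSum-none _ _ (λ { _ (i≤j ∷ _) → i≰j i≤j }) (tuples k f)))
      ... | yes i≤j = begin
        _ ≈⟨ filteredSum-≐ _ _ (Increasing? ∘ (suc j ∷_)) (Linked.tail , s≤s i≤j ∷_) (tuples (suc k) f) ⟩
        _ ≈⟨ *-distribˡ-filteredSum _ (monomial X) (X (suc j)) (tuples (suc k) f) ⟨
        X (suc j) * increasingFrom (suc j) f X ≈⟨ *-congˡ (increasingFrom-suc j f X) ⟩
        X (suc j) * increasingFrom j f (tail X)
          ≈⟨ *-distribˡ-filteredSum _ (monomial (tail X)) (X (suc j)) (tuples k f) ⟩
        _ ≈⟨ filteredSum-≐ _ _ _ ((i≤j ∷_) , Linked.tail) (tuples k f) ⟩
        _ ∎

    h-as-sum : ∀ {k} f (X : Vector Carrier k) → h (suc f) X ≈ sum (λ i → X i * increasingFrom i f X)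
    h-as-sum {k} f X = trans (filteredSum-tuples k f Increasing? (monomial X))
      (sum-cong-≋ λ i → sym (*-distribˡ-filteredSum (Increasing? ∘ (i ∷_)) (monomial X) (X i) (tuples k f)))

  h-zero : ∀ {k} (X : Vector Carrier k) → h 0 X ≈ 1#
  h-zero X = +-identityʳ 1#

  -- Split by the first index: after `zero` the rest of the tuple is unconstrained, and otherwise
  -- the first variable does not occur at all.
  h-suc : ∀ {k} f (X : Vector Carrier (suc k)) → h (suc f) X ≈ X zero * h f X + h (suc f) (tail X)
  h-suc {k} f X = begin
    h (suc f) X
      ≈⟨ h-as-sum f X ⟩
    X zero * increasingFrom zero f X + sum (λ i → X (suc i) * increasingFrom (suc i) f X)
      ≈⟨ +-cong (*-congˡ from-zero) (sum-cong-≋ λ i → *-congˡ (increasingFrom-suc i f X)) ⟩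
    X zero * h f X + sum (λ i → X (suc i) * increasingFrom i f (tail X))
      ≈⟨ +-congˡ (h-as-sum f (tail X)) ⟨
    X zero * h f X + h (suc f) (tail X) ∎
    where
    prepend-zero : ∀ {n} {is : Vec (Fin (suc k)) n} → Linked Fin._≤_ is → Linked Fin._≤_ (zero ∷ is)
    prepend-zero {is = []}    _   = [-]
    prepend-zero {is = _ ∷ _} inc = z≤n ∷ inc
    from-zero : increasingFrom zero f X ≈ h f X
    from-zero = filteredSum-≐ _ (monomial X) Increasing? (Linked.tail , prepend-zero) (tuples (suc k) f)

  -- A divided difference at n + 1 nodes kills polynomials of degree below n. This is the
  -- counterpart of there being no meanders from negative levels.
  H-below : ∀ {n} (Z : Vector Carrier (suc n)) {N} → N ℕ.< n → H Z N ≈ 0#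
  H-below {suc n} Z {zero}  _         = refl
  H-below {suc n} Z {suc N} (s≤s N<n) = begin
    Z zero * H Z N + H (tail Z) N  ≈⟨ +-cong (*-congˡ (H-below Z (ℕ.m<n⇒m<1+n N<n))) (H-below (tail Z) N<n) ⟩
    Z zero * 0# + 0#               ≈⟨ +-identityʳ _ ⟩
    Z zero * 0#                    ≈⟨ zeroʳ _ ⟩
    0#                             ∎

  H≈h : ∀ {n} (Z : Vector Carrier (suc n)) f → H Z (n ℕ.+ f) ≈ h f Z
  H≈h {zero} Z zero = sym (h-zero Z)
  H≈h {zero} Z (suc f) = begin
    Z zero * Z zero ^ f           ≈⟨ *-congˡ (H≈h Z f) ⟩
    Z zero * h f Z                ≈⟨ +-identityʳ _ ⟨
    Z zero * h f Z + 0#           ≈⟨ h-suc f Z ⟨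
    h (suc f) Z                   ∎
  H≈h {suc n} Z zero = begin
    Z zero * H Z (n ℕ.+ 0) + H (tail Z) (n ℕ.+ 0)
      ≈⟨ +-cong (*-congˡ (H-below Z (s≤s (ℕ.≤-reflexive (ℕ.+-identityʳ n))))) (H≈h (tail Z) 0) ⟩
    Z zero * 0# + h 0 (tail Z)
      ≈⟨ +-cong (zeroʳ _) (h-zero (tail Z)) ⟩
    0# + 1#
      ≈⟨ +-identityˡ 1# ⟩
    1#
      ≈⟨ h-zero Z ⟨
    h 0 Z ∎
  H≈h {suc n} Z (suc f) = begin
    Z zero * H Z (n ℕ.+ suc f) + H (tail Z) (n ℕ.+ suc f)
      ≈⟨ +-congʳ (*-congˡ (reflexive (≡.cong (H Z) (ℕ.+-suc n f)))) ⟩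
    Z zero * H Z (suc n ℕ.+ f) + H (tail Z) (n ℕ.+ suc f)
      ≈⟨ +-cong (*-congˡ (H≈h Z f)) (H≈h (tail Z) (suc f)) ⟩
    Z zero * h f Z + h (suc f) (tail Z)
      ≈⟨ h-suc f Z ⟨
    h (suc f) Z ∎

  -- When the first variable is 1, each use of `h-suc` merely adds the next h_f. This is the origin
  -- of the sum over f ≤ j in the second closed form.
  h-1∷ : ∀ {n} (X : Vector Carrier n) j → h j (1# ◂ X) ≈ sum {suc j} (λ f → h (toℕ f) X)
  h-1∷ X zero    = sym (+-identityʳ _)
  h-1∷ X (suc j) = begin
    h (suc j) (1# ◂ X)
      ≈⟨ h-suc j (1# ◂ X) ⟩
    1# * h j (1# ◂ X) + h (suc j) X
      ≈⟨ +-cong (trans (*-identityˡ _) (h-1∷ X j)) refl ⟩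
    sum {suc j} (λ f → h (toℕ f) X) + h (suc j) X
      ≈⟨ +-cong (sum-cong-≋ {suc j} λ f → reflexive (≡.cong (λ m → h m X) (≡.sym (Fin.toℕ-inject₁ f))))
                (reflexive (≡.cong (λ m → h m X) (≡.sym (Fin.toℕ-fromℕ (suc j))))) ⟩
    sum {suc j} (λ f → h (toℕ (inject₁ f)) X) + h (toℕ (fromℕ (suc j))) X
      ≈⟨ sum-init-last {suc j} (λ f → h (toℕ f) X) ⟨
    sum {suc (suc j)} (λ f → h (toℕ f) X) ∎

-- Formal power series: ring structure, shifts t^s · a(t) and inflations a(t^k).

below-or-above : ∀ s n → n ℕ.< s ⊎ ∃[ m ] n ≡ s ℕ.+ m
below-or-above s n with n ℕ.<? s
... | yes n<s = inj₁ n<s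
... | no  n≮s = inj₂ (n ℕ.∸ s , ≡.sym (ℕ.m+[n∸m]≡n (ℕ.≮⇒≥ n≮s)))

module PowerSeries {a ℓ} (K : CommutativeRing a ℓ) where
  private module Coefficient = RingKit K
  open Coefficient
  open PuiseuxSeries rawRing public using (inflate; shift; cauchyProduct)
  open PuiseuxSeries rawRing using (constant; Puiseux)

  Series : Set a
  Series = ℕ → Carrier

  infix 4 _≈ₛ_
  _≈ₛ_ : Series → Series → Set ℓ
  a ≈ₛ b = ∀ n → a n ≈ b n

  private
    tl : Series → Series
    tl a = a ∘ suc

    infixl 7 _*ₛ_ _∙_
    infixl 6 _+ₛ_
    _*ₛ_ _+ₛ_ : Series → Series → Series
    _*ₛ_ = cauchyProduct
    (a +ₛ b) n = a n + b n

    _∙_ : Carrier → Series → Series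
    (x ∙ a) n = x * a n

  const-series : Carrier → Series
  const-series x = Puiseux.coeff (constant x)

  0ₛ : Series
  0ₛ _ = 0#

  const-0 : const-series 0# ≈ₛ 0ₛ
  const-0 zero    = refl
  const-0 (suc n) = refl

  private
    *-congₛ : ∀ {a b c d} → a ≈ₛ b → c ≈ₛ d → a *ₛ c ≈ₛ b *ₛ d
    *-congₛ a≈b c≈d n = sum-cong-≋ {suc n} λ i → *-cong (a≈b (toℕ i)) (c≈d (n ℕ.∸ toℕ i))

    -- The Cauchy product computes by splitting off its first summand; commutativity by induction
    -- also needs to split off the last one.
    *-suc-tail : ∀ a b n → (a *ₛ b) (suc n) ≈ a (suc n) * b 0 + (a *ₛ tl b) n
    *-suc-tail a b zero =
      solve 4 (λ x y u v → x :* v :+ (y :* u :+ con (+ 0)) := y :* u :+ (x :* v :+ con (+ 0)))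
        refl (a 0) (a 1) (b 0) (b 1)
    *-suc-tail a b (suc n) = trans (+-congˡ (*-suc-tail (tl a) b n))
      (solve 3 (λ x y z → x :+ (y :+ z) := y :+ (x :+ z)) refl _ _ _)

    *-commₛ : ∀ a b → a *ₛ b ≈ₛ b *ₛ a
    *-commₛ a b zero    = +-congʳ (*-comm _ _)
    *-commₛ a b (suc n) = trans (+-cong (*-comm _ _) (*-commₛ (tl a) b n)) (sym (*-suc-tail b a n))

    distribˡₛ : ∀ a b c → a *ₛ (b +ₛ c) ≈ₛ a *ₛ b +ₛ a *ₛ c
    distribˡₛ a b c n = trans (sum-cong-≋ {suc n} λ i → distribˡ (a (toℕ i)) (b (n ℕ.∸ toℕ i)) (c (n ℕ.∸ toℕ i)))
      (∑-distrib-+ {suc n} (λ i → a (toℕ i) * b (n ℕ.∸ toℕ i)) (λ i → a (toℕ i) * c (n ℕ.∸ toℕ i)))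

    distribʳₛ : ∀ a b c → (b +ₛ c) *ₛ a ≈ₛ b *ₛ a +ₛ c *ₛ a
    distribʳₛ a b c n = trans (*-commₛ (b +ₛ c) a n)
      (trans (distribˡₛ a b c n) (+-cong (*-commₛ a b n) (*-commₛ a c n)))

    ∙-*-assoc : ∀ x a b → (x ∙ a) *ₛ b ≈ₛ x ∙ (a *ₛ b)
    ∙-*-assoc x a b n = trans (sum-cong-≋ {suc n} λ i → *-assoc x (a (toℕ i)) (b (n ℕ.∸ toℕ i)))
      (sym (*-distribˡ-sum {suc n} x (λ i → a (toℕ i) * b (n ℕ.∸ toℕ i))))

    -- By computation the tail of `a *ₛ b` is `a 0 ∙ tl b +ₛ tl a *ₛ b`, so the coefficient at
    -- `suc n` reduces to associativity at n for `tl a`.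
    *-assocₛ : ∀ a b c → (a *ₛ b) *ₛ c ≈ₛ a *ₛ (b *ₛ c)
    *-assocₛ a b c zero =
      solve 3 (λ x y z → (x :* y :+ con (+ 0)) :* z :+ con (+ 0) := x :* (y :* z :+ con (+ 0)) :+ con (+ 0))
        refl _ _ _
    *-assocₛ a b c (suc n) = begin
      (a 0 * b 0 + 0#) * c (suc n) + ((a 0 ∙ tl b +ₛ tl a *ₛ b) *ₛ c) n
        ≈⟨ +-congˡ (distribʳₛ c (a 0 ∙ tl b) (tl a *ₛ b) n) ⟩
      (a 0 * b 0 + 0#) * c (suc n) + (((a 0 ∙ tl b) *ₛ c) n + ((tl a *ₛ b) *ₛ c) n)
        ≈⟨ +-congˡ (+-cong (∙-*-assoc (a 0) (tl b) c n) (*-assocₛ (tl a) b c n)) ⟩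
      (a 0 * b 0 + 0#) * c (suc n) + (a 0 * (tl b *ₛ c) n + (tl a *ₛ (b *ₛ c)) n)
        ≈⟨ solve 5 (λ x y z u v → (x :* y :+ con (+ 0)) :* z :+ (x :* u :+ v) := x :* (y :* z :+ u) :+ v)
             refl (a 0) (b 0) (c (suc n)) _ _ ⟩
      a 0 * (b 0 * c (suc n) + (tl b *ₛ c) n) + (tl a *ₛ (b *ₛ c)) n ∎

    0ₛ-* : ∀ a → 0ₛ *ₛ a ≈ₛ 0ₛ
    0ₛ-* a n = sum-zero {suc n} λ i → zeroˡ (a (n ℕ.∸ toℕ i))

  const-*ˡ : ∀ x a → const-series x *ₛ a ≈ₛ x ∙ a
  const-*ˡ x a zero    = +-identityʳ _
  const-*ˡ x a (suc n) = trans (+-congˡ (0ₛ-* a n)) (+-identityʳ _)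

  private
    *-identityˡₛ : ∀ a → const-series 1# *ₛ a ≈ₛ a
    *-identityˡₛ a n = trans (const-*ˡ 1# a n) (*-identityˡ _)

  seriesRing : CommutativeRing a ℓ
  seriesRing = record
    { Carrier = Series ; _≈_ = _≈ₛ_ ; _+_ = _+ₛ_ ; _*_ = _*ₛ_ ; -_ = λ a n → - a n
    ; 0# = 0ₛ ; 1# = const-series 1#
    ; isCommutativeRing = record
      { isRing = record
        { +-isAbelianGroup = record
          { isGroup = record
            { isMonoid = record
              { isSemigroup = record
                { isMagma = record
                  { isEquivalence = record
                    { refl = λ n → refl ; sym = λ p n → sym (p n) ; trans = λ p q n → trans (p n) (q n) }
                  ; ∙-cong = λ p q n → +-cong (p n) (q n) }
                ; assoc = λ a b c n → +-assoc _ _ _ }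
              ; identity = (λ a n → +-identityˡ _) , (λ a n → +-identityʳ _) }
            ; inverse = (λ a n → -‿inverseˡ _) , (λ a n → -‿inverseʳ _)
            ; ⁻¹-cong = λ p n → -‿cong (p n) }
          ; comm = λ a b n → +-comm _ _ }
        ; *-cong = *-congₛ
        ; *-assoc = *-assocₛ
        ; *-identity = *-identityˡₛ , λ a n → trans (*-commₛ a (const-series 1#) n) (*-identityˡₛ a n)
        ; distrib = distribˡₛ , distribʳₛ }
      ; *-comm = *-commₛ } }

  shift-at : ∀ s a n → shift s a (s ℕ.+ n) ≡ a n
  shift-at zero    a n = ≡.refl
  shift-at (suc s) a n = shift-at s a n

  shift-below : ∀ s a {n} → n ℕ.< s → shift s a n ≡ 0#
  shift-below (suc s) a {zero}  _         = ≡.refl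
  shift-below (suc s) a {suc n} (s≤s n<s) = shift-below s a n<s

  shift-unique : ∀ s {a b} → (∀ n → n ℕ.< s → b n ≈ 0#) → (∀ n → b (s ℕ.+ n) ≈ a n) → b ≈ₛ shift s a
  shift-unique s {a} {b} below above n with below-or-above s n
  ... | inj₁ n<s         = trans (below n n<s) (reflexive (≡.sym (shift-below s a n<s)))
  ... | inj₂ (m , ≡.refl) = trans (above m) (reflexive (≡.sym (shift-at s a m)))

  shift-cong : ∀ s {a b} → a ≈ₛ b → shift s a ≈ₛ shift s b
  shift-cong s {a} {b} a≈b = shift-unique s (λ n n<s → reflexive (shift-below s a n<s))
    (λ n → trans (reflexive (shift-at s a n)) (a≈b n))

  shift-injective : ∀ s {a b} → shift s a ≈ₛ shift s b → a ≈ₛ b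
  shift-injective s {a} {b} eq n = trans (reflexive (≡.sym (shift-at s a n)))
    (trans (eq (s ℕ.+ n)) (reflexive (shift-at s b n)))

  shift-+ : ∀ s a b → shift s (a +ₛ b) ≈ₛ shift s a +ₛ shift s b
  shift-+ zero    a b n       = refl
  shift-+ (suc s) a b zero    = sym (+-identityˡ 0#)
  shift-+ (suc s) a b (suc n) = shift-+ s a b n

  shift-neg : ∀ s a n → shift s (λ m → - a m) n ≈ - shift s a n
  shift-neg zero    a n       = refl
  shift-neg (suc s) a zero    = sym -0#≈0#
  shift-neg (suc s) a (suc n) = shift-neg s a n

  shift-shift : ∀ s t a → shift s (shift t a) ≈ₛ shift (s ℕ.+ t) a
  shift-shift zero    t a n       = refl
  shift-shift (suc s) t a zero    = refl
  shift-shift (suc s) t a (suc n) = shift-shift s t a n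

  shift-*ˡ : ∀ s a b → shift s a *ₛ b ≈ₛ shift s (a *ₛ b)
  shift-*ˡ zero    a b n       = refl
  shift-*ˡ (suc s) a b zero    = trans (+-identityʳ _) (zeroˡ _)
  shift-*ˡ (suc s) a b (suc n) = trans (+-congʳ (zeroˡ _)) (trans (+-identityˡ _) (shift-*ˡ s a b n))

  shift-*-shift : ∀ s t a b → shift s a *ₛ shift t b ≈ₛ shift (s ℕ.+ t) (a *ₛ b)
  shift-*-shift s t a b n = begin
    (shift s a *ₛ shift t b) n      ≈⟨ shift-*ˡ s a (shift t b) n ⟩
    shift s (a *ₛ shift t b) n      ≈⟨ shift-cong s (*-commₛ a (shift t b)) n ⟩
    shift s (shift t b *ₛ a) n      ≈⟨ shift-cong s (shift-*ˡ t b a) n ⟩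
    shift s (shift t (b *ₛ a)) n    ≈⟨ shift-shift s t (b *ₛ a) n ⟩
    shift (s ℕ.+ t) (b *ₛ a) n      ≈⟨ shift-cong (s ℕ.+ t) (*-commₛ b a) n ⟩
    shift (s ℕ.+ t) (a *ₛ b) n      ∎

  inflate-∣ : ∀ k .{{_ : NonZero k}} a q → inflate k a (q ℕ.* k) ≡ a q
  inflate-∣ k a q with k ∣? (q ℕ.* k)
  ... | yes (divides q′ eq) = ≡.cong a (≡.sym (ℕ.*-cancelʳ-≡ q q′ k eq))
  ... | no k∤               = contradiction (divides-refl q) k∤

  inflate-∤ : ∀ k a {n} → ¬ k ∣ n → inflate k a n ≡ 0#
  inflate-∤ k a {n} k∤n with k ∣? n
  ... | yes k∣n = contradiction k∣n k∤n
  ... | no _    = ≡.refl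

  inflate-unique : ∀ k .{{_ : NonZero k}} {a b} → (∀ q → b (q ℕ.* k) ≈ a q) →
                   (∀ n → ¬ k ∣ n → b n ≈ 0#) → b ≈ₛ inflate k a
  inflate-unique k {a} {b} at off n with k ∣? n
  ... | yes (divides q ≡.refl) = at q
  ... | no k∤n                 = off n k∤n

  module _ (k : ℕ) .{{_ : NonZero k}} where

    inflate-cong : ∀ {a b} → a ≈ₛ b → inflate k a ≈ₛ inflate k b
    inflate-cong {a} {b} a≈b = inflate-unique k
      (λ q → trans (reflexive (inflate-∣ k a q)) (a≈b q)) (λ n k∤n → reflexive (inflate-∤ k a k∤n))

    inflate-injective : ∀ {a b} → inflate k a ≈ₛ inflate k b → a ≈ₛ b
    inflate-injective {a} {b} eq q = trans (reflexive (≡.sym (inflate-∣ k a q)))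
      (trans (eq (q ℕ.* k)) (reflexive (inflate-∣ k b q)))

    inflate-+ : ∀ a b → inflate k (a +ₛ b) ≈ₛ inflate k a +ₛ inflate k b
    inflate-+ a b n with k ∣? n
    ... | yes _ = refl
    ... | no  _ = sym (+-identityˡ 0#)

    inflate-neg : ∀ a n → inflate k (λ m → - a m) n ≈ - inflate k a n
    inflate-neg a n with k ∣? n
    ... | yes _ = refl
    ... | no  _ = sym -0#≈0#

    inflate-∙ : ∀ x a → inflate k (x ∙ a) ≈ₛ x ∙ inflate k a
    inflate-∙ x a n with k ∣? n
    ... | yes _ = refl
    ... | no  _ = sym (zeroʳ x)

    inflate-const : ∀ x → inflate k (const-series x) ≈ₛ const-series x
    inflate-const x n = sym (inflate-unique k {const-series x} at off n)
      where
      at : ∀ q → const-series x (q ℕ.* k) ≈ const-series x q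
      at zero = refl
      -- The product is nonzero and hence a successor, where `const-series x` computes to 0.
      at (suc q) with suc q ℕ.* k | ℕ.m*n≢0 (suc q) k
      ... | suc _ | _ = refl
      off : ∀ n → ¬ k ∣ n → const-series x n ≈ 0#
      off zero    k∤0 = contradiction (k ℕ∣.∣0) k∤0
      off (suc n) _   = refl

    inflate-shift : ∀ s a → inflate k (shift s a) ≈ₛ shift (s ℕ.* k) (inflate k a)
    inflate-shift s a n = sym (inflate-unique k {shift s a} at off n)
      where
      at : ∀ q → shift (s ℕ.* k) (inflate k a) (q ℕ.* k) ≈ shift s a q
      at q with below-or-above s q
      ... | inj₁ q<s = trans (reflexive (shift-below (s ℕ.* k) _ (ℕ.*-monoˡ-< k q<s)))
                             (reflexive (≡.sym (shift-below s a q<s)))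
      ... | inj₂ (m , ≡.refl) = begin
        shift (s ℕ.* k) (inflate k a) ((s ℕ.+ m) ℕ.* k)
          ≡⟨ ≡.cong (shift (s ℕ.* k) (inflate k a)) (ℕ.*-distribʳ-+ k s m) ⟩
        shift (s ℕ.* k) (inflate k a) (s ℕ.* k ℕ.+ m ℕ.* k)
          ≡⟨ shift-at (s ℕ.* k) _ _ ⟩
        inflate k a (m ℕ.* k)
          ≡⟨ inflate-∣ k a m ⟩
        a m
          ≡⟨ shift-at s a m ⟨
        shift s a (s ℕ.+ m) ∎
      off : ∀ n → ¬ k ∣ n → shift (s ℕ.* k) (inflate k a) n ≈ 0#
      off n k∤n with below-or-above (s ℕ.* k) n
      ... | inj₁ n<sk = reflexive (shift-below (s ℕ.* k) _ n<sk)
      ... | inj₂ (m , ≡.refl) = trans (reflexive (shift-at (s ℕ.* k) _ m))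
        (reflexive (inflate-∤ k a (λ k∣m → k∤n (ℕ∣.∣m∣n⇒∣m+n (divides-refl s) k∣m))))

    -- Substitute t^k for t in a = a₀ + t · `tl a`.
    inflate-tail : ∀ a → inflate k a ≈ₛ const-series (a 0) +ₛ shift k (inflate k (tl a))
    inflate-tail a n = sym (inflate-unique k {a} at off n)
      where
      at : ∀ q → const-series (a 0) (q ℕ.* k) + shift k (inflate k (tl a)) (q ℕ.* k) ≈ a q
      at zero = trans (+-congˡ (reflexive (shift-below k _ (ℕ.>-nonZero⁻¹ k)))) (+-identityʳ _)
      at (suc q) = trans (+-cong first (reflexive (≡.trans (shift-at k _ (q ℕ.* k)) (inflate-∣ k (tl a) q))))
        (+-identityˡ _)
        where
        first : const-series (a 0) (suc q ℕ.* k) ≈ 0#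
        first with suc q ℕ.* k | ℕ.m*n≢0 (suc q) k
        ... | suc _ | _ = refl
      off : ∀ n → ¬ k ∣ n → const-series (a 0) n + shift k (inflate k (tl a)) n ≈ 0#
      off zero k∤0 = contradiction (k ℕ∣.∣0) k∤0
      off (suc n) k∤n with below-or-above k (suc n)
      ... | inj₁ n<k = trans (+-identityˡ _) (reflexive (shift-below k _ n<k))
      ... | inj₂ (m , eq) = trans (+-identityˡ _) (trans
        (reflexive (≡.trans (≡.cong (shift k (inflate k (tl a))) eq) (shift-at k (inflate k (tl a)) m)))
        (reflexive (inflate-∤ k (tl a) λ k∣m → k∤n (≡.subst (k ∣_) (≡.sym eq) (ℕ∣.∣m∣n⇒∣m+n ℕ∣.∣-refl k∣m)))))

    -- Expanding both sides by `inflate-tail` leaves one product to compare, that of `tl a` with b.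
    -- It stands under `shift k`, so its relevant coefficient has index n - k < n, and strong
    -- induction on n, for all a at once, settles it.
    inflate-* : ∀ a b → inflate k (a *ₛ b) ≈ₛ inflate k a *ₛ inflate k b
    inflate-* a b n = <-rec (λ n → ∀ a → inflate k (a *ₛ b) n ≈ (inflate k a *ₛ inflate k b) n) step n a
      where
      I = inflate k
      step : ∀ n → (∀ {m} → m ℕ.< n → ∀ a → I (a *ₛ b) m ≈ (I a *ₛ I b) m) →
             ∀ a → I (a *ₛ b) n ≈ (I a *ₛ I b) n
      step n rec a = begin
        I (a *ₛ b) n
          ≈⟨ inflate-tail (a *ₛ b) n ⟩
        const-series (a 0 * b 0 + 0#) n + shift k (I (a 0 ∙ tl b +ₛ tl a *ₛ b)) n
          ≈⟨ +-cong (const-* n) tails ⟩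
        a 0 * const-series (b 0) n + (a 0 * shift k (I (tl b)) n + shift k (I (tl a) *ₛ I b) n)
          ≈⟨ solve 4 (λ x y z w → x :* y :+ (x :* z :+ w) := x :* (y :+ z) :+ w) refl _ _ _ _ ⟩
        a 0 * (const-series (b 0) n + shift k (I (tl b)) n) + shift k (I (tl a) *ₛ I b) n
          ≈⟨ +-cong (trans (const-*ˡ (a 0) (I b) n) (*-congˡ (inflate-tail b n))) (shift-*ˡ k (I (tl a)) (I b) n) ⟨
        (const-series (a 0) *ₛ I b) n + (shift k (I (tl a)) *ₛ I b) n
          ≈⟨ distribʳₛ (I b) (const-series (a 0)) (shift k (I (tl a))) n ⟨
        ((const-series (a 0) +ₛ shift k (I (tl a))) *ₛ I b) n
          ≈⟨ *-congₛ {c = I b} {d = I b} (inflate-tail a) (λ _ → refl) n ⟨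
        (I a *ₛ I b) n ∎
        where
        const-* : ∀ n → const-series (a 0 * b 0 + 0#) n ≈ a 0 * const-series (b 0) n
        const-* zero    = +-identityʳ _
        const-* (suc n) = sym (zeroʳ _)
        tails : shift k (I (a 0 ∙ tl b +ₛ tl a *ₛ b)) n ≈
                a 0 * shift k (I (tl b)) n + shift k (I (tl a) *ₛ I b) n
        tails with below-or-above k n
        ... | inj₁ n<k = begin
          shift k (I (a 0 ∙ tl b +ₛ tl a *ₛ b)) n  ≡⟨ shift-below k _ n<k ⟩
          0#                                       ≈⟨ solve 1 (λ x → con (+ 0) := x :* con (+ 0) :+ con
              (+ 0)) refl (a 0) ⟩
          a 0 * 0# + 0#                            ≡⟨ ≡.cong₂ (λ u v → a 0 * u + v) (shift-below k _ n<k)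
              (shift-below k _ n<k) ⟨
          a 0 * shift k (I (tl b)) n + shift k (I (tl a) *ₛ I b) n ∎
        ... | inj₂ (m , ≡.refl) = begin
          shift k (I (a 0 ∙ tl b +ₛ tl a *ₛ b)) (k ℕ.+ m)
            ≡⟨ shift-at k _ m ⟩
          I (a 0 ∙ tl b +ₛ tl a *ₛ b) m
            ≈⟨ inflate-+ (a 0 ∙ tl b) (tl a *ₛ b) m ⟩
          I (a 0 ∙ tl b) m + I (tl a *ₛ b) m
            ≈⟨ +-cong (inflate-∙ (a 0) (tl b) m) (rec (ℕ.m<n+m m (ℕ.>-nonZero⁻¹ k)) (tl a)) ⟩
          a 0 * I (tl b) m + (I (tl a) *ₛ I b) m
            ≡⟨ ≡.cong₂ (λ u v → a 0 * u + v) (shift-at k _ m) (shift-at k _ m) ⟨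
          a 0 * shift k (I (tl b)) (k ℕ.+ m) + shift k (I (tl a) *ₛ I b) (k ℕ.+ m) ∎

  inflate-inflate : ∀ k l .{{_ : NonZero k}} .{{_ : NonZero l}} a →
                    inflate k (inflate l a) ≈ₛ inflate (l ℕ.* k) a
  inflate-inflate k l a = inflate-unique (l ℕ.* k) {{ℕ.m*n≢0 l k}} {a} {inflate k (inflate l a)} at off
    where
    at : ∀ q → inflate k (inflate l a) (q ℕ.* (l ℕ.* k)) ≈ a q
    at q = begin
      inflate k (inflate l a) (q ℕ.* (l ℕ.* k))  ≡⟨ ≡.cong (inflate k (inflate l a)) (ℕ.*-assoc q l k) ⟨
      inflate k (inflate l a) (q ℕ.* l ℕ.* k)    ≡⟨ inflate-∣ k (inflate l a) (q ℕ.* l) ⟩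
      inflate l a (q ℕ.* l)                      ≡⟨ inflate-∣ l a q ⟩
      a q                                        ∎
    off : ∀ n → ¬ (l ℕ.* k) ∣ n → inflate k (inflate l a) n ≈ 0#
    off n lk∤n with k ∣? n
    ... | no _                   = refl
    ... | yes (divides q ≡.refl) = reflexive (inflate-∤ l a λ l∣q → lk∤n (ℕ∣.*-monoˡ-∣ k l∣q))

  inflate-1 : ∀ a → inflate 1 a ≈ₛ a
  inflate-1 a n = sym (inflate-unique 1 {a} {a} (λ q → reflexive (≡.cong a (ℕ.*-identityʳ q)))
    (λ n 1∤n → contradiction (ℕ∣.1∣ n) 1∤n) n)

-- The commutative ring of Puiseux series and its subrings K[[z^{1/d}]].

module PuiseuxRing {a ℓ} (K : CommutativeRing a ℓ) where
  open import Data.List.Base using ([]; _∷_)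
  private module K = CommutativeRing K
  open PuiseuxSeries K.rawRing hiding (inflate; shift; cauchyProduct; rawRing)
  open PowerSeries K
  open RingKit seriesRing

  private
    -- If a stands for Σ aₙ zⁿᐟᵈ, then M s k a gives the coefficients of
    -- z^{s/(dk)} Σ aₙ zⁿᐟᵈ as a series in z^{1/(dk)}.
    M : ℕ → ℕ → Series → Series
    M s k a = shift s (inflate k a)

    M-≡ : ∀ {s t k l} a → s ≡ t → k ≡ l → M s k a ≈ M t l a
    M-≡ a ≡.refl ≡.refl = refl

    M-cong : ∀ s k .{{_ : NonZero k}} {a b} → a ≈ b → M s k a ≈ M s k b
    M-cong s k a≈b = shift-cong s (inflate-cong k a≈b)

    M-injective : ∀ s k .{{_ : NonZero k}} {a b} → M s k a ≈ M s k b → a ≈ b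
    M-injective s k eq = inflate-injective k (shift-injective s eq)

    M-+ : ∀ s k .{{_ : NonZero k}} a b → M s k (a + b) ≈ M s k a + M s k b
    M-+ s k a b = trans (shift-cong s (inflate-+ k a b)) (shift-+ s (inflate k a) (inflate k b))

    M-neg : ∀ s k .{{_ : NonZero k}} a → M s k (- a) ≈ - M s k a
    M-neg s k a = trans (shift-cong s (inflate-neg k a)) (shift-neg s (inflate k a))

    M-* : ∀ s t k .{{_ : NonZero k}} a b → M (s ℕ.+ t) k (a * b) ≈ M s k a * M t k b
    M-* s t k a b = trans (shift-cong (s ℕ.+ t) (inflate-* k a b))
      (sym (shift-*-shift s t (inflate k a) (inflate k b)))

    -- `M s k` moves the coefficient at n to `s + k n`, so these operations compose like affine
    -- maps. Every change of denominator or pole thereby becomes an identity in ℕ.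
    M-M : ∀ s k t l .{{_ : NonZero k}} .{{_ : NonZero l}} a →
          M s k (M t l a) ≈ M (s ℕ.+ t ℕ.* k) (l ℕ.* k) a
    M-M s k t l a = begin
      shift s (inflate k (shift t (inflate l a)))
        ≈⟨ shift-cong s (inflate-shift k t (inflate l a)) ⟩
      shift s (shift (t ℕ.* k) (inflate k (inflate l a)))
        ≈⟨ shift-shift s (t ℕ.* k) (inflate k (inflate l a)) ⟩
      shift (s ℕ.+ t ℕ.* k) (inflate k (inflate l a))
        ≈⟨ shift-cong (s ℕ.+ t ℕ.* k) (inflate-inflate k l a) ⟩
      M (s ℕ.+ t ℕ.* k) (l ℕ.* k) a ∎

    M-1 : ∀ a → M 0 1 a ≈ a
    M-1 = inflate-1

    ≈ₚ-elim : ∀ s k .{{_ : NonZero k}} {f g} → f ≈ₚ g → let open Puiseux in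
      M (s ℕ.+ pole g ℕ.* den f ℕ.* k) (den g ℕ.* k) (coeff f) ≈
      M (s ℕ.+ pole f ℕ.* den g ℕ.* k) (den f ℕ.* k) (coeff g)
    ≈ₚ-elim s k {f} {g} f≈g = begin
      M (s ℕ.+ pole g ℕ.* den f ℕ.* k) (den g ℕ.* k) (coeff f)
        ≈⟨ M-M s k (pole g ℕ.* den f) (den g) (coeff f) ⟨
      M s k (M (pole g ℕ.* den f) (den g) (coeff f))
        ≈⟨ M-cong s k f≈g ⟩
      M s k (M (pole f ℕ.* den g) (den f) (coeff g))
        ≈⟨ M-M s k (pole f ℕ.* den g) (den f) (coeff g) ⟩
      M (s ℕ.+ pole f ℕ.* den g ℕ.* k) (den f ℕ.* k) (coeff g) ∎
      where open Puiseux

    -- The definition of `≈ₚ` prescribes the product of the denominators, but any common denominator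
    -- and pole will do: the given comparison and the prescribed one both pass to the denominator
    -- `d * e * k`, and `M` is injective.
    ≈ₚ-intro : ∀ f g k l s t .{{_ : NonZero k}} .{{_ : NonZero l}} → let open Puiseux in
      den f ℕ.* k ≡ den g ℕ.* l → pole f ℕ.* k ℕ.+ s ≡ pole g ℕ.* l ℕ.+ t →
      M s k (coeff f) ≈ M t l (coeff g) → f ≈ₚ g
    ≈ₚ-intro f@(record {den = d; pole = p; coeff = a}) g@(record {den = e; pole = q; coeff = b})
      k l s t dk≡el pk+s≡ql+t eq =
      M-injective (s ℕ.* e) k (begin
        M (s ℕ.* e) k (M (q ℕ.* d) e a)
          ≈⟨ M-M (s ℕ.* e) k (q ℕ.* d) e a ⟩
        M (s ℕ.* e ℕ.+ q ℕ.* d ℕ.* k) (e ℕ.* k) a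
          ≈⟨ M-≡ a (ℕ.+-comm (s ℕ.* e) _) (ℕ.*-comm e k) ⟩
        M (q ℕ.* d ℕ.* k ℕ.+ s ℕ.* e) (k ℕ.* e) a
          ≈⟨ M-M (q ℕ.* d ℕ.* k) e s k a ⟨
        M (q ℕ.* d ℕ.* k) e (M s k a)
          ≈⟨ M-cong (q ℕ.* d ℕ.* k) e eq ⟩
        M (q ℕ.* d ℕ.* k) e (M t l b)
          ≈⟨ M-M (q ℕ.* d ℕ.* k) e t l b ⟩
        M (q ℕ.* d ℕ.* k ℕ.+ t ℕ.* e) (l ℕ.* e) b
          ≈⟨ M-≡ b poles (≡.trans (ℕ.*-comm l e) (≡.sym dk≡el)) ⟩
        M (s ℕ.* e ℕ.+ p ℕ.* e ℕ.* k) (d ℕ.* k) b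
          ≈⟨ M-M (s ℕ.* e) k (p ℕ.* e) d b ⟨
        M (s ℕ.* e) k (M (p ℕ.* e) d b) ∎)
      where
      poles : q ℕ.* d ℕ.* k ℕ.+ t ℕ.* e ≡ s ℕ.* e ℕ.+ p ℕ.* e ℕ.* k
      poles = ≡.trans (≡.cong (ℕ._+ t ℕ.* e) (≡.trans (ℕ.*-assoc q d k) (≡.cong (q ℕ.*_) dk≡el)))
        (≡.trans lhs (≡.trans (≡.cong (e ℕ.*_) (≡.sym pk+s≡ql+t)) rhs))
        where
        lhs : q ℕ.* (e ℕ.* l) ℕ.+ t ℕ.* e ≡ e ℕ.* (q ℕ.* l ℕ.+ t)
        lhs = ℕSolver.solve (q ∷ e ∷ l ∷ t ∷ [])
        rhs : e ℕ.* (p ℕ.* k ℕ.+ s) ≡ s ℕ.* e ℕ.+ p ℕ.* e ℕ.* k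
        rhs = ℕSolver.solve (p ∷ e ∷ k ∷ s ∷ [])

    ≈ₚ-intro′ : ∀ f g → let open Puiseux in
      den f ≡ den g → pole f ≡ pole g → coeff f ≈ coeff g → f ≈ₚ g
    ≈ₚ-intro′ f g dens poles coeffs = ≈ₚ-intro f g 1 1 0 0 (≡.cong (ℕ._* 1) dens)
      (≡.cong (λ p → p ℕ.* 1 ℕ.+ 0) poles) (M-cong 0 1 coeffs)

    M-+ₚ : ∀ s k .{{_ : NonZero k}} f g → let open Puiseux in
      M s k (coeff (f +ₚ g)) ≈ M (s ℕ.+ pole g ℕ.* den f ℕ.* k) (den g ℕ.* k) (coeff f)
                             + M (s ℕ.+ pole f ℕ.* den g ℕ.* k) (den f ℕ.* k) (coeff g)
    M-+ₚ s k f g = trans (M-+ s k (commonCoeff f g) (commonCoeff g f))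
      (+-cong (M-M s k (pole g ℕ.* den f) (den g) (coeff f)) (M-M s k (pole f ℕ.* den g) (den f) (coeff g)))
      where open Puiseux

    M-*ₚ : ∀ s t k .{{_ : NonZero k}} f g → let open Puiseux in
      M (s ℕ.+ t) k (coeff (f *ₚ g)) ≈ M s (den g ℕ.* k) (coeff f) * M t (den f ℕ.* k) (coeff g)
    M-*ₚ s t k f g = trans (M-* s t k (inflate (den g) (coeff f)) (inflate (den f) (coeff g)))
      (*-cong (shift-cong s (inflate-inflate k (den g) (coeff f)))
              (shift-cong t (inflate-inflate k (den f) (coeff g))))
      where open Puiseux

    nz* : ∀ d e .{{_ : NonZero d}} .{{_ : NonZero e}} → NonZero (d ℕ.* e)
    nz* d e = ℕ.m*n≢0 d e

    -- As for fractions, both hypotheses are brought to the product of all three denominators, where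
    -- they meet in the coefficients of g.
    ≈ₚ-trans : ∀ {f g h} → f ≈ₚ g → g ≈ₚ h → f ≈ₚ h
    ≈ₚ-trans {f@(record {den = d; pole = p; coeff = a})} {g@(record {den = e; pole = q; coeff = b})}
      {h@(record {den = c; pole = r; coeff = u})} f≈g g≈h =
      ≈ₚ-intro f h (e ℕ.* c) (e ℕ.* d) (r ℕ.* e ℕ.* d ℕ.+ q ℕ.* d ℕ.* c) (p ℕ.* e ℕ.* c ℕ.+ q ℕ.* c ℕ.* d)
        {{nz* e c}} {{nz* e d}}
        (ℕSolver.solve (d ∷ e ∷ c ∷ [])) (ℕSolver.solve (p ∷ q ∷ r ∷ d ∷ e ∷ c ∷ [])) (begin
        M (r ℕ.* e ℕ.* d ℕ.+ q ℕ.* d ℕ.* c) (e ℕ.* c) a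
          ≈⟨ ≈ₚ-elim (r ℕ.* e ℕ.* d) c {f} {g} f≈g ⟩
        M (r ℕ.* e ℕ.* d ℕ.+ p ℕ.* e ℕ.* c) (d ℕ.* c) b
          ≈⟨ M-≡ {r ℕ.* e ℕ.* d ℕ.+ p ℕ.* e ℕ.* c} {p ℕ.* e ℕ.* c ℕ.+ r ℕ.* e ℕ.* d} b (ℕSolver.solve
              (p ∷ r ∷ d ∷ e ∷ c ∷ [])) (ℕ.*-comm d c) ⟩
        M (p ℕ.* e ℕ.* c ℕ.+ r ℕ.* e ℕ.* d) (c ℕ.* d) b
          ≈⟨ ≈ₚ-elim (p ℕ.* e ℕ.* c) d {g} {h} g≈h ⟩
        M (p ℕ.* e ℕ.* c ℕ.+ q ℕ.* c ℕ.* d) (e ℕ.* d) u ∎)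

    +ₚ-comm : ∀ f g → f +ₚ g ≈ₚ g +ₚ f
    +ₚ-comm f@(record {den = d; pole = p; coeff = a}) g@(record {den = e; pole = q; coeff = b}) =
      ≈ₚ-intro′ (f +ₚ g) (g +ₚ f) (ℕ.*-comm d e) (ℕ.+-comm (p ℕ.* e) (q ℕ.* d))
        (+-comm (commonCoeff f g) (commonCoeff g f))

    +ₚ-congʳ : ∀ {f f′} g → f ≈ₚ f′ → f +ₚ g ≈ₚ f′ +ₚ g
    +ₚ-congʳ {f@(record {den = d; pole = p; coeff = a})} {f′@(record {den = d′; pole = p′; coeff = a′})}
      g@(record {den = e; pole = q; coeff = b}) f≈f′ =
      ≈ₚ-intro (f +ₚ g) (f′ +ₚ g) d′ d (p′ ℕ.* e ℕ.* d) (p ℕ.* e ℕ.* d′)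
        (d ℕ.* e ℕ.* d′ ≡ d′ ℕ.* e ℕ.* d ∋ ℕSolver.solve (d ∷ d′ ∷ e ∷ [])) ((p ℕ.* e ℕ.+ q ℕ.* d) ℕ.* d′
            ℕ.+ p′ ℕ.* e ℕ.* d ≡ (p′ ℕ.* e ℕ.+ q ℕ.* d′) ℕ.* d ℕ.+ p ℕ.* e ℕ.* d′ ∋ ℕSolver.solve
            (p ∷ p′ ∷ q ∷ d ∷ d′ ∷ e ∷ [])) (begin
        M (p′ ℕ.* e ℕ.* d) d′ (Puiseux.coeff (f +ₚ g))
          ≈⟨ M-+ₚ (p′ ℕ.* e ℕ.* d) d′ f g ⟩
        M (p′ ℕ.* e ℕ.* d ℕ.+ q ℕ.* d ℕ.* d′) (e ℕ.* d′) a
          + M (p′ ℕ.* e ℕ.* d ℕ.+ p ℕ.* e ℕ.* d′) (d ℕ.* d′) b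
          ≈⟨ +-cong left (M-≡ b (ℕ.+-comm (p′ ℕ.* e ℕ.* d) _) (ℕ.*-comm d d′)) ⟩
        M (p ℕ.* e ℕ.* d′ ℕ.+ q ℕ.* d′ ℕ.* d) (e ℕ.* d) a′
          + M (p ℕ.* e ℕ.* d′ ℕ.+ p′ ℕ.* e ℕ.* d) (d′ ℕ.* d) b
          ≈⟨ M-+ₚ (p ℕ.* e ℕ.* d′) d f′ g ⟨
        M (p ℕ.* e ℕ.* d′) d (Puiseux.coeff (f′ +ₚ g)) ∎)
      where
      left : M (p′ ℕ.* e ℕ.* d ℕ.+ q ℕ.* d ℕ.* d′) (e ℕ.* d′) a ≈
             M (p ℕ.* e ℕ.* d′ ℕ.+ q ℕ.* d′ ℕ.* d) (e ℕ.* d) a′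
      left = begin
        M (p′ ℕ.* e ℕ.* d ℕ.+ q ℕ.* d ℕ.* d′) (e ℕ.* d′) a
          ≈⟨ M-≡ {p′ ℕ.* e ℕ.* d ℕ.+ q ℕ.* d ℕ.* d′} {q ℕ.* d ℕ.* d′ ℕ.+ p′ ℕ.* d ℕ.* e} a (ℕSolver.solve
              (p′ ∷ q ∷ d ∷ d′ ∷ e ∷ [])) (ℕ.*-comm e d′) ⟩
        M (q ℕ.* d ℕ.* d′ ℕ.+ p′ ℕ.* d ℕ.* e) (d′ ℕ.* e) a
          ≈⟨ ≈ₚ-elim (q ℕ.* d ℕ.* d′) e {f} {f′} f≈f′ ⟩
        M (q ℕ.* d ℕ.* d′ ℕ.+ p ℕ.* d′ ℕ.* e) (d ℕ.* e) a′
          ≈⟨ M-≡ {q ℕ.* d ℕ.* d′ ℕ.+ p ℕ.* d′ ℕ.* e} {p ℕ.* e ℕ.* d′ ℕ.+ q ℕ.* d′ ℕ.* d} a′ (ℕSolver.solve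
              (p ∷ q ∷ d ∷ d′ ∷ e ∷ [])) (ℕ.*-comm d e) ⟩
        M (p ℕ.* e ℕ.* d′ ℕ.+ q ℕ.* d′ ℕ.* d) (e ℕ.* d) a′ ∎

    +ₚ-cong : ∀ {f f′ g g′} → f ≈ₚ f′ → g ≈ₚ g′ → f +ₚ g ≈ₚ f′ +ₚ g′
    +ₚ-cong {f} {f′} {g} {g′} f≈f′ g≈g′ =
      ≈ₚ-trans {f +ₚ g} {f′ +ₚ g} {f′ +ₚ g′} (+ₚ-congʳ {f} {f′} g f≈f′)
      (≈ₚ-trans {f′ +ₚ g} {g +ₚ f′} {f′ +ₚ g′} (+ₚ-comm f′ g)
      (≈ₚ-trans {g +ₚ f′} {g′ +ₚ f′} {f′ +ₚ g′} (+ₚ-congʳ {g} {g′} f′ g≈g′) (+ₚ-comm g′ f′)))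

    +ₚ-assoc : ∀ f g h → (f +ₚ g) +ₚ h ≈ₚ f +ₚ (g +ₚ h)
    +ₚ-assoc f@(record {den = d; pole = p; coeff = a}) g@(record {den = e; pole = q; coeff = b})
      h@(record {den = c; pole = r; coeff = u}) =
      ≈ₚ-intro′ ((f +ₚ g) +ₚ h) (f +ₚ (g +ₚ h)) (ℕ.*-assoc d e c) ((p ℕ.* e ℕ.+ q ℕ.* d) ℕ.* c ℕ.+ r ℕ.*
          (d ℕ.* e) ≡ p ℕ.* (e ℕ.* c) ℕ.+ (q ℕ.* c ℕ.+ r ℕ.* e) ℕ.* d ∋ ℕSolver.solve
          (p ∷ q ∷ r ∷ d ∷ e ∷ c ∷ [])) (begin
        M (r ℕ.* (d ℕ.* e)) c (Puiseux.coeff (f +ₚ g)) + M ((p ℕ.* e ℕ.+ q ℕ.* d) ℕ.* c) (d ℕ.* e) u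
          ≈⟨ +-congʳ (M-+ₚ (r ℕ.* (d ℕ.* e)) c f g) ⟩
        (M (r ℕ.* (d ℕ.* e) ℕ.+ q ℕ.* d ℕ.* c) (e ℕ.* c) a + M (r ℕ.* (d ℕ.* e) ℕ.+ p ℕ.* e ℕ.* c) (d ℕ.* c) b)
          + M ((p ℕ.* e ℕ.+ q ℕ.* d) ℕ.* c) (d ℕ.* e) u
          ≈⟨ +-assoc _ _ _ ⟩
        M (r ℕ.* (d ℕ.* e) ℕ.+ q ℕ.* d ℕ.* c) (e ℕ.* c) a + (M (r ℕ.* (d ℕ.* e) ℕ.+ p ℕ.* e ℕ.* c) (d ℕ.* c) b
          + M ((p ℕ.* e ℕ.+ q ℕ.* d) ℕ.* c) (d ℕ.* e) u)
          ≈⟨ +-cong (M-≡ {r ℕ.* (d ℕ.* e) ℕ.+ q ℕ.* d ℕ.* c} {(q ℕ.* c ℕ.+ r ℕ.* e) ℕ.* d} {e ℕ.* c} {e ℕ.* c} a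
              (ℕSolver.solve (q ∷ r ∷ d ∷ e ∷ c ∷ [])) ≡.refl)
              (+-cong (M-≡ {r ℕ.* (d ℕ.* e) ℕ.+ p ℕ.* e ℕ.* c} {p ℕ.* (e ℕ.* c) ℕ.+ r ℕ.* e ℕ.* d} b
                  (ℕSolver.solve (p ∷ r ∷ d ∷ e ∷ c ∷ [])) (ℕ.*-comm d c))
                      (M-≡ {(p ℕ.* e ℕ.+ q ℕ.* d) ℕ.* c} {p ℕ.* (e ℕ.* c) ℕ.+ q ℕ.* c ℕ.* d} u (ℕSolver.solve
                          (p ∷ q ∷ d ∷ e ∷ c ∷ [])) (ℕ.*-comm d e))) ⟩
        M ((q ℕ.* c ℕ.+ r ℕ.* e) ℕ.* d) (e ℕ.* c) a + (M (p ℕ.* (e ℕ.* c) ℕ.+ r ℕ.* e ℕ.* d) (c ℕ.* d) b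
          + M (p ℕ.* (e ℕ.* c) ℕ.+ q ℕ.* c ℕ.* d) (e ℕ.* d) u)
          ≈⟨ +-congˡ (M-+ₚ (p ℕ.* (e ℕ.* c)) d g h) ⟨
        M ((q ℕ.* c ℕ.+ r ℕ.* e) ℕ.* d) (e ℕ.* c) a + M (p ℕ.* (e ℕ.* c)) d (Puiseux.coeff (g +ₚ h)) ∎)

    0ₚ 1ₚ : Puiseux
    0ₚ = constant K.0#
    1ₚ = constant K.1#

    M-0 : ∀ s k .{{_ : NonZero k}} → M s k (const-series K.0#) ≈ 0#
    M-0 s k n = K.trans (shift-cong s (inflate-const k K.0#) n)
      (K.sym (shift-unique s {const-series K.0#} {0#} (λ _ _ → K.refl) (λ n → K.sym (const-0 n)) n))

    +ₚ-identityˡ : ∀ f → 0ₚ +ₚ f ≈ₚ f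
    +ₚ-identityˡ f@(record {den = d; pole = p; coeff = a}) =
      ≈ₚ-intro′ (0ₚ +ₚ f) f (ℕ.*-identityˡ d) (ℕ.*-identityʳ p) (begin
        M (p ℕ.* 1) d (const-series K.0#) + M 0 1 a  ≈⟨ +-cong (M-0 (p ℕ.* 1) d) (M-1 a) ⟩
        0# + a                                       ≈⟨ +-identityˡ a ⟩
        a                                            ∎)

    -ₚ-inverseˡ : ∀ f → (-ₚ f) +ₚ f ≈ₚ 0ₚ
    -ₚ-inverseˡ f@(record {den = d; pole = p; coeff = a}) =
      ≈ₚ-intro ((-ₚ f) +ₚ f) 0ₚ 1 (d ℕ.* d) 0 (p ℕ.* d ℕ.+ p ℕ.* d) {{_}} {{nz* d d}}
        (d ℕ.* d ℕ.* 1 ≡ 1 ℕ.* (d ℕ.* d) ∋ ℕSolver.solve (d ∷ [])) ((p ℕ.* d ℕ.+ p ℕ.* d) ℕ.* 1 ℕ.+ 0 ≡ 0 ℕ.*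
            (d ℕ.* d) ℕ.+ (p ℕ.* d ℕ.+ p ℕ.* d) ∋ ℕSolver.solve (p ∷ d ∷ [])) (begin
        M 0 1 (M (p ℕ.* d) d (- a) + M (p ℕ.* d) d a)   ≈⟨ M-1 _ ⟩
        M (p ℕ.* d) d (- a) + M (p ℕ.* d) d a           ≈⟨ +-congʳ (M-neg (p ℕ.* d) d a) ⟩
        - M (p ℕ.* d) d a + M (p ℕ.* d) d a             ≈⟨ -‿inverseˡ (M (p ℕ.* d) d a) ⟩
        0#                                              ≈⟨ M-0 (p ℕ.* d ℕ.+ p ℕ.* d) (d ℕ.* d) {{nz* d d}} ⟨
        M (p ℕ.* d ℕ.+ p ℕ.* d) (d ℕ.* d) (const-series K.0#) ∎)

    -ₚ-cong : ∀ {f g} → f ≈ₚ g → -ₚ f ≈ₚ -ₚ g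
    -ₚ-cong {f} {g} f≈g = begin
      M (pole g ℕ.* den f) (den g) (- coeff f)   ≈⟨ M-neg (pole g ℕ.* den f) (den g) (coeff f) ⟩
      - M (pole g ℕ.* den f) (den g) (coeff f)   ≈⟨ -‿cong f≈g ⟩
      - M (pole f ℕ.* den g) (den f) (coeff g)   ≈⟨ M-neg (pole f ℕ.* den g) (den f) (coeff g) ⟨
      M (pole f ℕ.* den g) (den f) (- coeff g)   ∎
      where open Puiseux

    *ₚ-comm : ∀ f g → f *ₚ g ≈ₚ g *ₚ f
    *ₚ-comm f@(record {den = d; pole = p; coeff = a}) g@(record {den = e; pole = q; coeff = b}) =
      ≈ₚ-intro′ (f *ₚ g) (g *ₚ f) (ℕ.*-comm d e) (ℕ.+-comm (p ℕ.* e) (q ℕ.* d))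
        (*-comm (inflate e a) (inflate d b))

    *ₚ-congʳ : ∀ {f f′} g → f ≈ₚ f′ → f *ₚ g ≈ₚ f′ *ₚ g
    *ₚ-congʳ {f@(record {den = d; pole = p; coeff = a})} {f′@(record {den = d′; pole = p′; coeff = a′})}
      g@(record {den = e; pole = q; coeff = b}) f≈f′ =
      ≈ₚ-intro (f *ₚ g) (f′ *ₚ g) d′ d (p′ ℕ.* d ℕ.* e ℕ.+ 0) (p ℕ.* d′ ℕ.* e ℕ.+ 0)
        (d ℕ.* e ℕ.* d′ ≡ d′ ℕ.* e ℕ.* d ∋ ℕSolver.solve (d ∷ d′ ∷ e ∷ [])) ((p ℕ.* e ℕ.+ q ℕ.* d) ℕ.* d′ ℕ.+
            (p′ ℕ.* d ℕ.* e ℕ.+ 0) ≡ (p′ ℕ.* e ℕ.+ q ℕ.* d′) ℕ.* d ℕ.+ (p ℕ.* d′ ℕ.* e ℕ.+ 0) ∋ ℕSolver.solve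
            (p ∷ p′ ∷ q ∷ d ∷ d′ ∷ e ∷ [])) (begin
        M (p′ ℕ.* d ℕ.* e ℕ.+ 0) d′ (Puiseux.coeff (f *ₚ g))
          ≈⟨ M-*ₚ (p′ ℕ.* d ℕ.* e) 0 d′ f g ⟩
        M (p′ ℕ.* d ℕ.* e) (e ℕ.* d′) a * M 0 (d ℕ.* d′) b
          ≈⟨ *-cong left (M-≡ {0} {0} b ≡.refl (ℕ.*-comm d d′)) ⟩
        M (p ℕ.* d′ ℕ.* e) (e ℕ.* d) a′ * M 0 (d′ ℕ.* d) b
          ≈⟨ M-*ₚ (p ℕ.* d′ ℕ.* e) 0 d f′ g ⟨
        M (p ℕ.* d′ ℕ.* e ℕ.+ 0) d (Puiseux.coeff (f′ *ₚ g)) ∎)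
      where
      left : M (p′ ℕ.* d ℕ.* e) (e ℕ.* d′) a ≈ M (p ℕ.* d′ ℕ.* e) (e ℕ.* d) a′
      left = begin
        M (p′ ℕ.* d ℕ.* e) (e ℕ.* d′) a  ≈⟨ M-≡ {p′ ℕ.* d ℕ.* e} {p′ ℕ.* d ℕ.* e} a ≡.refl (ℕ.*-comm e d′) ⟩
        M (p′ ℕ.* d ℕ.* e) (d′ ℕ.* e) a  ≈⟨ ≈ₚ-elim 0 e {f} {f′} f≈f′ ⟩
        M (p ℕ.* d′ ℕ.* e) (d ℕ.* e) a′  ≈⟨ M-≡ {p ℕ.* d′ ℕ.* e} {p ℕ.* d′ ℕ.* e} a′ ≡.refl (ℕ.*-comm d e) ⟩
        M (p ℕ.* d′ ℕ.* e) (e ℕ.* d) a′  ∎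

    *ₚ-cong : ∀ {f f′ g g′} → f ≈ₚ f′ → g ≈ₚ g′ → f *ₚ g ≈ₚ f′ *ₚ g′
    *ₚ-cong {f} {f′} {g} {g′} f≈f′ g≈g′ =
      ≈ₚ-trans {f *ₚ g} {f′ *ₚ g} {f′ *ₚ g′} (*ₚ-congʳ {f} {f′} g f≈f′)
      (≈ₚ-trans {f′ *ₚ g} {g *ₚ f′} {f′ *ₚ g′} (*ₚ-comm f′ g)
      (≈ₚ-trans {g *ₚ f′} {g′ *ₚ f′} {f′ *ₚ g′} (*ₚ-congʳ {g} {g′} f′ g≈g′) (*ₚ-comm g′ f′)))

    *ₚ-assoc : ∀ f g h → (f *ₚ g) *ₚ h ≈ₚ f *ₚ (g *ₚ h)
    *ₚ-assoc f@(record {den = d; pole = p; coeff = a}) g@(record {den = e; pole = q; coeff = b})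
      h@(record {den = c; pole = r; coeff = u}) =
      ≈ₚ-intro′ ((f *ₚ g) *ₚ h) (f *ₚ (g *ₚ h)) (ℕ.*-assoc d e c) ((p ℕ.* e ℕ.+ q ℕ.* d) ℕ.* c ℕ.+ r ℕ.*
          (d ℕ.* e) ≡ p ℕ.* (e ℕ.* c) ℕ.+ (q ℕ.* c ℕ.+ r ℕ.* e) ℕ.* d ∋ ℕSolver.solve
          (p ∷ q ∷ r ∷ d ∷ e ∷ c ∷ [])) (begin
        M 0 c (Puiseux.coeff (f *ₚ g)) * M 0 (d ℕ.* e) u
          ≈⟨ *-congʳ (M-*ₚ 0 0 c f g) ⟩
        (M 0 (e ℕ.* c) a * M 0 (d ℕ.* c) b) * M 0 (d ℕ.* e) u
          ≈⟨ *-assoc (M 0 (e ℕ.* c) a) (M 0 (d ℕ.* c) b) (M 0 (d ℕ.* e) u) ⟩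
        M 0 (e ℕ.* c) a * (M 0 (d ℕ.* c) b * M 0 (d ℕ.* e) u)
          ≈⟨ *-congˡ {M 0 (e ℕ.* c) a} (*-cong (M-≡ {0} {0} b ≡.refl (ℕ.*-comm d c)) (M-≡ {0} {0} u ≡.refl
              (ℕ.*-comm d e))) ⟩
        M 0 (e ℕ.* c) a * (M 0 (c ℕ.* d) b * M 0 (e ℕ.* d) u)
          ≈⟨ *-congˡ {M 0 (e ℕ.* c) a} (M-*ₚ 0 0 d g h) ⟨
        M 0 (e ℕ.* c) a * M 0 d (Puiseux.coeff (g *ₚ h)) ∎)

    *ₚ-identityˡ : ∀ f → 1ₚ *ₚ f ≈ₚ f
    *ₚ-identityˡ f@(record {den = d; pole = p; coeff = a}) =
      ≈ₚ-intro′ (1ₚ *ₚ f) f (ℕ.*-identityˡ d) (ℕ.*-identityʳ p) (begin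
        inflate d (const-series K.1#) * inflate 1 a  ≈⟨ *-cong (inflate-const d K.1#) (inflate-1 a) ⟩
        1# * a                                       ≈⟨ *-identityˡ a ⟩
        a                                            ∎)

    *ₚ-distribˡ : ∀ f g h → f *ₚ (g +ₚ h) ≈ₚ (f *ₚ g) +ₚ (f *ₚ h)
    *ₚ-distribˡ f@(record {den = d; pole = p; coeff = a}) g@(record {den = e; pole = q; coeff = b})
      h@(record {den = c; pole = r; coeff = u}) =
      -- The right side carries the denominator and the pole of f twice. The factor d and the shift
      -- `s = p * d * e * c` on the left make up for the extra copy.
      ≈ₚ-intro (f *ₚ (g +ₚ h)) ((f *ₚ g) +ₚ (f *ₚ h)) d 1 (s ℕ.+ 0) 0
        (d ℕ.* (e ℕ.* c) ℕ.* d ≡ d ℕ.* e ℕ.* (d ℕ.* c) ℕ.* 1 ∋ ℕSolver.solve (d ∷ e ∷ c ∷ [])) ((p ℕ.* (e ℕ.* c)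
            ℕ.+ (q ℕ.* c ℕ.+ r ℕ.* e) ℕ.* d) ℕ.* d ℕ.+ (p ℕ.* d ℕ.* e ℕ.* c ℕ.+ 0) ≡ ((p ℕ.* e ℕ.+ q ℕ.* d) ℕ.*
            (d ℕ.* c) ℕ.+ (p ℕ.* c ℕ.+ r ℕ.* d) ℕ.* (d ℕ.* e)) ℕ.* 1 ℕ.+ 0 ∋ ℕSolver.solve
            (p ∷ q ∷ r ∷ d ∷ e ∷ c ∷ [])) (begin
        M (s ℕ.+ 0) d (Puiseux.coeff (f *ₚ (g +ₚ h)))
          ≈⟨ M-*ₚ s 0 d f (g +ₚ h) ⟩
        A * M 0 (d ℕ.* d) (Puiseux.coeff (g +ₚ h))
          ≈⟨ *-congˡ {A} (M-+ₚ 0 (d ℕ.* d) {{nz* d d}} g h) ⟩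
        A * (M (r ℕ.* e ℕ.* (d ℕ.* d)) (c ℕ.* (d ℕ.* d)) b + M (q ℕ.* c ℕ.* (d ℕ.* d)) (e ℕ.* (d ℕ.* d)) u)
          ≈⟨ distribˡ A _ _ ⟩
        A * M (r ℕ.* e ℕ.* (d ℕ.* d)) (c ℕ.* (d ℕ.* d)) b + A * M (q ℕ.* c ℕ.* (d ℕ.* d)) (e ℕ.* (d ℕ.* d)) u
          ≈⟨ +-cong left right ⟩
        M (s₁ ℕ.+ t₁) (d ℕ.* c) (Puiseux.coeff (f *ₚ g)) + M (s₂ ℕ.+ t₂) (d ℕ.* e) (Puiseux.coeff (f *ₚ h))
          ≈⟨ +-cong (M-≡ {p ℕ.* d ℕ.* e ℕ.* c ℕ.+ r ℕ.* e ℕ.* (d ℕ.* d)} {(p ℕ.* c ℕ.+ r ℕ.* d) ℕ.* (d ℕ.* e)}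
              {d ℕ.* c} {d ℕ.* c} (Puiseux.coeff (f *ₚ g)) (p ℕ.* d ℕ.* e ℕ.* c ℕ.+ r ℕ.* e ℕ.* (d ℕ.* d) ≡
              (p ℕ.* c ℕ.+ r ℕ.* d) ℕ.* (d ℕ.* e) ∋ ℕSolver.solve (p ∷ r ∷ d ∷ e ∷ c ∷ [])) ≡.refl)
                    (M-≡ {p ℕ.* d ℕ.* e ℕ.* c ℕ.+ q ℕ.* c ℕ.* (d ℕ.* d)} {(p ℕ.* e ℕ.+ q ℕ.* d) ℕ.* (d ℕ.* c)}
                        {d ℕ.* e} {d ℕ.* e} (Puiseux.coeff (f *ₚ h)) (p ℕ.* d ℕ.* e ℕ.* c ℕ.+ q ℕ.* c ℕ.*
                        (d ℕ.* d) ≡ (p ℕ.* e ℕ.+ q ℕ.* d) ℕ.* (d ℕ.* c) ∋ ℕSolver.solve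
                        (p ∷ q ∷ d ∷ e ∷ c ∷ [])) ≡.refl) ⟩
        Puiseux.coeff ((f *ₚ g) +ₚ (f *ₚ h))
          ≈⟨ M-1 (Puiseux.coeff ((f *ₚ g) +ₚ (f *ₚ h))) ⟨
        M 0 1 (Puiseux.coeff ((f *ₚ g) +ₚ (f *ₚ h))) ∎)
      where
      s = p ℕ.* d ℕ.* e ℕ.* c
      A = M s (e ℕ.* c ℕ.* d) a
      s₁ = p ℕ.* d ℕ.* e ℕ.* c
      t₁ = r ℕ.* e ℕ.* (d ℕ.* d)
      s₂ = p ℕ.* d ℕ.* e ℕ.* c
      t₂ = q ℕ.* c ℕ.* (d ℕ.* d)
      left : A * M t₁ (c ℕ.* (d ℕ.* d)) b ≈ M (s₁ ℕ.+ t₁) (d ℕ.* c) (Puiseux.coeff (f *ₚ g))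
      left = begin
        A * M t₁ (c ℕ.* (d ℕ.* d)) b
          ≈⟨ *-cong {A} {M s₁ (e ℕ.* (d ℕ.* c)) a} {M t₁ (c ℕ.* (d ℕ.* d)) b} {M t₁ (d ℕ.* (d ℕ.* c)) b}
               (M-≡ {s} {s} {e ℕ.* c ℕ.* d} {e ℕ.* (d ℕ.* c)} a ≡.refl (ℕSolver.solve (d ∷ e ∷ c ∷ [])))
               (M-≡ {t₁} {t₁} {c ℕ.* (d ℕ.* d)} {d ℕ.* (d ℕ.* c)} b ≡.refl (ℕSolver.solve (d ∷ c ∷ []))) ⟩
        M s₁ (e ℕ.* (d ℕ.* c)) a * M t₁ (d ℕ.* (d ℕ.* c)) b
          ≈⟨ M-*ₚ s₁ t₁ (d ℕ.* c) {{nz* d c}} f g ⟨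
        M (s₁ ℕ.+ t₁) (d ℕ.* c) (Puiseux.coeff (f *ₚ g)) ∎
      right : A * M t₂ (e ℕ.* (d ℕ.* d)) u ≈ M (s₂ ℕ.+ t₂) (d ℕ.* e) (Puiseux.coeff (f *ₚ h))
      right = begin
        A * M t₂ (e ℕ.* (d ℕ.* d)) u
          ≈⟨ *-cong {A} {M s₂ (c ℕ.* (d ℕ.* e)) a} {M t₂ (e ℕ.* (d ℕ.* d)) u} {M t₂ (d ℕ.* (d ℕ.* e)) u}
               (M-≡ {s} {s} {e ℕ.* c ℕ.* d} {c ℕ.* (d ℕ.* e)} a ≡.refl (ℕSolver.solve (d ∷ e ∷ c ∷ [])))
               (M-≡ {t₂} {t₂} {e ℕ.* (d ℕ.* d)} {d ℕ.* (d ℕ.* e)} u ≡.refl (ℕSolver.solve (d ∷ e ∷ []))) ⟩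
        M s₂ (c ℕ.* (d ℕ.* e)) a * M t₂ (d ℕ.* (d ℕ.* e)) u
          ≈⟨ M-*ₚ s₂ t₂ (d ℕ.* e) {{nz* d e}} f h ⟨
        M (s₂ ℕ.+ t₂) (d ℕ.* e) (Puiseux.coeff (f *ₚ h)) ∎

  puiseuxRing : CommutativeRing a ℓ
  puiseuxRing = record
    { Carrier = Puiseux ; _≈_ = _≈ₚ_ ; _+_ = _+ₚ_ ; _*_ = _*ₚ_ ; -_ = -ₚ_ ; 0# = 0ₚ ; 1# = 1ₚ
    ; isCommutativeRing = record
      { isRing = record
        { +-isAbelianGroup = record
          { isGroup = record
            { isMonoid = record
              { isSemigroup = record
                { isMagma = record
                  { isEquivalence = record
                    { refl = λ {f} n → K.refl ; sym = λ p n → K.sym (p n)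
                    ; trans = λ {f} {g} {h} → ≈ₚ-trans {f} {g} {h} }
                  ; ∙-cong = λ {f} {f′} {g} {g′} → +ₚ-cong {f} {f′} {g} {g′} }
                ; assoc = +ₚ-assoc }
              ; identity = +ₚ-identityˡ , λ f →
                  ≈ₚ-trans {f +ₚ 0ₚ} {0ₚ +ₚ f} {f} (+ₚ-comm f 0ₚ) (+ₚ-identityˡ f) }
            ; inverse = -ₚ-inverseˡ , λ f →
                ≈ₚ-trans {f +ₚ (-ₚ f)} {(-ₚ f) +ₚ f} {0ₚ} (+ₚ-comm f (-ₚ f)) (-ₚ-inverseˡ f)
            ; ⁻¹-cong = λ {f} {g} → -ₚ-cong {f} {g} }
          ; comm = +ₚ-comm }
        ; *-cong = λ {f} {f′} {g} {g′} → *ₚ-cong {f} {f′} {g} {g′}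
        ; *-assoc = *ₚ-assoc
        ; *-identity = *ₚ-identityˡ , λ f →
            ≈ₚ-trans {f *ₚ 1ₚ} {1ₚ *ₚ f} {f} (*ₚ-comm f 1ₚ) (*ₚ-identityˡ f)
        ; distrib = *ₚ-distribˡ , λ f g h →
            ≈ₚ-trans {(g +ₚ h) *ₚ f} {f *ₚ (g +ₚ h)} {(g *ₚ f) +ₚ (h *ₚ f)} (*ₚ-comm (g +ₚ h) f)
            (≈ₚ-trans {f *ₚ (g +ₚ h)} {(f *ₚ g) +ₚ (f *ₚ h)} {(g *ₚ f) +ₚ (h *ₚ f)} (*ₚ-distribˡ f g h)
              (+ₚ-cong {f *ₚ g} {g *ₚ f} {f *ₚ h} {h *ₚ f} (*ₚ-comm f g) (*ₚ-comm f h))) }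
      ; *-comm = *ₚ-comm } }

  private module P = CommutativeRing puiseuxRing

  series : (d : ℕ) {{_ : NonZero d}} → Series → Puiseux
  series d a = record { den = d ; pole = 0 ; coeff = a }

  module _ (d : ℕ) {{d≢0 : NonZero d}} where

    series-cong : ∀ {a b} → a ≈ b → series d a ≈ₚ series d b
    series-cong a≈b = ≈ₚ-intro′ (series d _) (series d _) ≡.refl ≡.refl a≈b

    series-injective : ∀ {a b} → series d a ≈ₚ series d b → a ≈ b
    series-injective = inflate-injective d

    series-+ : ∀ a b → series d (a + b) ≈ₚ series d a +ₚ series d b
    series-+ a b = ≈ₚ-intro (series d (a + b)) (series d a +ₚ series d b) d 1 0 0
      (≡.sym (ℕ.*-identityʳ (d ℕ.* d))) ≡.refl
      (trans (inflate-+ d a b) (sym (M-1 (inflate d a + inflate d b))))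

    series-* : ∀ a b → series d (a * b) ≈ₚ series d a *ₚ series d b
    series-* a b = ≈ₚ-intro (series d (a * b)) (series d a *ₚ series d b) d 1 0 0
      (≡.sym (ℕ.*-identityʳ (d ℕ.* d))) ≡.refl
      (trans (inflate-* d a b) (sym (M-1 (inflate d a * inflate d b))))

  series-inflate : ∀ d k a → {{_ : NonZero d}} .{{_ : NonZero k}} → {{_ : NonZero (d ℕ.* k)}} →
                    series d a ≈ₚ series (d ℕ.* k) (inflate k a)
  series-inflate d k a = ≈ₚ-intro (series d a) (series (d ℕ.* k) (inflate k a)) k 1 0 0
    (≡.sym (ℕ.*-identityʳ (d ℕ.* k))) ≡.refl (sym (M-1 (inflate k a)))

  -- The vanishing coefficients include the one at index `pole f`, that of z⁰. So after cutting off
  -- the first `pole f` coefficients, the constant coefficient is still 0.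
  positiveOrder⇒series : ∀ f → HasPositiveOrder f → ∃[ a ] a 0 K.≈ K.0# × f ≈ₚ series (Puiseux.den f) a
  positiveOrder⇒series f@(record {den = d; pole = p; coeff = a}) ord =
    (λ n → a (p ℕ.+ n)) ,
    (K.trans (K.reflexive (≡.cong a (ℕ.+-identityʳ p))) (ord p ℕ.≤-refl)) ,
    ≈ₚ-intro f (series d (λ n → a (p ℕ.+ n))) 1 1 0 p ≡.refl
      (≡.trans (ℕ.+-identityʳ _) (ℕ.*-identityʳ p)) (begin
      M 0 1 a                            ≈⟨ M-1 a ⟩
      a                                  ≈⟨ shift-unique p (λ n n<p → ord n (ℕ.<⇒≤ n<p)) (λ n → K.refl) ⟩
      shift p (λ n → a (p ℕ.+ n))        ≈⟨ shift-cong p (inflate-1 (λ n → a (p ℕ.+ n))) ⟨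
      M p 1 (λ n → a (p ℕ.+ n))          ∎)

  coefficients-≈ : ∀ f g → let open Puiseux in
    den f ≡ den g → pole f ≡ pole g → coeff f ≈ coeff g → f ≈ₚ g
  coefficients-≈ = ≈ₚ-intro′

  series-den : ∀ {d e} {{_ : NonZero d}} {{_ : NonZero e}} a → d ≡ e → series d a ≈ₚ series e a
  series-den {d} {e} a d≡e = ≈ₚ-intro′ (series d a) (series e a) d≡e ≡.refl (refl {a})

  series-const : ∀ d {{_ : NonZero d}} x → series d (const-series x) ≈ₚ constant x
  series-const d x = P.sym {constant x} {series d (const-series x)}
    (≈ₚ-intro (constant x) (series d (const-series x)) d 1 0 0
      (≡.trans (ℕ.*-identityˡ d) (≡.sym (ℕ.*-identityʳ d))) ≡.refl
      (trans {M 0 d (const-series x)} {const-series x} {M 0 1 (const-series x)}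
        (inflate-const d x) (sym {M 0 1 (const-series x)} (M-1 (const-series x)))))

  series-z : ∀ d {{_ : NonZero d}} → series d (shift d 1#) ≈ₚ z
  series-z d = P.sym {z} {series d (shift d 1#)} (≈ₚ-intro z (series d (shift d 1#)) d 1 0 0
    (≡.trans (ℕ.*-identityˡ d) (≡.sym (ℕ.*-identityʳ d))) ≡.refl (begin
    inflate d (Puiseux.coeff z)
      ≈⟨ inflate-cong d {Puiseux.coeff z} {shift 1 1#} (λ { zero → K.refl ; (suc zero) → K.refl ; (suc (suc n))
          → K.refl }) ⟩
    inflate d (shift 1 1#)
      ≈⟨ inflate-shift d 1 1# ⟩
    shift (1 ℕ.* d) (inflate d 1#)
      ≈⟨ shift-cong (1 ℕ.* d) (inflate-const d K.1#) ⟩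
    shift (1 ℕ.* d) 1#
      ≡⟨ ≡.cong (λ s → shift s 1#) (ℕ.*-identityˡ d) ⟩
    shift d 1#
      ≈⟨ inflate-1 (shift d 1#) ⟨
    inflate 1 (shift d 1#) ∎))

  series-shift-inverse : ∀ d {{_ : NonZero d}} s a a⁻¹ → a * a⁻¹ ≈ 1# →
    series d (shift s a) *ₚ record { den = d ; pole = s ; coeff = a⁻¹ } ≈ₚ constant K.1#
  series-shift-inverse d s a a⁻¹ aa⁻¹≈1 = ≈ₚ-intro (f *ₚ g) (constant K.1#) 1 (d ℕ.* d) 0 (s ℕ.* d) {{_}}
      {{nz* d d}}
    (ℕSolver.solve (d ∷ [])) ((s ℕ.* d) ℕ.* 1 ℕ.+ 0 ≡ 0 ℕ.* (d ℕ.* d) ℕ.+ s ℕ.* d ∋ ℕSolver.solve (s ∷ d ∷ []))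
        (begin
    inflate 1 (inflate d (shift s a) * inflate d a⁻¹)
      ≈⟨ inflate-1 (inflate d (shift s a) * inflate d a⁻¹) ⟩
    inflate d (shift s a) * inflate d a⁻¹
      ≈⟨ inflate-* d (shift s a) a⁻¹ ⟨
    inflate d (shift s a * a⁻¹)
      ≈⟨ inflate-cong d (shift-*ˡ s a a⁻¹) ⟩
    inflate d (shift s (a * a⁻¹))
      ≈⟨ inflate-cong d (shift-cong s aa⁻¹≈1) ⟩
    inflate d (shift s 1#)
      ≈⟨ inflate-shift d s 1# ⟩
    shift (s ℕ.* d) (inflate d 1#)
      ≈⟨ shift-cong (s ℕ.* d) (inflate-const d K.1#) ⟩
    shift (s ℕ.* d) 1#
      ≈⟨ shift-cong (s ℕ.* d) (inflate-const (d ℕ.* d) {{nz* d d}} K.1#) ⟨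
    M (s ℕ.* d) (d ℕ.* d) 1# ∎)
    where
    f g : Puiseux
    f = series d (shift s a)
    g = record { den = d ; pole = s ; coeff = a⁻¹ }

-- A record rather than an iterated Σ-type: over the ring of Puiseux series,
-- comparing the unfolded Σ-types costs time exponential in their depth.
record ClosedForms {a ℓ} (Q : RawRing a ℓ) {c} (X : Vector (RawRing.Carrier Q) c)
  (κ t : RawRing.Carrier Q) (j : ℕ) : Set (a ⊔ ℓ) where
  open RingNotation Q
  field
    κ-invertible : Invertible κ
    V-invertible : Invertible (vandermonde X)
  κ⁻¹ = proj₁ κ-invertible
  V⁻¹ = proj₁ V-invertible
  field
    vandermonde-form : t ≈ κ⁻¹ * (1# - sum (λ ℓ → vandermonde (X [ ℓ ]≔1) * V⁻¹ * X ℓ ^ (c ℕ.+ j)))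
    homogeneous-form : t ≈ κ⁻¹ * sum {suc j} (λ f → h (toℕ f) X) * product (λ ℓ → 1# - X ℓ)

-- Units, differences of powers and integer powers in a commutative ring.

module Units {a ℓ} (R : CommutativeRing a ℓ) where
  open RingKit R
  open Vandermonde R

  invertible : ∀ {x y} → x * y ≈ 1# → Invertible x
  invertible {x} {y} xy≈1 = y , trans (*-comm y x) xy≈1 , xy≈1

  invertible-cong : ∀ {x y} → x ≈ y → Invertible x → Invertible y
  invertible-cong x≈y (x⁻¹ , _ , xx⁻¹≈1) = invertible (trans (*-congʳ (sym x≈y)) xx⁻¹≈1)

  invertible-1 : Invertible 1#
  invertible-1 = invertible (*-identityˡ 1#)

  invertible-* : ∀ {x y} → Invertible x → Invertible y → Invertible (x * y)
  invertible-* {x} {y} (x⁻¹ , _ , xx⁻¹≈1) (y⁻¹ , _ , yy⁻¹≈1) = invertible (begin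
    (x * y) * (x⁻¹ * y⁻¹)  ≈⟨ solve 4 (λ x y u v → (x :* y) :* (u :* v) := (x :* u) :* (y :* v)) refl x y _ _ ⟩
    (x * x⁻¹) * (y * y⁻¹)  ≈⟨ *-cong xx⁻¹≈1 yy⁻¹≈1 ⟩
    1# * 1#                ≈⟨ *-identityˡ 1# ⟩
    1#                     ∎)

  invertible-factorˡ : ∀ {x y} → Invertible (x * y) → Invertible x
  invertible-factorˡ {x} {y} (u , _ , xyu≈1) = invertible (trans (sym (*-assoc x y u)) xyu≈1)

  invertible-^ : ∀ {x} n → Invertible x → Invertible (x ^ n)
  invertible-^ zero    _   = invertible-1
  invertible-^ (suc n) inv = invertible-* inv (invertible-^ n inv)

  invertible-neg : ∀ {x} → Invertible x → Invertible (- x)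
  invertible-neg {x} (x⁻¹ , _ , xx⁻¹≈1) = invertible
    (trans (solve 2 (λ x y → (:- x) :* (:- y) := x :* y) refl x x⁻¹) xx⁻¹≈1)

  invertible-swap : ∀ {x y} → Invertible (x - y) → Invertible (y - x)
  invertible-swap {x} {y} inv = invertible-cong
    (solve 2 (λ x y → :- (x :- y) := y :- x) refl x y) (invertible-neg inv)

  invertible⇒regular : ∀ {x} → Invertible x → Regular x
  invertible⇒regular {x} (x⁻¹ , x⁻¹x≈1 , _) y xy≈0 = begin
    y              ≈⟨ *-identityˡ y ⟨
    1# * y         ≈⟨ *-congʳ x⁻¹x≈1 ⟨
    (x⁻¹ * x) * y  ≈⟨ *-assoc _ _ _ ⟩
    x⁻¹ * (x * y)  ≈⟨ *-congˡ xy≈0 ⟩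
    x⁻¹ * 0#       ≈⟨ zeroʳ _ ⟩
    0#             ∎

  product-invertible : ∀ {n} {f : Vector Carrier n} → (∀ i → Invertible (f i)) → Invertible (product f)
  product-invertible {zero}  inv = invertible-1
  product-invertible {suc n} inv = invertible-* (inv zero) (product-invertible (inv ∘ suc))

  vandermonde-invertible : ∀ {n} (X : Vector Carrier n) →
    (∀ {i k} → i ≢ k → Invertible (X i - X k)) → Invertible (vandermonde X)
  vandermonde-invertible X inv = product-invertible λ i → product-invertible λ k → entry i k
    where
    guarded : ∀ {p} {P : Set p} {x} (P? : Dec P) → (P → Invertible x) → Invertible (if does P? then x else 1#)
    guarded (yes p) inv = inv p
    guarded (no _)  inv = invertible-1
    entry : ∀ i k → Invertible (if does (i Fin.<? k) then X i - X k else 1#)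
    entry i k = guarded (i Fin.<? k) (λ i<k → inv (Fin.<⇒≢ i<k))

  regularDifferences : ∀ {n} (X : Vector Carrier n) →
    (∀ {i k} → i ≢ k → Invertible (X i - X k)) → RegularDifferences X
  regularDifferences {zero}  X inv = tt
  regularDifferences {suc n} X inv =
    (λ k → invertible⇒regular (inv λ ())) ,
    regularDifferences (tail X) (λ i≢k → inv (i≢k ∘ Fin.suc-injective))

  power-difference : ∀ n x y → ∃[ q ] x ^ n - y ^ n ≈ (x - y) * q
  power-difference zero    x y = 0# , trans (-‿inverseʳ 1#) (sym (zeroʳ _))
  power-difference (suc n) x y with power-difference n x y
  ... | q , eq = x * q + y ^ n , (begin
    x * x ^ n - y * y ^ n
      ≈⟨ solve 4 (λ x y p r → x :* p :- y :* r := x :* (p :- r) :+ (x :- y) :* r) refl x y _ _ ⟩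
    x * (x ^ n - y ^ n) + (x - y) * y ^ n
      ≈⟨ +-congʳ (*-congˡ eq) ⟩
    x * ((x - y) * q) + (x - y) * y ^ n
      ≈⟨ solve 4 (λ x y q r → x :* ((x :- y) :* q) :+ (x :- y) :* r := (x :- y) :* (x :* q :+ r)) refl x y q _ ⟩
    (x - y) * (x * q + y ^ n) ∎)

  -- Second-order expansion at x, isolating the derivative, which will be a unit. In the inductive
  -- step the stray power of y is rewritten as the same power of x minus a multiple of `x − y`.
  power-taylor : ∀ n x y → ∃[ q ] x ^ suc n - y ^ suc n ≈ (x - y) * ((suc n · 1#) * x ^ n - (x - y) * q)
  power-taylor zero x y = 0# ,
    solve 2 (λ x y → x :* con (+ 1) :- y :* con (+ 1)
      := (x :- y) :* ((con (+ 1) :+ con (+ 0)) :* con (+ 1) :- (x :- y) :* con (+ 0))) refl x y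
  power-taylor (suc n) x y with power-taylor n x y | power-difference (suc n) x y
  ... | q , eq | r , eq′ = x * q + r , (begin
    x * x ^ suc n - y * y ^ suc n
      ≈⟨ solve 4 (λ x y p s → x :* p :- y :* s := x :* (p :- s) :+ (x :- y) :* (p :- (p :- s))) refl x y _ _ ⟩
    x * (x ^ suc n - y ^ suc n) + (x - y) * (x ^ suc n - (x ^ suc n - y ^ suc n))
      ≈⟨ +-cong (*-congˡ eq) (*-congˡ (+-congˡ (-‿cong eq′))) ⟩
    x * ((x - y) * (N * x ^ n - (x - y) * q)) + (x - y) * (x * x ^ n - (x - y) * r)
      ≈⟨ solve 6 (λ x d N p q r → x :* (d :* (N :* p :- d :* q)) :+ d :* (x :* p :- d :* r)
           := d :* ((con (+ 1) :+ N) :* (x :* p) :- d :* (x :* q :+ r))) refl x (x - y) N (x ^ n) q r ⟩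
    (x - y) * ((1# + N) * x ^ suc n - (x - y) * (x * q + r)) ∎)
    where N = suc n · 1#

  weighted-sum-difference : ∀ {m} (w f g q : Vector Carrier m) d → (∀ ℓ → f ℓ - g ℓ ≈ d * q ℓ) →
    sum (λ ℓ → w ℓ * f ℓ) - sum (λ ℓ → w ℓ * g ℓ) ≈ d * sum (λ ℓ → w ℓ * q ℓ)
  weighted-sum-difference w f g q d f-g≈dq = begin
    sum (λ ℓ → w ℓ * f ℓ) - sum (λ ℓ → w ℓ * g ℓ)
      ≈⟨ +-congˡ (sum-neg (λ ℓ → w ℓ * g ℓ)) ⟩
    sum (λ ℓ → w ℓ * f ℓ) + sum (λ ℓ → - (w ℓ * g ℓ))
      ≈⟨ ∑-distrib-+ (λ ℓ → w ℓ * f ℓ) (λ ℓ → - (w ℓ * g ℓ)) ⟨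
    sum (λ ℓ → w ℓ * f ℓ - w ℓ * g ℓ)
      ≈⟨ sum-cong-≋ (λ ℓ → term (w ℓ) (f-g≈dq ℓ)) ⟩
    sum (λ ℓ → d * (w ℓ * q ℓ))
      ≈⟨ *-distribˡ-sum d (λ ℓ → w ℓ * q ℓ) ⟨
    d * sum (λ ℓ → w ℓ * q ℓ) ∎
    where
    term : ∀ w {f g q} → f - g ≈ d * q → w * f - w * g ≈ d * (w * q)
    term w {f} {g} {q} eq = begin
      w * f - w * g  ≈⟨ solve 3 (λ w f g → w :* f :- w :* g := w :* (f :- g)) refl w f g ⟩
      w * (f - g)    ≈⟨ *-congˡ eq ⟩
      w * (d * q)    ≈⟨ solve 3 (λ w d q → w :* (d :* q) := d :* (w :* q)) refl w d q ⟩
      d * (w * q)    ∎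

  cancel-difference : ∀ {p p′ s s′ δ e f} → p ≈ s → p′ ≈ s′ →
    p - p′ ≈ δ * e → s - s′ ≈ δ * f → δ * (e - f) ≈ 0#
  cancel-difference {p} {p′} {s} {s′} {δ} {e} {f} p≈s p′≈s′ p-p′ s-s′ = begin
    δ * (e - f)          ≈⟨ solve 3 (λ d e f → d :* (e :- f) := d :* e :- d :* f) refl δ e f ⟩
    δ * e - δ * f        ≈⟨ +-cong p-p′ (-‿cong s-s′) ⟨
    (p - p′) - (s - s′)  ≈⟨ x≈y⇒x-y≈0 (+-cong p≈s (-‿cong p′≈s′)) ⟩
    0#                   ∎

  *-zpow : ∀ {x x⁻¹} → x * x⁻¹ ≈ 1# → ∀ c b e → + e ≡ b ℤ.+ + c → x ^ c * zpow x x⁻¹ b ≈ x ^ e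
  *-zpow {x} {x⁻¹} xx⁻¹≈1 c (+ n) e eq = begin
    x ^ c * x ^ n    ≈⟨ *-comm _ _ ⟩
    x ^ n * x ^ c    ≈⟨ ^-homo-* x n c ⟨
    x ^ (n ℕ.+ c)    ≡⟨ ≡.cong (x ^_) (ℤ.+-injective eq) ⟨
    x ^ e            ∎
  *-zpow {x} {x⁻¹} xx⁻¹≈1 c -[1+ n ] e eq = begin
    x ^ c * x⁻¹ ^ suc n                  ≡⟨ ≡.cong (λ k → x ^ k * x⁻¹ ^ suc n) c≡ ⟩
    x ^ (e ℕ.+ suc n) * x⁻¹ ^ suc n      ≈⟨ *-congʳ (^-homo-* x e (suc n)) ⟩
    (x ^ e * x ^ suc n) * x⁻¹ ^ suc n    ≈⟨ *-assoc _ _ _ ⟩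
    x ^ e * (x ^ suc n * x⁻¹ ^ suc n)    ≈⟨ *-congˡ (cancel (suc n)) ⟩
    x ^ e * 1#                           ≈⟨ *-identityʳ _ ⟩
    x ^ e                                ∎
    where
    cancel : ∀ k → x ^ k * x⁻¹ ^ k ≈ 1#
    cancel zero    = *-identityˡ 1#
    cancel (suc k) = begin
      (x * x ^ k) * (x⁻¹ * x⁻¹ ^ k)
        ≈⟨ solve 4 (λ x p y q → (x :* p) :* (y :* q) := (x :* y) :* (p :* q)) refl _ _ _ _ ⟩
      (x * x⁻¹) * (x ^ k * x⁻¹ ^ k)  ≈⟨ *-cong xx⁻¹≈1 (cancel k) ⟩
      1# * 1#                        ≈⟨ *-identityˡ 1# ⟩
      1#                             ∎
    c≡ : c ≡ e ℕ.+ suc n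
    c≡ = ℤ.+-injective (≡.trans (≡.sym (ℤ.+-identityʳ (+ c)))
      (≡.trans (≡.cong (λ i → (+ c) ℤ.+ i) (≡.sym (ℤ.+-inverseˡ (+ suc n))))
      (≡.trans (≡.sym (ℤ.+-assoc (+ c) -[1+ n ] (+ suc n)))
        (≡.cong (λ i → i ℤ.+ + suc n) (≡.trans (ℤ.+-comm (+ c) -[1+ n ]) (≡.sym eq))))))

  zpow-1 : ∀ b → zpow 1# 1# b ≈ 1#
  zpow-1 (+ n)    = 1^n≈1 n
  zpow-1 -[1+ n ] = 1^n≈1 (suc n)

  solve-linear : ∀ {κ κ⁻¹ t y} → κ⁻¹ * κ ≈ 1# → κ * t - y ≈ 0# → t ≈ κ⁻¹ * y
  solve-linear {κ} {κ⁻¹} {t} {y} κ⁻¹κ≈1 κt-y≈0 = begin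
    t              ≈⟨ *-identityˡ t ⟨
    1# * t         ≈⟨ *-congʳ κ⁻¹κ≈1 ⟨
    (κ⁻¹ * κ) * t  ≈⟨ *-assoc κ⁻¹ κ t ⟩
    κ⁻¹ * (κ * t)  ≈⟨ *-congˡ (x-y≈0⇒x≈y κt-y≈0) ⟩
    κ⁻¹ * y        ∎

-- The interpolation error at 1 and its recurrence.

module KernelMethod {a ℓ} (R : CommutativeRing a ℓ) where
  open RingKit R
  open Vandermonde R
  open CompleteHomogeneous R
  open Units R

  -- Multiplying 1 = zP(x) by x^c clears the negative exponents, leaving the natural exponents b +
  -- c.
  polynomialize : ∀ {m} {z x x⁻¹ : Carrier} (w : Vector Carrier m) (b : Fin m → ℤ) (e : Fin m → ℕ) c →
    (∀ ℓ → + e ℓ ≡ b ℓ ℤ.+ + c) → x * x⁻¹ ≈ 1# →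
    1# - z * sum (λ ℓ → w ℓ * zpow x x⁻¹ (b ℓ)) ≈ 0# →
    x ^ c ≈ z * sum (λ ℓ → w ℓ * x ^ e ℓ)
  polynomialize {z = z} {x} {x⁻¹} w b e c e≡b+c xx⁻¹≈1 kernel = begin
    x ^ c
      ≈⟨ *-identityʳ _ ⟨
    x ^ c * 1#
      ≈⟨ *-congˡ (x-y≈0⇒x≈y kernel) ⟩
    x ^ c * (z * sum (λ ℓ → w ℓ * zpow x x⁻¹ (b ℓ)))
      ≈⟨ solve 3 (λ p z s → p :* (z :* s) := z :* (p :* s)) refl _ _ _ ⟩
    z * (x ^ c * sum (λ ℓ → w ℓ * zpow x x⁻¹ (b ℓ)))
      ≈⟨ *-congˡ (*-distribˡ-sum (x ^ c) (λ ℓ → w ℓ * zpow x x⁻¹ (b ℓ))) ⟩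
    z * sum (λ ℓ → x ^ c * (w ℓ * zpow x x⁻¹ (b ℓ)))
      ≈⟨ *-congˡ (sum-cong-≋ λ ℓ → trans
           (solve 3 (λ p w q → p :* (w :* q) := w :* (p :* q)) refl (x ^ c) (w ℓ) (zpow x x⁻¹ (b ℓ)))
           (*-congˡ (*-zpow xx⁻¹≈1 c (b ℓ) (e ℓ) (e≡b+c ℓ)))) ⟩
    z * sum (λ ℓ → w ℓ * x ^ e ℓ) ∎

  -- The value at x = 1 of x^N minus its interpolation polynomial at the nodes X, in Newton's form.
  -- Being free of division, it makes sense in any commutative ring and commutes with homomorphisms.
  interpolant : ∀ {n} → Vector Carrier n → ℕ → Carrier
  interpolant X N = differences 1# X * H (1# ◂ X) N

  interpolant-below : ∀ {n} (X : Vector Carrier n) {N} → N ℕ.< n → interpolant X N ≈ 0#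
  interpolant-below X N<n = trans (*-congˡ (H-below (1# ◂ X) N<n)) (zeroʳ _)

  module _ {c : ℕ} (X : Vector Carrier (suc c)) (reg : RegularDifferences (1# ◂ X))
           {V⁻¹ : Carrier} (VV⁻¹≈1 : vandermonde X * V⁻¹ ≈ 1#) where

    interpolant-vandermonde : ∀ N →
      interpolant X N ≈ 1# - sum (λ i → vandermonde (X [ i ]≔1) * V⁻¹ * X i ^ N)
    interpolant-vandermonde N = begin
      interpolant X N
        ≈⟨ trans (*-congʳ VV⁻¹≈1) (*-identityˡ _) ⟨
      (V * V⁻¹) * interpolant X N
        ≈⟨ solve 3 (λ v u p → (v :* u) :* p := u :* (v :* p)) refl V V⁻¹ _ ⟩
      V⁻¹ * (V * interpolant X N)
        ≈⟨ *-congˡ (interpolation 1# X reg N) ⟨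
      V⁻¹ * (V * 1# ^ N - sum (λ i → U i * X i ^ N))
        ≈⟨ solve 4 (λ u v p s → u :* (v :* p :- s) := (v :* u) :* p :- u :* s) refl V⁻¹ V (1# ^ N) _ ⟩
      (V * V⁻¹) * 1# ^ N - V⁻¹ * sum (λ i → U i * X i ^ N)
        ≈⟨ +-cong (trans (*-cong VV⁻¹≈1 (1^n≈1 N)) (*-identityˡ 1#))
             (-‿cong (trans (*-distribˡ-sum V⁻¹ (λ i → U i * X i ^ N))
               (sum-cong-≋ λ i → solve 3 (λ u v p → u :* (v :* p) := (v :* u) :* p) refl V⁻¹ (U i) (X i ^ N)))) ⟩
      1# - sum (λ i → U i * V⁻¹ * X i ^ N) ∎
      where
      V = vandermonde X
      U : Vector Carrier (suc c)
      U i = vandermonde (X [ i ]≔1)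

    interpolant-h : ∀ j → interpolant X (suc c ℕ.+ j) ≈
                          sum {suc j} (λ f → h (toℕ f) X) * product (λ ℓ → 1# - X ℓ)
    interpolant-h j = trans (*-comm _ _) (*-congʳ (trans (H≈h (1# ◂ X) j) (h-1∷ X j)))

    -- In the Lagrange form the coefficients λ do not depend on N, so the kernel equation can be
    -- applied to each power `X i ^ suc c` separately. The leading 1 is written as (1 - zΣw) + zΣw,
    -- and each `w ℓ` then completes its inner sum to an `interpolant`.
    interpolant-recurrence : ∀ {m} z (w : Vector Carrier m) (e : Fin m → ℕ) →
      (∀ i → X i ^ suc c ≈ z * sum (λ ℓ → w ℓ * X i ^ e ℓ)) → ∀ j →
      interpolant X (suc c ℕ.+ j) ≈ (1# - z * sum w) + z * sum (λ ℓ → w ℓ * interpolant X (j ℕ.+ e ℓ))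
    interpolant-recurrence {m} z w e kernel j = begin
      interpolant X (suc c ℕ.+ j)
        ≈⟨ interpolant-vandermonde (suc c ℕ.+ j) ⟩
      1# - sum (λ i → λᵢ i * X i ^ (suc c ℕ.+ j))
        ≈⟨ +-congˡ (-‿cong (sum-cong-≋ λ i → trans (*-congˡ (power i)) (term i))) ⟩
      1# - sum (λ i → z * S i)
        ≈⟨ +-congˡ (-‿cong (*-distribˡ-sum z S)) ⟨
      1# - z * sum S
        ≈⟨ +-congˡ (-‿cong (*-congˡ (∑-comm (λ i ℓ → w ℓ * (λᵢ i * X i ^ (j ℕ.+ e ℓ)))))) ⟩
      1# - z * sum (λ ℓ → sum (λ i → w ℓ * (λᵢ i * X i ^ (j ℕ.+ e ℓ))))
        ≈⟨ +-congˡ (-‿cong (*-congˡ (sum-cong-≋ λ ℓ → *-distribˡ-sum (w ℓ) (λ i → λᵢ i * X i ^ (j ℕ.+ e ℓ))))) ⟨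
      1# - z * sum (λ ℓ → w ℓ * L ℓ)
        ≈⟨ solve 3 (λ z a b → con (+ 1) :- z :* b := (con (+ 1) :- z :* a) :+ z :* (a :- b)) refl z (sum w) _ ⟩
      (1# - z * sum w) + z * (sum w - sum (λ ℓ → w ℓ * L ℓ))
        ≈⟨ +-congˡ (*-congˡ (trans (+-congˡ (sum-neg (λ ℓ → w ℓ * L ℓ))) (sym (∑-distrib-+ w (λ ℓ → -
            (w ℓ * L ℓ)))))) ⟩
      (1# - z * sum w) + z * sum (λ ℓ → w ℓ - w ℓ * L ℓ)
        ≈⟨ +-congˡ (*-congˡ (sum-cong-≋ λ ℓ → trans
             (solve 2 (λ w l → w :- w :* l := w :* (con (+ 1) :- l)) refl (w ℓ) (L ℓ))
             (*-congˡ (sym (interpolant-vandermonde (j ℕ.+ e ℓ)))))) ⟩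
      (1# - z * sum w) + z * sum (λ ℓ → w ℓ * interpolant X (j ℕ.+ e ℓ)) ∎
      where
      λᵢ : Vector Carrier (suc c)
      λᵢ i = vandermonde (X [ i ]≔1) * V⁻¹
      S : Vector Carrier (suc c)
      S i = sum (λ ℓ → w ℓ * (λᵢ i * X i ^ (j ℕ.+ e ℓ)))
      L : Vector Carrier m
      L ℓ = sum (λ i → λᵢ i * X i ^ (j ℕ.+ e ℓ))
      power : ∀ i → X i ^ (suc c ℕ.+ j) ≈ (z * sum (λ ℓ → w ℓ * X i ^ e ℓ)) * X i ^ j
      power i = trans (^-homo-* (X i) (suc c) j) (*-congʳ (kernel i))
      term : ∀ i → λᵢ i * ((z * sum (λ ℓ → w ℓ * X i ^ e ℓ)) * X i ^ j) ≈ z * S i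
      term i = begin
        λᵢ i * ((z * sum (λ ℓ → w ℓ * X i ^ e ℓ)) * X i ^ j)
          ≈⟨ solve 4 (λ l z s p → l :* ((z :* s) :* p) := z :* ((l :* p) :* s)) refl (λᵢ i) z _ _ ⟩
        z * ((λᵢ i * X i ^ j) * sum (λ ℓ → w ℓ * X i ^ e ℓ))
          ≈⟨ *-congˡ (*-distribˡ-sum (λᵢ i * X i ^ j) (λ ℓ → w ℓ * X i ^ e ℓ)) ⟩
        z * sum (λ ℓ → (λᵢ i * X i ^ j) * (w ℓ * X i ^ e ℓ))
          ≈⟨ *-congˡ (sum-cong-≋ λ ℓ → trans
               (solve 4 (λ l p w q → (l :* p) :* (w :* q) := w :* (l :* (p :* q))) refl (λᵢ i) (X i ^ j) (w ℓ)
                   (X i ^ e ℓ))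
               (*-congˡ (*-congˡ (sym (^-homo-* (X i) j (e ℓ)))))) ⟩
        z * S i ∎

  closed-forms : ∀ {c κ t} (X : Vector Carrier (suc c)) → RegularDifferences (1# ◂ X) → ∀ j →
    Invertible κ → Invertible (vandermonde X) → κ * t - interpolant X (suc c ℕ.+ j) ≈ 0# →
    ClosedForms rawRing X κ t j
  closed-forms {c} {κ} {t} X reg j κ-invertible V-invertible κt≈ = record
    { κ-invertible     = κ-invertible
    ; V-invertible     = V-invertible
    ; vandermonde-form = trans t≈ (*-congˡ (interpolant-vandermonde X reg VV⁻¹≈1 (suc c ℕ.+ j)))
    ; homogeneous-form = trans t≈ (trans (*-congˡ (interpolant-h X reg VV⁻¹≈1 j)) (sym (*-assoc _ _ _)))
    }
    where
    VV⁻¹≈1 = proj₂ (proj₂ V-invertible)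
    t≈ : t ≈ proj₁ κ-invertible * interpolant X (suc c ℕ.+ j)
    t≈ = solve-linear (proj₁ (proj₂ κ-invertible)) κt≈

-- Units and constant coefficients of power series.

module SeriesUnits {a ℓ} (K : CommutativeRing a ℓ) where
  private
    module K = RingKit K
    module KU = Units K
  open PowerSeries K
  open RingKit seriesRing
  open Units seriesRing
  private
    -- Long division by the series u with constant coefficient q⁻¹.
    remainder quotient : Series → K.Carrier → Series → Series
    remainder u q a k = a (suc k) K.- (a 0 K.* q) K.* u (suc k)
    quotient u q a zero    = a 0 K.* q
    quotient u q a (suc n) = quotient u q (remainder u q a) n

    quotient-* : ∀ {u q} → u 0 K.* q K.≈ K.1# → ∀ a → quotient u q a * u ≈ a
    quotient-* {u} {q} uq≈1 a zero = K.trans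
      (K.solve 3 (λ a q u → (a K.:* q) K.:* u K.:+ K.con (+ 0) K.:= a K.:* (u K.:* q)) K.refl (a 0) q (u 0))
      (K.trans (K.*-congˡ uq≈1) (K.*-identityʳ _))
    quotient-* {u} {q} uq≈1 a (suc n) = K.trans (K.+-congˡ (quotient-* uq≈1 (remainder u q a) n))
      (K.solve 2 (λ x y → x K.:+ (y K.:- x) K.:= y) K.refl ((a 0 K.* q) K.* u (suc n)) (a (suc n)))

  series-invertible : ∀ {u} → K.Invertible (u 0) → Invertible u
  series-invertible {u} (q , _ , uq≈1) = invertible {u} {quotient u q 1#}
    (trans {u * quotient u q 1#} {quotient u q 1# * u} {1#} (*-comm u (quotient u q 1#)) (quotient-* uq≈1 1#))

  constant-coefficient-^ : ∀ a n → (a ^ n) 0 K.≈ a 0 K.^ n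
  constant-coefficient-^ a zero    = K.refl
  constant-coefficient-^ a (suc n) = K.trans (K.+-identityʳ _) (K.*-congˡ (constant-coefficient-^ a n))

  constant-coefficient-· : ∀ n → (n · 1#) 0 K.≈ n K.· K.1#
  constant-coefficient-· zero    = K.refl
  constant-coefficient-· (suc n) = K.+-congˡ (constant-coefficient-· n)

  coefficient-sum : ∀ {m} (f : Vector Series m) n → sum f n K.≈ K.sum (λ i → f i n)
  coefficient-sum {zero}  f n = K.refl
  coefficient-sum {suc m} f n = K.+-congˡ (coefficient-sum (tail f) n)

  shift-^ : ∀ s a n → shift s a ^ n ≈ shift (n ℕ.* s) (a ^ n)
  shift-^ s a zero    = refl {1#}
  shift-^ s a (suc n) = trans {shift s a * shift s a ^ n} {shift s a * shift (n ℕ.* s) (a ^ n)}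
    (*-congˡ {shift s a} {shift s a ^ n} {shift (n ℕ.* s) (a ^ n)} (shift-^ s a n))
    (shift-*-shift s (n ℕ.* s) a (a ^ n))

  shift-*-swap : ∀ s a b → shift s a * b ≈ a * shift s b
  shift-*-swap s a b = trans {shift s a * b} {shift s (a * b)} {a * shift s b}
    (shift-*ˡ s a b) (sym {a * shift s b} {shift s (a * b)} (shift-*-shift 0 s a b))

  shift-suc-tail : ∀ s {a u} → a ≈ shift s u → u 0 K.≈ K.0# → a ≈ shift (suc s) (u ∘ suc)
  shift-suc-tail s {a} {u} a≈ u₀≈0 = trans {a} {shift s u} a≈
    (trans {shift s u} {shift s (shift 1 (u ∘ suc))}
      (shift-cong s {u} {shift 1 (u ∘ suc)} λ { zero → u₀≈0 ; (suc n) → K.refl })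
      (trans {_} {shift (s ℕ.+ 1) (u ∘ suc)} (shift-shift s 1 (u ∘ suc))
        (λ n → K.reflexive (≡.cong (λ t → shift t (u ∘ suc) n) (ℕ.+-comm s 1)))))

-- A Heyting field of characteristic 0, in terms of invertibility alone.
record IsFieldOfCharacteristic0 {a ℓ} (K : CommutativeRing a ℓ) : Set (a ⊔ ℓ) where
  open RingKit K
  field
    1≉0              : ¬ (1# ≈ 0#)
    local            : ∀ {x y} → Invertible (x + y) → Invertible x ⊎ Invertible y
    tight            : ∀ {x} → ¬ Invertible x → x ≈ 0#
    characteristic-0 : ∀ n → Invertible (suc n · 1#)

-- Leading terms of small solutions and their separation.

module SmallSeries {a ℓ} (K : CommutativeRing a ℓ) (isField : IsFieldOfCharacteristic0 K) where
  open RingKit K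
  open IsFieldOfCharacteristic0 isField
  private
    module KU = Units K
    module S = RingKit (PowerSeries.seriesRing K)
    module SU = Units (PowerSeries.seriesRing K)
  open PowerSeries K
  open SeriesUnits K

  0-not-invertible : ∀ {x} → Invertible x → ¬ (x ≈ 0#)
  0-not-invertible (x⁻¹ , _ , xx⁻¹≈1) x≈0 = 1≉0 (trans (sym xx⁻¹≈1) (trans (*-congʳ x≈0) (zeroˡ _)))

  -- If x were a unit, so would be its power. Tightness turns this refutation into `x ≈ 0#` without
  -- deciding whether x is zero.
  reduced : ∀ {x} n → x ^ n ≈ 0# → x ≈ 0#
  reduced n x^n≈0 = tight λ inv → 0-not-invertible (KU.invertible-^ n inv) x^n≈0

  module _ {m : ℕ} (w : Vector Carrier m) (e : Fin m → ℕ) (e-injective : ∀ {i k} → e i ≡ e k → i ≡ k)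
           (ℓ₀ : Fin m) (eℓ₀≡0 : e ℓ₀ ≡ 0) (wℓ₀-invertible : Invertible (w ℓ₀)) (c D : ℕ) where

    step-series : Series → Series
    step-series x = S.sum (λ ℓ → const-series (w ℓ) S.* x S.^ e ℓ)

    -- The polynomial kernel equation in the variable t = z^{1/D}: multiplication by z is `shift D`.
    SmallSeries : Series → Set ℓ
    SmallSeries x = x 0 ≈ 0# × (x S.^ suc c S.≈ shift D (step-series x))

    -- Positive powers of x have constant coefficient 0, and by injectivity of e the exponent 0
    -- occurs for the lowest step only.
    step-series-0 : ∀ x → x 0 ≈ 0# → step-series x 0 ≈ w ℓ₀
    step-series-0 x x₀≈0 = trans (coefficient-sum (λ ℓ → const-series (w ℓ) S.* x S.^ e ℓ) 0)
      (only ℓ₀ (trans (term ℓ₀) (trans (*-congˡ (reflexive (≡.cong (x 0 ^_) eℓ₀≡0))) (*-identityʳ _)))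
        λ i i≢ℓ₀ → trans (term i) (trans (*-congˡ (zero-power i i≢ℓ₀)) (zeroʳ _)))
      where
      only : ∀ {m} {f : Vector Carrier m} {v} i → f i ≈ v → (∀ k → k ≢ i → f k ≈ 0#) → sum f ≈ v
      only {suc m} {f} {v} i fi≈v rest = begin
        sum f                     ≈⟨ sum-remove {i = i} f ⟩
        f i + sum (removeAt f i)  ≈⟨ +-cong fi≈v (sum-zero λ k → rest _ (Fin.punchInᵢ≢i i k)) ⟩
        v + 0#                    ≈⟨ +-identityʳ v ⟩
        v                         ∎
      term : ∀ i → (const-series (w i) S.* x S.^ e i) 0 ≈ w i * x 0 ^ e i
      term i = trans (+-identityʳ _) (*-congˡ (constant-coefficient-^ x (e i)))
      zero-power : ∀ i → i ≢ ℓ₀ → x 0 ^ e i ≈ 0#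
      zero-power i i≢ℓ₀ with e i in eq
      ... | zero  = contradiction (e-injective (≡.trans eq (≡.sym eℓ₀≡0))) i≢ℓ₀
      ... | suc k = trans (*-congʳ x₀≈0) (zeroˡ _)

    -- As t is z^{1/D}, the condition `suc c * N ≡ D` says that x has order 1/(c + 1) in z. The last
    -- component determines the power `suc c` of the leading coefficient.
    LeadingTerm : Series → Set (a ⊔ ℓ)
    LeadingTerm x = ∃[ N ] ∃[ u ] suc c ℕ.* N ≡ D × (x S.≈ shift N u) × Invertible (u 0) ×
                        (u S.^ suc c S.≈ step-series x)

    -- Write x = t^N u, starting from N = 0; then t^{(c+1)N} u^{c+1} = t^D r, where r(0) is a unit.
    -- For (c+1)N < D the lowest coefficient forces u(0)^{c+1} = 0, hence u(0) = 0, and N can be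
    -- raised. For (c+1)N > D the unit r(0) would vanish. At equality the powers of t cancel.
    leading : ∀ {x} → SmallSeries x → LeadingTerm x
    leading {x} (x₀≈0 , kernel) = go D 0 x (ℕ.≤-reflexive (≡.sym (ℕ.+-identityʳ D))) (S.refl {x})
      where
      r = step-series x
      r₀-invertible : Invertible (r 0)
      r₀-invertible = KU.invertible-cong (sym (step-series-0 x x₀≈0)) wℓ₀-invertible

      go : ∀ fuel N u → D ℕ.≤ fuel ℕ.+ N → x S.≈ shift N u → LeadingTerm x
      go fuel N u enough x≈ = compare (ℕ.<-cmp (suc c ℕ.* N) D) fuel enough
        where
        powers : shift (suc c ℕ.* N) (u S.^ suc c) S.≈ shift D r
        powers = S.trans {shift (suc c ℕ.* N) (u S.^ suc c)} {x S.^ suc c} {shift D r}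
          (S.sym {x S.^ suc c} {shift (suc c ℕ.* N) (u S.^ suc c)}
            (S.trans {x S.^ suc c} {shift N u S.^ suc c} (S.^-congˡ (suc c) {x} {shift N u} x≈) (shift-^ N u
                (suc c))))
          kernel
        compare : _ → ∀ fuel → D ℕ.≤ fuel ℕ.+ N → LeadingTerm x
        compare (tri≈ _ ≡.refl _) _ _ = N , u , ≡.refl , x≈ , u₀-invertible , same
          where
          same : u S.^ suc c S.≈ r
          same = shift-injective (suc c ℕ.* N) powers
          u₀-invertible : Invertible (u 0)
          u₀-invertible = KU.invertible-factorˡ
            (KU.invertible-cong (trans (sym (same 0)) (constant-coefficient-^ u (suc c))) r₀-invertible)
        compare (tri> _ _ cN>D) _ _ = contradiction r₀≈0 (0-not-invertible r₀-invertible)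
          where
          r₀≈0 : r 0 ≈ 0#
          r₀≈0 = trans (sym (trans (powers D) (trans (reflexive (≡.cong (shift D r) (≡.sym (ℕ.+-identityʳ D))))
                                                    (reflexive (shift-at D r 0)))))
                       (reflexive (shift-below (suc c ℕ.* N) (u S.^ suc c) cN>D))
        -- D rounds suffice: without fuel, D ≤ N ≤ (c+1)N, against (c+1)N < D.
        compare (tri< cN<D _ _) zero D≤N =
          contradiction (ℕ.<-≤-trans cN<D (ℕ.≤-trans D≤N (ℕ.m≤m+n N (c ℕ.* N)))) (ℕ.<-irrefl ≡.refl)
        compare (tri< cN<D _ _) (suc fuel) D≤ =
          go fuel (suc N) (u ∘ suc) (≡.subst (D ℕ.≤_) (≡.sym (ℕ.+-suc fuel N)) D≤)
            (shift-suc-tail N {x} {u} x≈ u₀≈0)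
          where
          u₀≈0 : u 0 ≈ 0#
          u₀≈0 = reduced (suc c) (trans (sym (constant-coefficient-^ u (suc c))) (begin
            (u S.^ suc c) 0
              ≡⟨ shift-at (suc c ℕ.* N) (u S.^ suc c) 0 ⟨
            shift (suc c ℕ.* N) (u S.^ suc c) (suc c ℕ.* N ℕ.+ 0)
              ≡⟨ ≡.cong (shift (suc c ℕ.* N) (u S.^ suc c)) (ℕ.+-identityʳ (suc c ℕ.* N)) ⟩
            shift (suc c ℕ.* N) (u S.^ suc c) (suc c ℕ.* N)
              ≈⟨ powers (suc c ℕ.* N) ⟩
            shift D r (suc c ℕ.* N)
              ≡⟨ shift-below D r cN<D ⟩
            0# ∎))

    -- With δ = u − v and both powers equal to the step series, Taylor
    -- expansion gives δ · ((c + 1) uᶜ − δ q − tᴺ R) = 0.  The constant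
    -- coefficient of (c + 1) uᶜ is invertible, so by locality δ or the other
    -- factor is a unit.
    equal-or-apart : 1 ℕ.≤ D → ∀ {x y} → SmallSeries x → SmallSeries y →
      (x S.≈ y) ⊎ (∃[ N ] ∃[ v ] (x S.- y S.≈ shift N v) × Invertible (v 0))
    equal-or-apart 1≤D {x} {y} sx sy with leading sx | leading sy
    ... | N , u , cN≡D , x≈ , u₀-invertible , uᶜ≈ | N′ , v , cN′≡D , y≈ , _ , vᶜ≈
      with ℕ.*-cancelˡ-≡ N N′ (suc c) (≡.trans cN≡D (≡.sym cN′≡D))
    ... | ≡.refl = conclude (local sum-invertible)
      where
      δ = u S.- v
      taylor = SU.power-taylor c u v
      q = proj₁ taylor
      G = (suc c S.· S.1#) S.* u S.^ c
      rest = SU.weighted-sum-difference (λ ℓ → const-series (w ℓ)) (λ ℓ → x S.^ e ℓ) (λ ℓ → y S.^ e ℓ)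
        (λ ℓ → proj₁ (SU.power-difference (e ℓ) x y)) (x S.- y) (λ ℓ → proj₂ (SU.power-difference (e ℓ) x y))
      R = S.sum (λ ℓ → const-series (w ℓ) S.* proj₁ (SU.power-difference (e ℓ) x y))
      F = (G S.- δ S.* q) S.- shift N R

      x-y≈ : x S.- y S.≈ shift N δ
      x-y≈ n = trans (+-cong (x≈ n) (trans (-‿cong (y≈ n)) (sym (shift-neg N v n)))) (sym (shift-+ N u (S.- v) n))

      δF≈0 : δ S.* F S.≈ S.0#
      δF≈0 = SU.cancel-difference {u S.^ suc c} {v S.^ suc c} {step-series x} {step-series y}
        {δ} {G S.- δ S.* q} {shift N R} uᶜ≈ vᶜ≈ (proj₂ taylor)
        (S.trans {step-series x S.- step-series y} {(x S.- y) S.* R} {δ S.* shift N R} rest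
          (S.trans {(x S.- y) S.* R} {shift N δ S.* R} {δ S.* shift N R}
            (S.*-congʳ {R} {x S.- y} {shift N δ} x-y≈) (shift-*-swap N δ R)))

      -- N = 0 would give D = 0. For positive N the series t^N R has constant coefficient 0, so at 0
      -- the unit `G` and the factor `F` differ by δ q alone.
      N≢0 : N ≢ 0
      N≢0 ≡.refl = contradiction (≡.subst (1 ℕ.≤_) (≡.trans (≡.sym cN≡D) (ℕ.*-zeroʳ c)) 1≤D) λ ()

      split : G 0 ≈ F 0 + δ 0 * q 0
      split = begin
        G 0
          ≈⟨ solve 2 (λ g p → g := ((g :- p) :- con (+ 0)) :+ p) refl (G 0) (δ 0 * q 0) ⟩
        ((G 0 - δ 0 * q 0) - 0#) + δ 0 * q 0
          ≈⟨ +-congʳ (+-cong (+-congˡ (-‿cong (+-identityʳ _))) (-‿cong (reflexive (shift-below N R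
              (ℕ.n≢0⇒n>0 N≢0))))) ⟨
        F 0 + δ 0 * q 0 ∎

      sum-invertible : Invertible (F 0 + δ 0 * q 0)
      sum-invertible = KU.invertible-cong
        (trans (*-cong (sym (constant-coefficient-· (suc c))) (sym (constant-coefficient-^ u c)))
          (trans (sym (+-identityʳ _)) split))
        (KU.invertible-* (characteristic-0 c) (KU.invertible-^ c u₀-invertible))

      conclude : Invertible (F 0) ⊎ Invertible (δ 0 * q 0) →
                 (x S.≈ y) ⊎ (∃[ N ] ∃[ v ] (x S.- y S.≈ shift N v) × Invertible (v 0))
      conclude (inj₂ δq-invertible) = inj₂ (N , δ , x-y≈ , KU.invertible-factorˡ δq-invertible)
      conclude (inj₁ F₀-invertible) = inj₁ (S.x-y≈0⇒x≈y {x} {y} (S.trans {x S.- y} {shift N δ} {S.0#} x-y≈ λ n →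
        trans (shift-cong N δ≈0 n) (sym (shift-unique N {S.0#} {S.0#} (λ _ _ → refl) (λ _ → refl) n))))
        where
        δ≈0 : δ S.≈ S.0#
        δ≈0 = SU.invertible⇒regular {F} (series-invertible F₀-invertible) δ
          (S.trans {F S.* δ} {δ S.* F} {S.0#} (S.*-comm F δ) δF≈0)

-- Transfer of the kernel method along a ring homomorphism.

module Homomorphism {a ℓ a′ ℓ′} (S : CommutativeRing a ℓ) (R : CommutativeRing a′ ℓ′)
  (ι : CommutativeRing.Carrier S → CommutativeRing.Carrier R)
  (ι-cong : ∀ {x y} → CommutativeRing._≈_ S x y → CommutativeRing._≈_ R (ι x) (ι y))
  (ι-+ : ∀ x y → CommutativeRing._≈_ R (ι (CommutativeRing._+_ S x y)) (CommutativeRing._+_ R (ι x) (ι y)))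
  (ι-* : ∀ x y → CommutativeRing._≈_ R (ι (CommutativeRing._*_ S x y)) (CommutativeRing._*_ R (ι x) (ι y)))
  (ι-1 : CommutativeRing._≈_ R (ι (CommutativeRing.1# S)) (CommutativeRing.1# R))
  where
  open RingKit R
  private module S = RingKit S
  private
    module SV = Vandermonde S
    module SK = KernelMethod S
  open Vandermonde R
  open KernelMethod R

  ι-0 : ι S.0# ≈ 0#
  ι-0 = begin
    ι S.0#                        ≈⟨ solve 1 (λ x → x := (x :+ x) :- x) refl (ι S.0#) ⟩
    (ι S.0# + ι S.0#) - ι S.0#    ≈⟨ +-congʳ (ι-+ S.0# S.0#) ⟨
    ι (S.0# S.+ S.0#) - ι S.0#    ≈⟨ +-congʳ (ι-cong (S.+-identityˡ S.0#)) ⟩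
    ι S.0# - ι S.0#               ≈⟨ -‿inverseʳ _ ⟩
    0#                            ∎

  ι-neg : ∀ x → ι (S.- x) ≈ - ι x
  ι-neg x = begin
    ι (S.- x)                     ≈⟨ solve 2 (λ x y → x := (x :+ y) :- y) refl (ι (S.- x)) (ι x) ⟩
    (ι (S.- x) + ι x) - ι x       ≈⟨ +-congʳ (ι-+ (S.- x) x) ⟨
    ι (S.- x S.+ x) - ι x         ≈⟨ +-congʳ (trans (ι-cong (S.-‿inverseˡ x)) ι-0) ⟩
    0# - ι x                      ≈⟨ +-identityˡ _ ⟩
    - ι x                         ∎

  ι-- : ∀ x y → ι (x S.- y) ≈ ι x - ι y
  ι-- x y = trans (ι-+ x (S.- y)) (+-congˡ (ι-neg y))

  ι-^ : ∀ x n → ι (x S.^ n) ≈ ι x ^ n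
  ι-^ x zero    = ι-1
  ι-^ x (suc n) = trans (ι-* x (x S.^ n)) (*-congˡ (ι-^ x n))

  ι-sum : ∀ {n} (f : Vector S.Carrier n) → ι (S.sum f) ≈ sum (ι ∘ f)
  ι-sum {zero}  f = ι-0
  ι-sum {suc n} f = trans (ι-+ (f zero) (S.sum (tail f))) (+-congˡ (ι-sum (tail f)))

  ι-product : ∀ {n} (f : Vector S.Carrier n) → ι (S.product f) ≈ product (ι ∘ f)
  ι-product {zero}  f = ι-1
  ι-product {suc n} f = trans (ι-* (f zero) (S.product (tail f))) (*-congˡ (ι-product (tail f)))

  ι-weighted-sum : ∀ {n} {w : Vector Carrier n} {ŵ : Vector S.Carrier n}
    {f : Vector Carrier n} {f̂ : Vector S.Carrier n} →
    (∀ i → w i ≈ ι (ŵ i)) → (∀ i → f i ≈ ι (f̂ i)) →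
    sum (λ i → w i * f i) ≈ ι (S.sum (λ i → ŵ i S.* f̂ i))
  ι-weighted-sum {w = w} {ŵ} {f} {f̂} w≈ f≈ = begin
    sum (λ i → w i * f i)            ≈⟨ sum-cong-≋ (λ i → trans (*-cong (w≈ i) (f≈ i)) (sym (ι-* (ŵ i) (f̂ i)))) ⟩
    sum (λ i → ι (ŵ i S.* f̂ i))      ≈⟨ ι-sum (λ i → ŵ i S.* f̂ i) ⟨
    ι (S.sum (λ i → ŵ i S.* f̂ i))    ∎

  ι-H : ∀ {n} (Ẑ : Vector S.Carrier (suc n)) {Z} → (∀ i → Z i ≈ ι (Ẑ i)) → ∀ N → H Z N ≈ ι (SV.H Ẑ N)
  ι-H {zero}  Ẑ Z≈ N       = trans (^-congˡ N (Z≈ zero)) (sym (ι-^ (Ẑ zero) N))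
  ι-H {suc n} Ẑ Z≈ zero    = sym ι-0
  ι-H {suc n} Ẑ {Z} Z≈ (suc N) = begin
    Z zero * H Z N + H (tail Z) N
      ≈⟨ +-cong (*-cong (Z≈ zero) (ι-H Ẑ Z≈ N)) (ι-H (tail Ẑ) (Z≈ ∘ suc) N) ⟩
    ι (Ẑ zero) * ι (SV.H Ẑ N) + ι (SV.H (tail Ẑ) N)
      ≈⟨ +-congʳ (ι-* (Ẑ zero) (SV.H Ẑ N)) ⟨
    ι (Ẑ zero S.* SV.H Ẑ N) + ι (SV.H (tail Ẑ) N)
      ≈⟨ ι-+ (Ẑ zero S.* SV.H Ẑ N) (SV.H (tail Ẑ) N) ⟨
    ι (SV.H Ẑ (suc N)) ∎

  ι-interpolant : ∀ {n} (X̂ : Vector S.Carrier n) {X} → (∀ i → X i ≈ ι (X̂ i)) → ∀ N →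
                  interpolant X N ≈ ι (SK.interpolant X̂ N)
  ι-interpolant X̂ {X} X≈ N = begin
    differences 1# X * H (1# ◂ X) N
      ≈⟨ *-cong (product-cong λ i → trans (+-cong (sym ι-1) (-‿cong (X≈ i))) (sym (ι-- S.1# (X̂ i))))
                (ι-H (S.1# ◂ X̂) (λ { zero → sym ι-1 ; (suc i) → X≈ i }) N) ⟩
    product (λ i → ι (S.1# S.- X̂ i)) * ι (SV.H (S.1# ◂ X̂) N)
      ≈⟨ *-congʳ (ι-product (λ i → S.1# S.- X̂ i)) ⟨
    ι (SV.differences S.1# X̂) * ι (SV.H (S.1# ◂ X̂) N)
      ≈⟨ ι-* (SV.differences S.1# X̂) (SV.H (S.1# ◂ X̂) N) ⟨
    ι (SK.interpolant X̂ N) ∎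

  -- (1 − z Σ w) T(N) and the interpolant at N differ by a solution of the homogeneous recurrence.
  module Discrepancy (ι-injective : ∀ {x y} → ι x ≈ ι y → x S.≈ y)
    {c m : ℕ} (X : Vector Carrier (suc c)) (reg : RegularDifferences (1# ◂ X))
    {V⁻¹ : Carrier} (VV⁻¹≈1 : vandermonde X * V⁻¹ ≈ 1#)
    (X̂ : Vector S.Carrier (suc c)) (X≈ : ∀ i → X i ≈ ι (X̂ i))
    (z : Carrier) (ẑ : S.Carrier) (z≈ : z ≈ ι ẑ)
    (w : Vector Carrier m) (ŵ : Vector S.Carrier m) (w≈ : ∀ ℓ → w ℓ ≈ ι (ŵ ℓ))
    (e : Fin m → ℕ) (kernel : ∀ i → X i ^ suc c ≈ z * sum (λ ℓ → w ℓ * X i ^ e ℓ))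
    (T : ℕ → Carrier) (T̂ : ℕ → S.Carrier) (T≈ : ∀ N → T N ≈ ι (T̂ N))
    (T̂-below : ∀ {N} → N ℕ.< suc c → T̂ N S.≈ S.0#)
    (T-recurrence : ∀ j → T (suc c ℕ.+ j) ≈ 1# + z * sum (λ ℓ → w ℓ * T (j ℕ.+ e ℓ)))
    where

    discrepancy : ℕ → S.Carrier
    discrepancy N = (S.1# S.- ẑ S.* S.sum ŵ) S.* T̂ N S.- SK.interpolant X̂ N

    private
      κ = 1# - z * sum w

    discrepancy-ι : ∀ N → κ * T N - interpolant X N ≈ ι (discrepancy N)
    discrepancy-ι N = begin
      κ * T N - interpolant X N
        ≈⟨ +-cong (*-cong κ≈ (T≈ N)) (-‿cong (ι-interpolant X̂ X≈ N)) ⟩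
      ι κ̂ * ι (T̂ N) - ι (SK.interpolant X̂ N)
        ≈⟨ +-congʳ (ι-* κ̂ (T̂ N)) ⟨
      ι (κ̂ S.* T̂ N) - ι (SK.interpolant X̂ N)
        ≈⟨ ι-- (κ̂ S.* T̂ N) (SK.interpolant X̂ N) ⟨
      ι (discrepancy N) ∎
      where
      κ̂ = S.1# S.- ẑ S.* S.sum ŵ
      κ≈ : κ ≈ ι κ̂
      κ≈ = begin
        1# - z * sum w               ≈⟨ +-cong (sym ι-1) (-‿cong (*-cong z≈ (trans (sum-cong-≋ w≈) (sym
            (ι-sum ŵ))))) ⟩
        ι S.1# - ι ẑ * ι (S.sum ŵ)   ≈⟨ +-congˡ (-‿cong (ι-* ẑ (S.sum ŵ))) ⟨
        ι S.1# - ι (ẑ S.* S.sum ŵ)   ≈⟨ ι-- S.1# (ẑ S.* S.sum ŵ) ⟨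
        ι κ̂                          ∎

    discrepancy-below : ∀ {N} → N ℕ.< suc c → discrepancy N S.≈ S.0#
    discrepancy-below {N} N<c = S.begin
      discrepancy N
        S.≈⟨ S.+-cong (S.*-congˡ (T̂-below N<c)) (S.-‿cong (SK.interpolant-below X̂ N<c)) ⟩
      (S.1# S.- ẑ S.* S.sum ŵ) S.* S.0# S.- S.0#
        S.≈⟨ S.+-cong (S.zeroʳ _) S.-0#≈0# ⟩
      S.0# S.+ S.0#
        S.≈⟨ S.+-identityˡ S.0# ⟩
      S.0# S.∎

    -- The recurrence of the interpolant relies on the inverse of the Vandermonde product, which is
    -- available in R but in general not in S. It is therefore proved after applying ι and pulled
    -- back by injectivity. The inhomogeneous terms of T, multiplied by κ, and of the interpolant
    -- are both κ and cancel.
    discrepancy-recurrence : ∀ j →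
      discrepancy (suc c ℕ.+ j) S.≈ ẑ S.* S.sum (λ ℓ → ŵ ℓ S.* discrepancy (j ℕ.+ e ℓ))
    discrepancy-recurrence j = ι-injective (begin
      ι (discrepancy (suc c ℕ.+ j))
        ≈⟨ discrepancy-ι (suc c ℕ.+ j) ⟨
      κ * T (suc c ℕ.+ j) - interpolant X (suc c ℕ.+ j)
        ≈⟨ +-cong (*-congˡ (T-recurrence j)) (-‿cong (interpolant-recurrence X reg VV⁻¹≈1 z w e kernel j)) ⟩
      κ * (1# + z * sum (λ ℓ → w ℓ * τ ℓ)) - (κ + z * sum (λ ℓ → w ℓ * ε ℓ))
        ≈⟨ solve 4 (λ k z t e → k :* (con (+ 1) :+ z :* t) :- (k :+ z :* e) := z :* (k :* t :- e)) refl κ z _ _ ⟩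
      z * (κ * sum (λ ℓ → w ℓ * τ ℓ) - sum (λ ℓ → w ℓ * ε ℓ))
        ≈⟨ *-congˡ combine ⟩
      z * sum (λ ℓ → w ℓ * (κ * τ ℓ - ε ℓ))
        ≈⟨ *-cong z≈ (ι-weighted-sum w≈ (λ ℓ → discrepancy-ι (j ℕ.+ e ℓ))) ⟩
      ι ẑ * ι (S.sum (λ ℓ → ŵ ℓ S.* discrepancy (j ℕ.+ e ℓ)))
        ≈⟨ ι-* ẑ _ ⟨
      ι (ẑ S.* S.sum (λ ℓ → ŵ ℓ S.* discrepancy (j ℕ.+ e ℓ))) ∎)
      where
      τ ε : Vector Carrier m
      τ ℓ = T (j ℕ.+ e ℓ)
      ε ℓ = interpolant X (j ℕ.+ e ℓ)
      combine : κ * sum (λ ℓ → w ℓ * τ ℓ) - sum (λ ℓ → w ℓ * ε ℓ) ≈ sum (λ ℓ → w ℓ * (κ * τ ℓ - ε ℓ))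
      combine = begin
        κ * sum (λ ℓ → w ℓ * τ ℓ) - sum (λ ℓ → w ℓ * ε ℓ)
          ≈⟨ +-cong (*-distribˡ-sum κ (λ ℓ → w ℓ * τ ℓ)) (sum-neg (λ ℓ → w ℓ * ε ℓ)) ⟩
        sum (λ ℓ → κ * (w ℓ * τ ℓ)) + sum (λ ℓ → - (w ℓ * ε ℓ))
          ≈⟨ ∑-distrib-+ (λ ℓ → κ * (w ℓ * τ ℓ)) (λ ℓ → - (w ℓ * ε ℓ)) ⟨
        sum (λ ℓ → κ * (w ℓ * τ ℓ) - w ℓ * ε ℓ)
          ≈⟨ sum-cong-≋ (λ ℓ → solve 4 (λ k w t e → k :* (w :* t) :- w :* e := w :* (k :* t :- e)) refl κ (w ℓ)
              (τ ℓ) (ε ℓ)) ⟩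
        sum (λ ℓ → w ℓ * (κ * τ ℓ - ε ℓ)) ∎

-- Generating functions of meanders and their first-step recurrence.

module Meanders {a ℓ} (K : CommutativeRing a ℓ) {m : ℕ} (b : Fin m → ℤ) (w : Fin m → CommutativeRing.Carrier K)
  (c : ℕ) (e : Fin m → ℕ) (e≡b+c : ∀ i → + e i ≡ b i ℤ.+ + c) where
  open import Data.Vec.Base using ([]; _∷_)
  open import Data.Vec.Relation.Unary.All using ([]; _∷_)
  open RingKit K
  open FilteredSums K
  open PowerSeries K
  open SeriesUnits K
  open Steps rawRing b w using (levels; t; weight)
  private module S = RingKit seriesRing

  -- The generating function of meanders starting at level N − c, which is 0
  -- for negative levels.
  meanderSeries : ℕ → Series
  meanderSeries N with below-or-above c N
  ... | inj₁ _       = 0ₛ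
  ... | inj₂ (j , _) = λ n → t n j

  meanderSeries-at : ∀ j n → meanderSeries (c ℕ.+ j) n ≡ t n j
  meanderSeries-at j n with below-or-above c (c ℕ.+ j)
  ... | inj₁ c+j<c    = contradiction c+j<c (ℕ.m+n≮m c j)
  ... | inj₂ (k , eq) = ≡.cong (t n) (≡.sym (ℕ.+-cancelˡ-≡ c j k eq))

  meanderSeries-below : ∀ {N} → N ℕ.< c → meanderSeries N ≈ₛ 0ₛ
  meanderSeries-below {N} N<c n with below-or-above c N
  ... | inj₁ _            = refl
  ... | inj₂ (j , ≡.refl) = contradiction N<c (ℕ.m+n≮m c j)

  private
    NonNegative : ∀ {n} → ℤ → Vec (Fin m) n → Set
    NonNegative x ss = All (ℤ.+0 ℤ.≤_) (levels x ss)

    nonNegative? : ∀ {n} x → Decidable (NonNegative {n} x)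
    nonNegative? x ss = all? (ℤ.+0 ℤ.≤?_) (levels x ss)

    nonNegative-start : ∀ {n x} (ss : Vec (Fin m) n) → NonNegative x ss → ℤ.+0 ℤ.≤ x
    nonNegative-start []       (0≤x ∷ _) = 0≤x
    nonNegative-start (_ ∷ ss) (0≤x ∷ _) = 0≤x

    level+c : ∀ j i → (+ j ℤ.+ b i) ℤ.+ + c ≡ + (j ℕ.+ e i)
    level+c j i = ≡.trans (ℤ.+-assoc (+ j) (b i) (+ c)) (≡.cong (λ x → + j ℤ.+ x) (≡.sym (e≡b+c i)))

    -- The index after the step is the new level plus c. If it is below c, no completion is a
    -- meander and the extended series is 0 as well; otherwise the remaining steps form an arbitrary
    -- meander from the new level.
    first-step : ∀ n j i →
      filteredSum (λ ss → nonNegative? (+ j) (i ∷ ss)) (λ ss → w i * weight ss) (tuples m n) ≈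
      w i * meanderSeries (j ℕ.+ e i) n
    first-step n j i with below-or-above c (j ℕ.+ e i)
    ... | inj₁ j+e<c = trans (filteredSum-none _ _ starts-below (tuples m n)) (sym (zeroʳ _))
      where
      starts-below : ∀ ss → ¬ NonNegative (+ j) (i ∷ ss)
      starts-below ss (_ ∷ rest) = ℕ.<⇒≱ j+e<c (ℤ.drop‿+≤+
        (≡.subst (+ c ℤ.≤_) (level+c j i) (ℤ.+-monoˡ-≤ (+ c) (nonNegative-start ss rest))))
    ... | inj₂ (k , j+e≡c+k) = begin
      filteredSum (λ ss → nonNegative? (+ j) (i ∷ ss)) (λ ss → w i * weight ss) (tuples m n)
        ≈⟨ filteredSum-≐ _ _ (nonNegative? (+ k)) (forth , back) (tuples m n) ⟩
      filteredSum (nonNegative? (+ k)) (λ ss → w i * weight ss) (tuples m n)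
        ≈⟨ *-distribˡ-filteredSum (nonNegative? (+ k)) weight (w i) (tuples m n) ⟨
      w i * t n k ∎
      where
      level≡k : + j ℤ.+ b i ≡ + k
      level≡k = RingProperties.+-cancelʳ ℤ.+-*-ring (+ c) (+ j ℤ.+ b i) (+ k)
        (≡.trans (level+c j i) (≡.cong +_ (≡.trans j+e≡c+k (ℕ.+-comm c k))))
      forth : ∀ {ss} → NonNegative (+ j) (i ∷ ss) → NonNegative (+ k) ss
      forth {ss} (_ ∷ rest) = ≡.subst (λ x → NonNegative x ss) level≡k rest
      back : ∀ {ss} → NonNegative (+ k) ss → NonNegative (+ j) (i ∷ ss)
      back {ss} rest = ℤ.+≤+ z≤n ∷ ≡.subst (λ x → NonNegative x ss) (≡.sym level≡k) rest

  t-suc : ∀ n j → t (suc n) j ≈ sum (λ i → w i * meanderSeries (j ℕ.+ e i) n)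
  t-suc n j = trans (filteredSum-tuples m n (nonNegative? (+ j)) weight) (sum-cong-≋ (first-step n j))

  meanderSeries-recurrence : ∀ j → meanderSeries (c ℕ.+ j) S.≈
    S.1# S.+ shift 1 S.1# S.* S.sum (λ i → const-series (w i) S.* meanderSeries (j ℕ.+ e i))
  meanderSeries-recurrence j n = trans (reflexive (meanderSeries-at j n)) (coefficient n)
    where
    Y : Series
    Y = S.sum (λ i → const-series (w i) S.* meanderSeries (j ℕ.+ e i))
    shifted : shift 1 S.1# S.* Y S.≈ shift 1 Y
    shifted = S.trans {shift 1 S.1# S.* Y} {shift 1 (S.1# S.* Y)} {shift 1 Y}
      (shift-*ˡ 1 S.1# Y) (shift-cong 1 (S.*-identityˡ Y))
    coefficient : ∀ n → t n j ≈ const-series 1# n + (shift 1 S.1# S.* Y) n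
    -- `t 0 j` computes to `1# + 0#`: the only path of length 0 is empty, and its single level `+ j`
    -- is nonnegative.
    coefficient zero    = +-congˡ (sym (shifted 0))
    coefficient (suc n) = begin
      t (suc n) j
        ≈⟨ t-suc n j ⟩
      sum (λ i → w i * meanderSeries (j ℕ.+ e i) n)
        ≈⟨ sum-cong-≋ (λ i → const-*ˡ (w i) (meanderSeries (j ℕ.+ e i)) n) ⟨
      sum (λ i → (const-series (w i) S.* meanderSeries (j ℕ.+ e i)) n)
        ≈⟨ coefficient-sum (λ i → const-series (w i) S.* meanderSeries (j ℕ.+ e i)) n ⟨
      Y n
        ≈⟨ +-identityˡ _ ⟨
      0# + Y n
        ≈⟨ +-congˡ (shifted (suc n)) ⟨
      0# + (shift 1 S.1# S.* Y) (suc n) ∎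

  -- The recurrence can raise N, since steps may go up, so induction on N is impossible. The
  -- induction is on the coefficient index n, for all N at once: each use of the recurrence lowers n
  -- by D ≥ 1.
  homogeneous-recurrence : ∀ D → 1 ℕ.≤ D → (δ : ℕ → Series) → (∀ {N} → N ℕ.< c → δ N S.≈ S.0#) →
    (∀ j → δ (c ℕ.+ j) S.≈ shift D S.1# S.* S.sum (λ i → const-series (w i) S.* δ (j ℕ.+ e i))) →
    ∀ N → δ N S.≈ S.0#
  homogeneous-recurrence D 1≤D δ below recurrence N n = vanish (suc n) N n ℕ.≤-refl
    where
    vanish : ∀ fuel N n → n ℕ.< fuel → δ N n ≈ 0#
    vanish (suc fuel) N n (s≤s n≤fuel) with below-or-above c N
    ... | inj₁ N<c          = below N<c n
    ... | inj₂ (j , ≡.refl) = trans (recurrence j n) (trans (shift-*ˡ D S.1# Y n)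
            (trans (shift-cong D (S.*-identityˡ Y) n) (shifted (below-or-above D n))))
      where
      Y : Series
      Y = S.sum (λ i → const-series (w i) S.* δ (j ℕ.+ e i))
      shifted : _ → shift D Y n ≈ 0#
      shifted (inj₁ n<D) = reflexive (shift-below D Y n<D)
      shifted (inj₂ (k , ≡.refl)) = trans (reflexive (shift-at D Y k))
        (trans (coefficient-sum (λ i → const-series (w i) S.* δ (j ℕ.+ e i)) k)
          (sum-zero λ i → trans (const-*ˡ (w i) (δ (j ℕ.+ e i)) k)
            (trans (*-congˡ (vanish fuel (j ℕ.+ e i) k (ℕ.<-≤-trans (ℕ.m<n+m k 1≤D) n≤fuel))) (zeroʳ _))))

-- The closed forms over a field of characteristic 0, with lowest step -(c + 1).

module MeanderTheorem {a ℓ} (K : CommutativeRing a ℓ) (isField : IsFieldOfCharacteristic0 K)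
  {m : ℕ} (b : Fin m → ℤ) (b-injective : Injective _≡_ _≡_ b)
  (w : Fin m → CommutativeRing.Carrier K) (w-invertible : ∀ ℓ → RingKit.Invertible K (w ℓ))
  (c : ℕ) (minimum : IsMinimum b (ℤ.- (+ suc c)))
  where
  open RingKit K
  open PuiseuxSeries rawRing using (Puiseux; HasPositiveOrder; constant; z; fromPowerSeries)
  open PowerSeries K
  open PuiseuxRing K
  open SeriesUnits K
  open Steps rawRing b w using (IsSmallSolution; AreTheSmallSolutions; P; T)
  private
    module KU = Units K
    module S = RingKit seriesRing
    module R = RingKit puiseuxRing
    module RU = Units puiseuxRing
    module RV = Vandermonde puiseuxRing
    module RK = KernelMethod puiseuxRing

  exponent : Fin m → ℕ
  exponent i = ℤ.∣ b i ℤ.+ + suc c ∣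

  exponent≡ : ∀ i → + exponent i ≡ b i ℤ.+ + suc c
  exponent≡ i = ℤ.0≤i⇒+∣i∣≡i (≡.subst (ℤ._≤ b i ℤ.+ + suc c) (ℤ.+-inverseˡ (+ suc c))
    (ℤ.+-monoˡ-≤ (+ suc c) (proj₂ minimum i)))

  exponent-injective : ∀ {i k} → exponent i ≡ exponent k → i ≡ k
  exponent-injective {i} {k} eq = b-injective (RingProperties.+-cancelʳ ℤ.+-*-ring (+ suc c) (b i) (b k)
    (≡.trans (≡.sym (exponent≡ i)) (≡.trans (≡.cong +_ eq) (exponent≡ k))))

  lowest : Fin m
  lowest = proj₁ (proj₁ minimum)

  exponent-lowest : exponent lowest ≡ 0
  exponent-lowest = ℤ.+-injective (≡.trans (exponent≡ lowest)
    (≡.trans (≡.cong (λ x → x ℤ.+ + suc c) (proj₂ (proj₁ minimum))) (ℤ.+-inverseˡ (+ suc c))))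

  module Small = SmallSeries K isField
  module Paths = Meanders K b w (suc c) exponent exponent≡

  -- All solutions must lie in one ring K[[z^{1/D}]], both to be compared with each other and to
  -- enter a single discrepancy.
  common-denominator : ∀ {n} (X : Vector Puiseux n) → (∀ i → HasPositiveOrder (X i)) →
    ∃[ D ] Σ[ nz ∈ NonZero D ] Σ[ A ∈ (Fin n → Series) ] (∀ i → A i 0 ≈ 0#) × (∀ i → X i R.≈ series D {{nz}} (A i))
  common-denominator {zero}  X _   = 1 , _ , (λ ()) , (λ ()) , λ ()
  common-denominator {suc n} X ord
    with common-denominator (tail X) (ord ∘ suc) | positiveOrder⇒series (X zero) (ord zero)
  ... | D , nz , A , A₀≈0 , X≈A | a₀ , a₀₀≈0 , X₀≈ = d ℕ.* D , nz* , A′ , A′₀≈0 , X≈A′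
    where
    d = Puiseux.den (X zero)
    instance
      _ = nz
      d≢0 : NonZero d
      d≢0 = Puiseux.den≢0 (X zero)
      nz* : NonZero (d ℕ.* D)
      nz* = ℕ.m*n≢0 d D
      nz*′ : NonZero (D ℕ.* d)
      nz*′ = ℕ.m*n≢0 D d
    A′ : Fin (suc n) → Series
    A′ zero    = inflate D a₀
    A′ (suc i) = inflate d (A i)
    A′₀≈0 : ∀ i → A′ i 0 ≈ 0#
    A′₀≈0 zero    = trans (reflexive (inflate-∣ D a₀ 0)) a₀₀≈0
    A′₀≈0 (suc i) = trans (reflexive (inflate-∣ d (A i) 0)) (A₀≈0 i)
    X≈A′ : ∀ i → X i R.≈ series (d ℕ.* D) (A′ i)
    X≈A′ zero = R.trans {X zero} {series d a₀} {series (d ℕ.* D) (A′ zero)} X₀≈ (series-inflate d D a₀)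
    X≈A′ (suc i) = R.trans {X (suc i)} {series D (A i)} {series (d ℕ.* D) (A′ (suc i))} (X≈A i)
      (R.trans {series D (A i)} {series (D ℕ.* d) (A′ (suc i))} {series (d ℕ.* D) (A′ (suc i))}
        (series-inflate D d (A i)) (series-den (A′ (suc i)) (ℕ.*-comm D d)))

  module Embedding (D : ℕ) {{_ : NonZero D}} = Homomorphism seriesRing puiseuxRing (series D)
    (series-cong D) (series-+ D) (series-* D) (series-const D 1#)

  const-w : ∀ D {{_ : NonZero D}} i → constant (w i) R.≈ series D (const-series (w i))
  const-w D i = R.sym {series D (const-series (w i))} {constant (w i)} (series-const D (w i))

  z≈ : ∀ D {{_ : NonZero D}} → z R.≈ series D (shift D S.1#)
  z≈ D = R.sym {series D (shift D S.1#)} {z} (series-z D)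

  module _ {X : Puiseux} (solution : IsSmallSolution X) where
    open IsSmallSolution solution renaming (solution to kernel)

    kernel-equation : X R.^ suc c R.≈ z R.* R.sum (λ i → constant (w i) R.* X R.^ exponent i)
    kernel-equation = RK.polynomialize {z = z} {X} {X⁻¹} (λ i → constant (w i)) b exponent
        (suc c) exponent≡ inverseʳ kernel

    -- Every term of the polynomial kernel equation is the image of a power series in z^{1/D}, so
    -- the equation descends by injectivity of `series D`.
    smallSeries : ∀ D {{_ : NonZero D}} {A} → A 0 ≈ 0# → X R.≈ series D A →
      Small.SmallSeries w exponent exponent-injective lowest exponent-lowest (w-invertible lowest) c D A
    smallSeries D {A} A₀≈0 X≈A = A₀≈0 , S.trans {A S.^ suc c} {shift D S.1# S.* step} {shift D step}
      (series-injective D {A S.^ suc c} {shift D S.1# S.* step} (R.begin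
        series D (A S.^ suc c)
          R.≈⟨ ι-^ A (suc c) ⟩
        series D A R.^ suc c
          R.≈⟨ R.^-congˡ (suc c) {X} {series D A} X≈A ⟨
        X R.^ suc c
          R.≈⟨ kernel-equation ⟩
        z R.* R.sum (λ i → constant (w i) R.* X R.^ exponent i)
          R.≈⟨ R.*-cong {z} {series D (shift D S.1#)}
                 {R.sum (λ i → constant (w i) R.* X R.^ exponent i)} {series D step} (z≈ D)
                 (ι-weighted-sum {w = λ i → constant (w i)} {λ i → const-series (w i)}
                   {λ i → X R.^ exponent i} {λ i → A S.^ exponent i} (const-w D) powers) ⟩
        series D (shift D S.1#) R.* series D step
          R.≈⟨ series-* D (shift D S.1#) step ⟨
        series D (shift D S.1# S.* step) R.∎))
      (S.trans {shift D S.1# S.* step} {shift D (S.1# S.* step)} {shift D step}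
        (shift-*ˡ D S.1# step) (shift-cong D (S.*-identityˡ step)))
      where
      open Embedding D
      step : Series
      step = S.sum (λ i → const-series (w i) S.* A S.^ exponent i)
      powers : ∀ i → X R.^ exponent i R.≈ series D (A S.^ exponent i)
      powers i = R.trans {X R.^ exponent i} {series D A R.^ exponent i} {series D (A S.^ exponent i)}
        (R.^-congˡ (exponent i) {X} {series D A} X≈A)
        (R.sym {series D (A S.^ exponent i)} {series D A R.^ exponent i} (ι-^ A (exponent i)))

  series-shift-invertible : ∀ D {{_ : NonZero D}} s {v} → Invertible (v 0) → R.Invertible (series D (shift s v))
  series-shift-invertible D s {v} v₀-invertible with series-invertible {v} v₀-invertible
  ... | v⁻¹ , _ , vv⁻¹≈1 = RU.invertible {series D (shift s v)} {record { den = D ; pole = s ; coeff = v⁻¹ }}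
    (series-shift-inverse D s v v⁻¹ vv⁻¹≈1)

  module _ (X : Vector Puiseux (suc c)) (solutions : AreTheSmallSolutions X) where
    open AreTheSmallSolutions solutions
    private
      common = common-denominator X (λ i → IsSmallSolution.positiveOrder (isSmallSolution i))
      D = proj₁ common
      instance
        D≢0 : NonZero D
        D≢0 = proj₁ (proj₂ common)
      A = proj₁ (proj₂ (proj₂ common))
      A₀≈0 = proj₁ (proj₂ (proj₂ (proj₂ common)))
      X≈A = proj₂ (proj₂ (proj₂ (proj₂ common)))
      open Embedding D

      difference≈ : ∀ {f g x y} → f R.≈ series D x → g R.≈ series D y → f R.- g R.≈ series D (x S.- y)
      difference≈ {f} {g} {x} {y} f≈ g≈ = R.trans {f R.- g} {series D x R.- series D y} {series D (x S.- y)}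
        (R.+-cong {f} {series D x} {R.- g} {R.- series D y} f≈ (R.-‿cong {g} {series D y} g≈))
        (R.sym {series D (x S.- y)} {series D x R.- series D y} (ι-- x y))

    -- Distinctness only refutes equality, which excludes the first alternative of `equal-or-apart`.
    -- The second gives the difference as t^s times a unit, and t is invertible among Puiseux
    -- series.
    differences-invertible : ∀ {i k} → i ≢ k → R.Invertible (X i R.- X k)
    differences-invertible {i} {k} i≢k = decide (Small.equal-or-apart w exponent exponent-injective lowest
      exponent-lowest (w-invertible lowest) c D (ℕ.>-nonZero⁻¹ D)
      (smallSeries (isSmallSolution i) D (A₀≈0 i) (X≈A i)) (smallSeries (isSmallSolution k) D (A₀≈0 k) (X≈A k)))
      where
      decide : (A i S.≈ A k) ⊎ (∃[ s ] ∃[ v ] (A i S.- A k S.≈ shift s v) × Invertible (v 0)) →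
               R.Invertible (X i R.- X k)
      decide (inj₁ Aᵢ≈Aₖ) = contradiction (distinct (R.trans {X i} {series D (A i)} {X k} (X≈A i)
        (R.trans {series D (A i)} {series D (A k)} {X k} (series-cong D {A i} {A k} Aᵢ≈Aₖ)
          (R.sym {X k} {series D (A k)} (X≈A k))))) i≢k
      decide (inj₂ (s , v , A-A≈ , v₀-invertible)) = RU.invertible-cong {series D (shift s v)} {X i R.- X k}
        (R.sym {X i R.- X k} {series D (shift s v)} (R.trans {X i R.- X k} {series D (A i S.- A k)} {series D
            (shift s v)}
          (difference≈ {X i} {X k} {A i} {A k} (X≈A i) (X≈A k)) (series-cong D {A i S.- A k} {shift s v} A-A≈)))
        (series-shift-invertible D s {v} v₀-invertible)

    -- Positive order of X_i makes the constant coefficient equal to 1.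
    1-X-invertible : ∀ i → R.Invertible (R.1# R.- X i)
    1-X-invertible i = RU.invertible-cong {series D (S.1# S.- A i)} {R.1# R.- X i}
      (R.sym {R.1# R.- X i} {series D (S.1# S.- A i)} (difference≈ {R.1#} {X i} {S.1#} {A i}
        (R.sym {series D S.1#} {R.1#} (series-const D 1#)) (X≈A i)))
      (series-shift-invertible D 0 {S.1# S.- A i}
        (KU.invertible-cong (sym (trans (+-congˡ (trans (-‿cong (A₀≈0 i)) -0#≈0#))
            (+-identityʳ 1#))) KU.invertible-1))

    vandermonde-unit : R.Invertible (R.vandermonde X)
    vandermonde-unit = RU.vandermonde-invertible X differences-invertible

    regular : RV.RegularDifferences (R.1# ◂ X)
    regular = RU.regularDifferences (R.1# ◂ X) λ { {i} {k} → apart i k }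
      where
      apart : ∀ i k → i ≢ k → R.Invertible ((R.1# ◂ X) i R.- (R.1# ◂ X) k)
      apart zero    zero    0≢0 = contradiction ≡.refl 0≢0
      apart zero    (suc k) _   = 1-X-invertible k
      apart (suc i) zero    _   = RU.invertible-swap {R.1#} {X i} (1-X-invertible i)
      apart (suc i) (suc k) i≢k = differences-invertible (i≢k ∘ ≡.cong suc)

    private
      T′ : ℕ → Puiseux
      T′ N = series 1 (Paths.meanderSeries N)

      -- `T′` is a series in z itself; this is the same series in t = z^{1/D}, the ring in which the
      -- discrepancy is formed.
      T̂ : ℕ → Series
      T̂ N = inflate D (Paths.meanderSeries N)

      T≈T̂ : ∀ N → T′ N R.≈ series D (T̂ N)
      T≈T̂ N = R.trans {T′ N} {series (1 ℕ.* D) {{ℕ.m*n≢0 1 D}} (T̂ N)} {series D (T̂ N)}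
        (series-inflate 1 D (Paths.meanderSeries N) {{_}} {{D≢0}} {{ℕ.m*n≢0 1 D}})
        (series-den {{ℕ.m*n≢0 1 D}} (T̂ N) (ℕ.*-identityˡ D))

      T̂-below : ∀ {N} → N ℕ.< suc c → T̂ N S.≈ S.0#
      T̂-below {N} N<c = S.trans {T̂ N} {inflate D 0ₛ} {S.0#}
        (inflate-cong D {Paths.meanderSeries N} {0ₛ} (Paths.meanderSeries-below N<c))
        (S.sym {0ₛ} {inflate D 0ₛ} (inflate-unique D {0ₛ} {0ₛ} (λ _ → refl) (λ _ _ → refl)))

      cw : Fin m → Puiseux
      cw i = constant (w i)

      T′-recurrence : ∀ j → T′ (suc c ℕ.+ j) R.≈ R.1# R.+ z R.* R.sum (λ i → cw i R.* T′ (j ℕ.+ exponent i))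
      T′-recurrence j = R.begin
        T′ (suc c ℕ.+ j)
          R.≈⟨ series-cong 1 {Paths.meanderSeries (suc c ℕ.+ j)} {S.1# S.+ shift 1 S.1# S.* Y}
              (Paths.meanderSeries-recurrence j) ⟩
        series 1 (S.1# S.+ shift 1 S.1# S.* Y)
          R.≈⟨ series-+ 1 S.1# (shift 1 S.1# S.* Y) ⟩
        series 1 S.1# R.+ series 1 (shift 1 S.1# S.* Y)
          R.≈⟨ R.+-cong {series 1 S.1#} {R.1#} {series 1 (shift 1 S.1# S.* Y)} {z R.* series 1 Y}
                 (series-const 1 1#) (R.trans {series 1 (shift 1 S.1# S.* Y)} {series 1
                     (shift 1 S.1#) R.* series 1 Y} {z R.* series 1 Y}
                   (series-* 1 (shift 1 S.1#) Y)
                   (R.*-congʳ {series 1 Y} {series 1 (shift 1 S.1#)} {z} (series-z 1))) ⟩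
        R.1# R.+ z R.* series 1 Y
          R.≈⟨ R.+-congˡ {R.1#} {z R.* series 1 Y} {z R.* W} (R.*-congˡ {z} {series 1 Y} {W}
                 (R.sym {W} {series 1 Y} (Embedding.ι-weighted-sum 1 {w = cw} {λ i → const-series (w i)}
                   {λ i → T′ (j ℕ.+ exponent i)} {λ i → Paths.meanderSeries (j ℕ.+ exponent i)}
                   (const-w 1) (λ i → R.refl {T′ (j ℕ.+ exponent i)})))) ⟩
        R.1# R.+ z R.* W R.∎
        where
        Y : Series
        Y = S.sum (λ i → const-series (w i) S.* Paths.meanderSeries (j ℕ.+ exponent i))
        W : Puiseux
        W = R.sum (λ i → cw i R.* T′ (j ℕ.+ exponent i))

      V⁻¹ = proj₁ vandermonde-unit
      VV⁻¹≈1 = proj₂ (proj₂ vandermonde-unit)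

      κ : Puiseux
      κ = R.1# R.- z R.* R.sum cw

      module Δ = Embedding.Discrepancy D (series-injective D) X regular {V⁻¹} VV⁻¹≈1 A X≈A
        z (shift D S.1#) (z≈ D) cw (λ i → const-series (w i)) (const-w D) exponent
        (λ i → kernel-equation (isSmallSolution i)) T′ T̂ T≈T̂ T̂-below T′-recurrence

      κT≈interpolant : ∀ N → κ R.* T′ N R.- RK.interpolant X N R.≈ R.0#
      κT≈interpolant N = R.trans {κ R.* T′ N R.- RK.interpolant X N} {series D (Δ.discrepancy N)} {R.0#}
          (Δ.discrepancy-ι N)
        (R.trans {series D (Δ.discrepancy N)} {series D S.0#} {R.0#}
          (series-cong D {Δ.discrepancy N} {S.0#} (Paths.homogeneous-recurrence D
              (ℕ.>-nonZero⁻¹ D) Δ.discrepancy Δ.discrepancy-below Δ.discrepancy-recurrence N))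
          ι-0)

      -- The vacuous `shift 0` gives κ the form t^s times a series with unit constant coefficient,
      -- as `series-shift-invertible` expects it.
      κ≈ : κ R.≈ series 1 (shift 0 (S.1# S.- shift 1 S.1# S.* S.sum (λ i → const-series (w i))))
      κ≈ = R.trans {κ} {series 1 S.1# R.- series 1 (shift 1 S.1# S.* Ŵ)} {series 1 (S.1# S.- shift 1 S.1# S.* Ŵ)}
        (R.+-cong {R.1#} {series 1 S.1#} {R.- (z R.* R.sum cw)} {R.- series 1 (shift 1 S.1# S.* Ŵ)}
          (R.sym {series 1 S.1#} {R.1#} (series-const 1 1#))
          (R.-‿cong {z R.* R.sum cw} {series 1 (shift 1 S.1# S.* Ŵ)}
            (R.trans {z R.* R.sum cw} {series 1 (shift 1 S.1#) R.* series 1 Ŵ} {series 1 (shift 1 S.1# S.* Ŵ)}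
              (R.*-cong {z} {series 1 (shift 1 S.1#)} {R.sum cw} {series 1 Ŵ} (z≈ 1)
                (R.trans {R.sum cw} {R.sum (λ i → series 1 (const-series (w i)))} {series 1 Ŵ}
                  (R.sum-cong-≋ {x = cw} {y = λ i → series 1 (const-series (w i))} (const-w 1))
                  (R.sym {series 1 Ŵ} {R.sum (λ i → series 1 (const-series (w i)))}
                    (Embedding.ι-sum 1 (λ i → const-series (w i))))))
              (R.sym {series 1 (shift 1 S.1# S.* Ŵ)} {series 1 (shift 1 S.1#) R.* series 1 Ŵ}
                (series-* 1 (shift 1 S.1#) Ŵ)))))
        (R.sym {series 1 (S.1# S.- shift 1 S.1# S.* Ŵ)} {series 1 S.1# R.- series 1 (shift 1 S.1# S.* Ŵ)}
          (Embedding.ι-- 1 S.1# (shift 1 S.1# S.* Ŵ)))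
        where
        Ŵ : Series
        Ŵ = S.sum (λ i → const-series (w i))

      P1≈ : R.sum cw R.≈ P R.1# R.1#
      P1≈ = R.sum-cong-≋ {x = cw} {y = λ i → cw i R.* R.zpow R.1# R.1# (b i)} λ i →
        R.sym {cw i R.* R.zpow R.1# R.1# (b i)} {cw i}
          (R.trans {cw i R.* R.zpow R.1# R.1# (b i)} {cw i R.* R.1#} {cw i}
            (R.*-congˡ {cw i} {R.zpow R.1# R.1# (b i)} {R.1#} (RU.zpow-1 (b i))) (R.*-identityʳ (cw i)))

      κ≈1-zP : κ R.≈ R.1# R.- z R.* P R.1# R.1#
      κ≈1-zP = R.+-congˡ {R.1#} {R.- (z R.* R.sum cw)} {R.- (z R.* P R.1# R.1#)}
        (R.-‿cong {z R.* R.sum cw} {z R.* P R.1# R.1#} (R.*-congˡ {z} {R.sum cw} {P R.1# R.1#} P1≈))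

    1-zP-invertible : R.Invertible (R.1# R.- z R.* P R.1# R.1#)
    1-zP-invertible = RU.invertible-cong {κ} {R.1# R.- z R.* P R.1# R.1#} κ≈1-zP
      (RU.invertible-cong {series 1 (shift 0 u)} {κ} (R.sym {κ} {series 1 (shift 0 u)} κ≈)
        (series-shift-invertible 1 0 {u} (KU.invertible-cong (sym u₀≈1) KU.invertible-1)))
      where
      u : Series
      u = S.1# S.- shift 1 S.1# S.* S.sum (λ i → const-series (w i))
      u₀≈1 : u 0 ≈ 1#
      u₀≈1 = trans (+-congˡ (trans (-‿cong (trans (+-identityʳ _) (zeroˡ _))) -0#≈0#)) (+-identityʳ 1#)

    meander-generating-function : ∀ j →
      ClosedForms R.rawRing X (R.1# R.- z R.* P R.1# R.1#) (T j) j
    meander-generating-function j = RK.closed-forms {c} {R.1# R.- z R.* P R.1# R.1#} {T j} X regular j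
      1-zP-invertible vandermonde-unit difference≈0
      where
      N = suc c ℕ.+ j
      T≈T′ : T j R.≈ T′ N
      T≈T′ = series-cong 1 {λ n → Steps.t rawRing b w n j} {Paths.meanderSeries N}
        λ n → reflexive (≡.sym (Paths.meanderSeries-at j n))
      difference≈0 : (R.1# R.- z R.* P R.1# R.1#) R.* T j R.- RK.interpolant X N R.≈ R.0#
      difference≈0 = R.trans {(R.1# R.- z R.* P R.1# R.1#) R.* T j R.- RK.interpolant X N}
        {κ R.* T′ N R.- RK.interpolant X N} {R.0#}
        (R.+-congʳ {R.- RK.interpolant X N} {(R.1# R.- z R.* P R.1# R.1#) R.* T j} {κ R.* T′ N}
          (R.*-cong {R.1# R.- z R.* P R.1# R.1#} {κ} {T j} {T′ N}
            (R.sym {κ} {R.1# R.- z R.* P R.1# R.1#} κ≈1-zP) T≈T′))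
        (κT≈interpolant N)

module ClosedFormTheorem {a ℓ} (Q : RawRing a ℓ)
  (isCommutativeRing : IsCommutativeRing (RawRing._≈_ Q) (RawRing._+_ Q) (RawRing._*_ Q) (RawRing.-_ Q)
    (RawRing.0# Q) (RawRing.1# Q)) where
  private
    K : CommutativeRing a ℓ
    K = record { isCommutativeRing = isCommutativeRing }
  open PuiseuxSeries Q using (Puiseux; z)
  open RingNotation (PuiseuxSeries.rawRing Q) using (_-_; _*_; 1#)

  closed-forms : IsFieldOfCharacteristic0 K →
    {m : ℕ} (b : Fin m → ℤ) (b-injective : Injective _≡_ _≡_ b)
    (w : Fin m → RawRing.Carrier Q) (w-invertible : ∀ ℓ → RingKit.Invertible K (w ℓ)) →
    let open Steps Q b w using (AreTheSmallSolutions; P; T) in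
    (c : ℕ) → IsMinimum b (ℤ.- (+ c)) → 1 ℕ.≤ c →
    (X : Vector Puiseux c) → AreTheSmallSolutions X → ∀ j →
    ClosedForms (PuiseuxSeries.rawRing Q) X (1# - z * P 1# 1#) (T j) j
  closed-forms isField b b-inj w w-inv (suc c) minimum (s≤s _) =
    MeanderTheorem.meander-generating-function K isField b b-inj w w-inv c minimum

-- Constructive order and units of the real numbers.

module RealProperties {a ℓ₁ ℓ₂} (ℝ : Reals a ℓ₁ ℓ₂) where
  open Reals ℝ using (heytingField; _<_; isStrictPartialOrder; #⇔<⊎>; +-monoˡ-<; *-pos)
  open HeytingField heytingField using (heytingCommutativeRing; _#_; #⇒invertible; invertible⇒#; #-cotrans; tight)

  realRing : CommutativeRing a ℓ₁
  realRing = HeytingCommutativeRing.commutativeRing heytingCommutativeRing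

  open RingKit realRing
  open Units realRing
  module Order = IsStrictPartialOrder isStrictPartialOrder

  private
    x-0≈x : ∀ x → x - 0# ≈ x
    x-0≈x x = trans (+-congˡ -0#≈0#) (+-identityʳ x)

  #0⇒invertible : ∀ {x} → x # 0# → Invertible x
  #0⇒invertible x#0 = invertible-cong (x-0≈x _) (#⇒invertible x#0)

  invertible⇒#0 : ∀ {x} → Invertible x → x # 0#
  invertible⇒#0 inv = invertible⇒# (invertible-cong (sym (x-0≈x _)) inv)

  -- Cotransitivity of `x + y # 0` at the intermediate point y: either `x + y # y`, so x is a unit,
  -- or `y # 0`.
  real-local : ∀ {x y} → Invertible (x + y) → Invertible x ⊎ Invertible y
  real-local {x} {y} inv with #-cotrans (invertible⇒#0 inv) y
  ... | inj₁ x+y#y = inj₁ (invertible-cong (solve 2 (λ x y → (x :+ y) :- y := x) refl x y) (#⇒invertible x+y#y))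
  ... | inj₂ y#0   = inj₂ (#0⇒invertible y#0)

  real-tight : ∀ {x} → ¬ Invertible x → x ≈ 0#
  real-tight ¬inv = proj₁ (tight _ _) (λ x#0 → ¬inv (#0⇒invertible x#0))

  1≉0 : ¬ (1# ≈ 0#)
  1≉0 1≈0 = proj₂ (tight 1# 0#) 1≈0 (invertible⇒#0 invertible-1)

  positive⇒invertible : ∀ {x} → 0# < x → Invertible x
  positive⇒invertible 0<x = #0⇒invertible (Equivalence.from #⇔<⊎> (inj₂ 0<x))

  square-positive : ∀ {x} → Invertible x → 0# < x * x
  square-positive {x} inv with Equivalence.to #⇔<⊎> (invertible⇒#0 inv)
  ... | inj₂ 0<x = *-pos 0<x 0<x
  ... | inj₁ x<0 = Order.<-respʳ-≈ (solve 1 (λ x → (:- x) :* (:- x) := x :* x) refl x) (*-pos 0<-x 0<-x)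
    where
    0<-x : 0# < - x
    0<-x = Order.<-respʳ-≈ (+-identityˡ (- x)) (Order.<-respˡ-≈ (-‿inverseʳ x) (+-monoˡ-< (- x) x<0))

  -- A negative square would be a unit, so x would be a unit too, and then its square is positive.
  square-nonNegative : ∀ x → ¬ (x * x < 0#)
  square-nonNegative x xx<0 = Order.irrefl refl (Order.trans xx<0 (square-positive
    (invertible-factorˡ (#0⇒invertible (Equivalence.from #⇔<⊎> (inj₁ xx<0))))))

  -- In place of trichotomy, cotransitivity of `0 # x` separates `x + y` from 0 or from x. In either
  -- case the unwanted order yields `x + y < x`, that is, `y < 0`.
  positive-+-nonNegative : ∀ {x y} → 0# < x → ¬ (y < 0#) → 0# < x + y
  positive-+-nonNegative {x} {y} 0<x y≮0 with #-cotrans (Equivalence.from #⇔<⊎> (inj₁ 0<x)) (x + y)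
  ... | inj₁ 0#x+y with Equivalence.to #⇔<⊎> 0#x+y
  ...   | inj₁ 0<x+y = 0<x+y
  ...   | inj₂ x+y<0 = contradiction (below (Order.trans x+y<0 0<x)) y≮0
    where
    below : x + y < x → y < 0#
    below x+y<x = Order.<-respˡ-≈ (solve 2 (λ x y → (x :+ y) :+ (:- x) := y) refl x y)
      (Order.<-respʳ-≈ (-‿inverseʳ x) (+-monoˡ-< (- x) x+y<x))
  positive-+-nonNegative {x} {y} 0<x y≮0 | inj₂ x+y#x with Equivalence.to #⇔<⊎> x+y#x
  ...   | inj₂ x<x+y = Order.trans 0<x x<x+y
  ...   | inj₁ x+y<x = contradiction (Order.<-respˡ-≈ (solve 2 (λ x y → (x :+ y) :+ (:- x) := y) refl x y)
      (Order.<-respʳ-≈ (-‿inverseʳ x) (+-monoˡ-< (- x) x+y<x))) y≮0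

  0<1 : 0# < 1#
  0<1 = Order.<-respʳ-≈ (*-identityˡ 1#) (square-positive invertible-1)

  multiple-positive : ∀ n → 0# < suc n · 1#
  multiple-positive zero    = Order.<-respʳ-≈ (sym (+-identityʳ 1#)) 0<1
  multiple-positive (suc n) = positive-+-nonNegative 0<1
    (λ n<0 → Order.irrefl refl (Order.trans (multiple-positive n) n<0))

-- The complex numbers as a constructive field of characteristic 0.

module ComplexProperties {a ℓ₁ ℓ₂} (ℝ : Reals a ℓ₁ ℓ₂) where
  open RealProperties ℝ
  open Complex ℝ
  open RingKit realRing
  private
    module RU = Units realRing

  complexRing : CommutativeRing a ℓ₁
  complexRing = record
    { RawRing ℂ-rawRing
    ; isCommutativeRing = record
      { isRing = record
        { +-isAbelianGroup = record
          { isGroup = record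
            { isMonoid = record
              { isSemigroup = record
                { isMagma = record
                  { isEquivalence = record
                    { refl = refl , refl ; sym = λ (p , q) → sym p , sym q
                    ; trans = λ (p , q) (r , s) → trans p r , trans q s }
                  ; ∙-cong = λ (p , q) (r , s) → +-cong p r , +-cong q s }
                ; assoc = λ _ _ _ → +-assoc _ _ _ , +-assoc _ _ _ }
              ; identity = (λ _ → +-identityˡ _ , +-identityˡ _) , (λ _ → +-identityʳ _ , +-identityʳ _) }
            ; inverse = (λ _ → -‿inverseˡ _ , -‿inverseˡ _) , (λ _ → -‿inverseʳ _ , -‿inverseʳ _)
            ; ⁻¹-cong = λ (p , q) → -‿cong p , -‿cong q }
          ; comm = λ _ _ → +-comm _ _ , +-comm _ _ }
        ; *-cong = λ (p , q) (r , s) →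
            +-cong (*-cong p r) (-‿cong (*-cong q s)) , +-cong (*-cong p s) (*-cong q r)
        ; *-assoc = λ (x +i y) (u +i v) (s +i t) →
            solve 6 (λ x y u v s t → (x :* u :- y :* v) :* s :- (x :* v :+ y :* u) :* t
              := x :* (u :* s :- v :* t) :- y :* (u :* t :+ v :* s)) refl x y u v s t ,
            solve 6 (λ x y u v s t → (x :* u :- y :* v) :* t :+ (x :* v :+ y :* u) :* s
              := x :* (u :* t :+ v :* s) :+ y :* (u :* s :- v :* t)) refl x y u v s t
        ; *-identity =
            (λ (x +i y) → solve 2 (λ x y → con (+ 1) :* x :- con (+ 0) :* y := x) refl x y ,
                          solve 2 (λ x y → con (+ 1) :* y :+ con (+ 0) :* x := y) refl x y) ,
            (λ (x +i y) → solve 2 (λ x y → x :* con (+ 1) :- y :* con (+ 0) := x) refl x y ,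
                          solve 2 (λ x y → x :* con (+ 0) :+ y :* con (+ 1) := y) refl x y)
        ; distrib =
            (λ (x +i y) (u +i v) (s +i t) →
              solve 6 (λ x y u v s t → x :* (u :+ s) :- y :* (v :+ t)
                := (x :* u :- y :* v) :+ (x :* s :- y :* t)) refl x y u v s t ,
              solve 6 (λ x y u v s t → x :* (v :+ t) :+ y :* (u :+ s)
                := (x :* v :+ y :* u) :+ (x :* t :+ y :* s)) refl x y u v s t) ,
            (λ (x +i y) (u +i v) (s +i t) →
              solve 6 (λ x y u v s t → (u :+ s) :* x :- (v :+ t) :* y
                := (u :* x :- v :* y) :+ (s :* x :- t :* y)) refl x y u v s t ,
              solve 6 (λ x y u v s t → (u :+ s) :* y :+ (v :+ t) :* x
                := (u :* y :+ v :* x) :+ (s :* y :+ t :* x)) refl x y u v s t) }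
      ; *-comm = λ (x +i y) (u +i v) →
          solve 4 (λ x y u v → x :* u :- y :* v := u :* x :- v :* y) refl x y u v ,
          solve 4 (λ x y u v → x :* v :+ y :* u := u :* y :+ v :* x) refl x y u v } }

  private
    module C = RingKit complexRing
    module CU = Units complexRing

  norm : ℂ → Carrier
  norm (x +i y) = x * x + y * y

  norm-invertible⇒invertible : ∀ α → Invertible (norm α) → C.Invertible α
  norm-invertible⇒invertible (x +i y) (n , _ , N*n≈1) = CU.invertible {x +i y} {(x * n) +i (- (y * n))}
    ( trans (solve 3 (λ x y n → x :* (x :* n) :- y :* (:- (y :* n)) := (x :* x :+ y :* y) :* n) refl x y n) N*n≈1
    , solve 3 (λ x y n → x :* (:- (y :* n)) :+ y :* (x :* n) := con (+ 0)) refl x y n )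

  -- The norm is multiplicative, so the norm of the inverse is an inverse of the norm.
  invertible⇒norm-invertible : ∀ α → C.Invertible α → Invertible (norm α)
  invertible⇒norm-invertible (x +i y) ((u +i v) , _ , (re≈1 , im≈0)) = RU.invertible {x * x + y * y}
      {u * u + v * v} (begin
    (x * x + y * y) * (u * u + v * v)
      ≈⟨ solve 4 (λ x y u v → (x :* x :+ y :* y) :* (u :* u :+ v :* v) :=
           (x :* u :- y :* v) :* (x :* u :- y :* v) :+ (x :* v :+ y :* u) :* (x :* v :+ y :* u)) refl x y u v ⟩
    (x * u - y * v) * (x * u - y * v) + (x * v + y * u) * (x * v + y * u)
      ≈⟨ +-cong (*-cong re≈1 re≈1) (*-cong im≈0 im≈0) ⟩
    1# * 1# + 0# * 0#
      ≈⟨ solve 0 (con (+ 1) :* con (+ 1) :+ con (+ 0) :* con (+ 0) := con (+ 1)) refl ⟩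
    1# ∎)

  re-invertible⇒invertible : ∀ {x y} → Invertible x → C.Invertible (x +i y)
  re-invertible⇒invertible {x} {y} inv = norm-invertible⇒invertible (x +i y)
    (positive⇒invertible (positive-+-nonNegative (square-positive inv) (square-nonNegative y)))

  im-invertible⇒invertible : ∀ {x y} → Invertible y → C.Invertible (x +i y)
  im-invertible⇒invertible {x} {y} inv = norm-invertible⇒invertible (x +i y)
    (RU.invertible-cong (+-comm _ _)
      (positive⇒invertible (positive-+-nonNegative (square-positive inv) (square-nonNegative x))))

  complexField : IsFieldOfCharacteristic0 complexRing
  complexField = record
    { 1≉0              = λ (1≈0 , _) → 1≉0 1≈0
    ; local            = local
    ; tight            = λ ¬inv → real-tight (λ inv → ¬inv (re-invertible⇒invertible inv)) ,
                                  real-tight (λ inv → ¬inv (im-invertible⇒invertible inv))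
    ; characteristic-0 = λ n → re-invertible⇒invertible
        (RU.invertible-cong (sym (re-multiple (suc n))) (positive⇒invertible (multiple-positive n)))
    }
    where
    -- Locality of ℝ is used twice: first for the norm of α + β, a sum of two squares, then for
    -- whichever of `x + u` and `y + v` turns out to be a unit.
    local : ∀ {α β} → C.Invertible (α C.+ β) → C.Invertible α ⊎ C.Invertible β
    local {x +i y} {u +i v} inv = Sum.[ re , im ]′
      (real-local {(x + u) * (x + u)} {(y + v) * (y + v)} (invertible⇒norm-invertible ((x + u) +i (y + v)) inv))
      where
      re : Invertible ((x + u) * (x + u)) → C.Invertible (x +i y) ⊎ C.Invertible (u +i v)
      re inv = Sum.map (re-invertible⇒invertible {x} {y}) (re-invertible⇒invertible {u} {v})
        (real-local (RU.invertible-factorˡ {x + u} {x + u} inv))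
      im : Invertible ((y + v) * (y + v)) → C.Invertible (x +i y) ⊎ C.Invertible (u +i v)
      im inv = Sum.map (im-invertible⇒invertible {x} {y}) (im-invertible⇒invertible {u} {v})
        (real-local (RU.invertible-factorˡ {y + v} {y + v} inv))
    re-multiple : ∀ n → ℂ.re (n C.· C.1#) ≈ n · 1#
    re-multiple zero    = refl
    re-multiple (suc n) = +-congˡ (re-multiple n)

  positive-real-invertible : ∀ {x} → Reals._<_ ℝ (Reals.0# ℝ) x → C.Invertible (fromℝ x)
  positive-real-invertible 0<x = re-invertible⇒invertible (positive⇒invertible 0<x)

-- Comparing two syntactically different but definitionally equal expressions
-- over Puiseux series also takes exponential time.  In the lemmas below F, G
-- and s are therefore inferred from the goal; the reflexivity proofs are
-- instance arguments, as these are solved only after that unification.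
record Same {i a} {I : Set i} {A : Set a} (f g : I → A) : Set (i ⊔ a) where
  field same : ∀ x → f x ≡ g x

instance
  same-refl : ∀ {i a} {I : Set i} {A : Set a} {f : I → A} → Same f f
  same-refl = record { same = λ _ → ≡.refl }

module Restatement {a ℓ} (W : RawRing a ℓ)
  (isCommutativeRing : IsCommutativeRing (RawRing._≈_ W) (RawRing._+_ W) (RawRing._*_ W) (RawRing.-_ W)
    (RawRing.0# W) (RawRing.1# W)) where
  open RingNotation W
  private
    R : CommutativeRing a ℓ
    R = record { isCommutativeRing = isCommutativeRing }
    module R = RingKit R
    module RU = Units R

  vandermondeRow : ∀ {n} → Vector Carrier n → Fin n → Carrier
  vandermondeRow X i = product λ k → if does (i Fin.<? k) then X i - X k else 1#

  module _ {c : ℕ} {X : Vector Carrier c} {κ t : Carrier} {j : ℕ} (cf : ClosedForms W X κ t j) where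
    open ClosedForms cf using (V-invertible; κ⁻¹; V⁻¹; vandermonde-form; homogeneous-form)

    restate-vandermonde : ∀ {F} {{_ : Same (vandermondeRow X) F}} → Invertible (product F)
    restate-vandermonde {{row≡F}} =
      RU.invertible-cong (R.product-cong λ i → R.reflexive (Same.same row≡F i)) V-invertible

    restate-vandermonde-form : ∀ {F}
      {{_ : Same (λ i → vandermonde (X [ i ]≔1) * V⁻¹ * X i ^ (c ℕ.+ j)) F}} → t ≈ κ⁻¹ * (1# - sum F)
    restate-vandermonde-form {{f≡F}} = R.trans vandermonde-form
      (R.*-congˡ (R.+-congˡ (R.-‿cong (R.sum-cong-≋ λ i → R.reflexive (Same.same f≡F i)))))

    restate-homogeneous-form : ∀ {F G} {{_ : Same (λ i → h (suc (toℕ i)) X) F}} {{_ : Same (λ i → 1# - X i) G}} →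
      t ≈ κ⁻¹ * (h 0 X + sum {j} F) * product G
    restate-homogeneous-form {{h≡F}} {{d≡G}} = R.trans homogeneous-form
      (R.*-cong (R.*-congˡ (R.+-congˡ (R.sum-cong-≋ λ i → R.reflexive (Same.same h≡F i))))
                (R.product-cong λ i → R.reflexive (Same.same d≡G i)))

module CoefficientRestatement {a ℓ} (Q : RawRing a ℓ)
  (isCommutativeRing : IsCommutativeRing (RawRing._≈_ Q) (RawRing._+_ Q) (RawRing._*_ Q) (RawRing.-_ Q)
    (RawRing.0# Q) (RawRing.1# Q)) where
  open PuiseuxSeries Q
  open Puiseux
  open RingNotation (PuiseuxSeries.rawRing Q)
  private
    K : CommutativeRing a ℓ
    K = record { isCommutativeRing = isCommutativeRing }
    module R = RingKit (PuiseuxRing.puiseuxRing K)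
    module RU = Units (PuiseuxRing.puiseuxRing K)

  _⟨_⟩ : Puiseux → (ℕ → RawRing.Carrier Q) → Puiseux
  f ⟨ s ⟩ = record { den = den f ; pole = pole f ; coeff = s }

  restate-κ : ∀ {c m} {X : Vector Puiseux c} {t j} {f F : Vector Puiseux m} {s} {{_ : Same f F}}
    {{_ : Same (coeff (1# - z * sum F)) s}} →
    ClosedForms (PuiseuxSeries.rawRing Q) X (1# - z * sum f) t j → Invertible ((1# - z * sum F) ⟨ s ⟩)
  restate-κ {f = f} {F} {s} {{f≡F}} {{κ≡s}} cf =
    RU.invertible-cong {1# - z * sum f} {(1# - z * sum F) ⟨ s ⟩}
      (R.trans {1# - z * sum f} {1# - z * sum F} {(1# - z * sum F) ⟨ s ⟩}
        (R.+-congˡ {1#} { - (z * sum f)} { - (z * sum F)} (R.-‿cong {z * sum f} {z * sum F}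
          (R.*-congˡ {z} {sum f} {sum F}
            (R.sum-cong-≋ {x = f} {y = F} λ i → R.reflexive (Same.same f≡F i)))))
        (PuiseuxRing.coefficients-≈ K (1# - z * sum F) ((1# - z * sum F) ⟨ s ⟩) ≡.refl ≡.refl
          λ n → CommutativeRing.reflexive K (Same.same κ≡s n)))
      (ClosedForms.κ-invertible cf)

-- The closed forms for positive real weights, over ℂ.

module ComplexMeanders {a ℓ₁ ℓ₂} (ℝ : Reals a ℓ₁ ℓ₂) {m : ℕ} (b : Fin m → ℤ) (b-injective : Injective _≡_ _≡_ b)
  (w : Fin m → Reals.Carrier ℝ) (0<w : ∀ ℓ → Reals._<_ ℝ (Reals.0# ℝ) (w ℓ)) where
  open ComplexProperties ℝ
  open Complex ℝ using (ℂ-rawRing; fromℝ)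
  open PuiseuxSeries ℂ-rawRing using (Puiseux; z)
  open RingNotation (PuiseuxSeries.rawRing ℂ-rawRing) using (_-_; _*_; 1#)
  open Steps ℂ-rawRing b (λ ℓ → fromℝ (w ℓ)) using (AreTheSmallSolutions; P; T)

  abstract
    complex-closed-forms : (c : ℕ) → IsMinimum b (-ℤ (+ c)) → 1 ≤ℕ c →
      (X : Vector Puiseux c) → AreTheSmallSolutions X → ∀ j →
      ClosedForms (PuiseuxSeries.rawRing ℂ-rawRing) X (1# - z * P 1# 1#) (T j) j
    complex-closed-forms = ClosedFormTheorem.closed-forms ℂ-rawRing
      (CommutativeRing.isCommutativeRing complexRing) complexField b b-injective
      (λ ℓ → fromℝ (w ℓ)) (λ ℓ → positive-real-invertible (0<w ℓ))

corollary3 : ∀ {a ℓ₁ ℓ₂} (ℝ : Reals a ℓ₁ ℓ₂) →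
    (m : ℕ) (b : Fin m → ℤ) → Injective _≡_ _≡_ b →
    (w : Fin m → Reals.Carrier ℝ) → (∀ ℓ → Reals._<_ ℝ (Reals.0# ℝ) (w ℓ)) →
    (c : ℕ) → IsMinimum b (-ℤ (+ c)) → 1 ≤ℕ c →
    let open WeightedPaths ℝ b w in
    (X : Vector Puiseux c) → AreTheSmallSolutions X →
    (j : ℕ) →
    Σ[ (T , _) ∈ Invertible (1# - z * P 1# 1#) ]
    Σ[ (V⁻¹ , _) ∈ Invertible (vandermonde X) ]
    (T[ j ] ≈ T * (1# - sum (λ ℓ → vandermonde (X [ ℓ ]≔1) * V⁻¹ * X ℓ ^ (c +ℕ j))))
    × (T[ j ] ≈ T * sum {suc j} (λ f → h (toℕ f) X) * product (λ ℓ → 1# - X ℓ))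
corollary3 ℝ m b b-injective w 0<w c minimum 1≤c X solutions j =
  restate-κ {f = f} closed , restate-vandermonde closed ,
  restate-vandermonde-form closed , restate-homogeneous-form closed
  where
  Q = Complex.ℂ-rawRing ℝ
  ℂ = ComplexProperties.complexRing ℝ
  open CoefficientRestatement Q (CommutativeRing.isCommutativeRing ℂ)
  open Restatement (PuiseuxSeries.rawRing Q) (CommutativeRing.isCommutativeRing (PuiseuxRing.puiseuxRing ℂ))
  open RingNotation (PuiseuxSeries.rawRing Q) using (_*_; zpow; 1#)
  closed = ComplexMeanders.complex-closed-forms ℝ b b-injective w 0<w c minimum 1≤c X solutions j
  f : Fin m → PuiseuxSeries.Puiseux Q
  f i = PuiseuxSeries.constant Q (Complex.fromℝ ℝ (w i)) * zpow 1# 1# (b i)
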